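{- Let $T$ be a locally finite rooted tree, $\ell$ a length function on $T$, and $\chi$ a capacity function on $T$, and let $\Gamma$ be the metric realization of $(T,\ell)$. Then the sequence $(a_n)$ produced by the greedy procedure with capacities depends only on the pair $(\Gamma,\chi)$. That is: if $(T_1,\ell_1,\chi_1)$ and $(T_2,\ell_2,\chi_2)$ are two such triples for which there is a root-preserving isometry between the metric realizations of $(T_1,\ell_1)$ and $(T_2,\ell_2)$ which carries $\chi_1$ to $\chi_2$ under the induced bijection of leaves (possibly the two triples being equal), then any two sequences produced by the greedy procedure with capacities for these triples, each continued as long as possible, yield sequences $(a_n)$ and $(a_n')$ of the same (finite or infinite) length with $a_n=a'_n$ for every index $n$.
   Context: A rooted tree $T$ has root $\mathfrak r$ and edges oriented away from the root; $E(T)$ is the set of oriented edges. A length function is a map $\ell:E(T)\to\mathbb R_{+}$ with (strictly) positive values. The metric realization of $(T,\ell)$ is the rooted metric tree obtained by replacing each edge $e$ with an interval of length $\ell(e)$, with the path metric. A leaf of $T$ is a vertex $v\ne\mathfrak r$ of valence one; if $T$ is the single vertex $\mathfrak r$, then $\mathfrak r$ is a leaf. $L(T)$ is the set of leaves. A capacity function is a map $\chi:L(T)\to\{1,2,3,\dots\}\cup\{\infty\}$. The boundary $\partial T$ is the set of infinite oriented paths starting at $\mathfrak r$; the extended boundary $\widetilde\partial T$ is the union of $\partial T$ and the set of oriented paths from $\mathfrak r$ to a leaf (the latter identified with leaves). For $\rho,\tau\in\widetilde\partial T$ (with $\rho\ne\tau$ if both lie in $\partial T$), $\langle\rho,\tau\rangle:=\sum_{e\in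 E(\rho)\cap E(\tau)}\ell(e)$, where $E(\rho)$ is the set of edges of $\rho$. Greedy procedure with capacities: choose $\rho_0\in\widetilde\partial T$ arbitrarily, $a_0=0$. Given $\rho_0,\dots,\rho_{n-1}$, call $\rho\in\widetilde\partial T$ admissible if either $\rho\in\partial T$ and $\rho\notin\{\rho_0,\dots,\rho_{n-1}\}$, or $\rho$ is a leaf $v$ which appears strictly fewer than $\chi(v)$ times in $\rho_0,\dots,\rho_{n-1}$. Choose, if possible, $\rho_n$ arbitrarily among the admissible $\rho$ minimizing $\sum_{j=0}^{n-1}\langle\rho,\rho_j\rangle$, and set $a_n:=\sum_{j=0}^{n-1}\langle\rho_n,\rho_j\rangle$. If there is no admissible $\rho$, the procedure stops. -}

module Defs where

open import Algebra.Bundles using (CommutativeMonoid)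
import Algebra.Properties.CommutativeSemigroup
import Algebra.Properties.Group
open import Data.Empty using (⊥)
open import Data.Fin using (toℕ)
open import Data.Fin.Properties using (toℕ<n)
open import Data.List using (List; length; map; foldr)
open import Data.List.Membership.Propositional using (_∈_)
open import Data.List.Relation.Unary.Unique.Propositional using (Unique)
open import Data.Nat as ℕ using (ℕ; suc)
import Data.Nat.Properties as ℕ
open import Data.Product using (Σ; _×_; _,_; ∃; ∃₂; ∃!; proj₁; proj₂)
open import Data.Rational as ℚ using (ℚ; 0ℚ; ½)
import Data.Rational.Properties as ℚ
open import Data.Sum using (_⊎_; inj₁; inj₂)
open import Data.Unit using (⊤; tt)
import Data.Vec.Functional as Vector
open Vector using (Vector)
open import Function using (_⇔_)
open import Relation.Binary.Construct.Closure.ReflexiveTransitive using (Star; _◅_)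
open import Relation.Binary.PropositionalEquality
  using (_≡_; _≢_; refl; sym; cong; subst; module ≡-Reasoning)
open import Relation.Nullary using (¬_)

-- Real numbers: Cauchy sequences of rationals, considered up to _≈ᴿ_.

Cauchy : (ℕ → ℚ) → Set
Cauchy x = ∀ δ → 0ℚ ℚ.< δ →
  ∃ λ N → ∀ m n → N ℕ.≤ m → N ℕ.≤ n → ℚ.∣ x m ℚ.- x n ∣ ℚ.< δ

record ℝ : Set where
  constructor mkℝ
  field
    seq    : ℕ → ℚ
    cauchy : Cauchy seq
open ℝ

infix 4 _≈ᴿ_ _≤ᴿ_ _<ᴿ_

_≈ᴿ_ : ℝ → ℝ → Set
x ≈ᴿ y = ∀ δ → 0ℚ ℚ.< δ →
  ∃ λ N → ∀ n → N ℕ.≤ n → ℚ.∣ seq x n ℚ.- seq y n ∣ ℚ.< δ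

_≤ᴿ_ : ℝ → ℝ → Set
x ≤ᴿ y = ∀ δ → 0ℚ ℚ.< δ →
  ∃ λ N → ∀ n → N ℕ.≤ n → seq x n ℚ.< seq y n ℚ.+ δ

_<ᴿ_ : ℝ → ℝ → Set
x <ᴿ y = ∃ λ δ → 0ℚ ℚ.< δ ×
  ∃ λ N → ∀ n → N ℕ.≤ n → seq x n ℚ.+ δ ℚ.≤ seq y n

0ᴿ : ℝ
0ᴿ = mkℝ (λ _ → 0ℚ) (λ δ 0<δ → 0 , λ _ _ _ _ → 0<δ)

private
  open Algebra.Properties.Group ℚ.+-0-group
    using (//-rightDividesˡ; //-rightDividesʳ; ⁻¹-anti-homo-//)
  open Algebra.Properties.CommutativeSemigroup
    (CommutativeMonoid.commutativeSemigroup ℚ.+-0-commutativeMonoid)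
    using (interchange)

  half+half : ∀ p → ½ ℚ.* p ℚ.+ ½ ℚ.* p ≡ p
  half+half p = begin
    ½ ℚ.* p ℚ.+ ½ ℚ.* p ≡⟨ ℚ.*-distribʳ-+ p ½ ½ ⟨
    (½ ℚ.+ ½) ℚ.* p     ≡⟨ ℚ.*-identityˡ p ⟩
    p                   ∎
    where open ≡-Reasoning

  0<half : ∀ {p} → 0ℚ ℚ.< p → 0ℚ ℚ.< ½ ℚ.* p
  0<half {p} 0<p =
    subst (ℚ._< ½ ℚ.* p) (ℚ.*-zeroʳ ½) (ℚ.*-monoʳ-<-pos ½ 0<p)

  difference-of-sums : ∀ a b c d → (a ℚ.+ b) ℚ.- (c ℚ.+ d) ≡ (a ℚ.- c) ℚ.+ (b ℚ.- d)
  difference-of-sums a b c d = begin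
    (a ℚ.+ b) ℚ.- (c ℚ.+ d)            ≡⟨ cong (a ℚ.+ b ℚ.+_) (ℚ.neg-distrib-+ c d) ⟩
    (a ℚ.+ b) ℚ.+ (ℚ.- c ℚ.+ ℚ.- d)    ≡⟨ interchange a b (ℚ.- c) (ℚ.- d) ⟩
    (a ℚ.- c) ℚ.+ (b ℚ.- d)            ∎
    where open ≡-Reasoning

  neg-distance : ∀ p q → ℚ.∣ ℚ.- p ℚ.- ℚ.- q ∣ ≡ ℚ.∣ p ℚ.- q ∣
  neg-distance p q = begin
    ℚ.∣ ℚ.- p ℚ.- ℚ.- q ∣   ≡⟨ cong ℚ.∣_∣ (ℚ.neg-distrib-+ p (ℚ.- q)) ⟨
    ℚ.∣ ℚ.- (p ℚ.- q) ∣     ≡⟨ ℚ.∣-p∣≡∣p∣ (p ℚ.- q) ⟩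
    ℚ.∣ p ℚ.- q ∣           ∎
    where open ≡-Reasoning

  one-sided : ∀ p q → ℚ.∣ p ∣ ℚ.- ℚ.∣ q ∣ ℚ.≤ ℚ.∣ p ℚ.- q ∣
  one-sided p q = begin
    ℚ.∣ p ∣ ℚ.- ℚ.∣ q ∣
      ≡⟨ cong (λ r → ℚ.∣ r ∣ ℚ.- ℚ.∣ q ∣) (//-rightDividesˡ q p) ⟨
    ℚ.∣ (p ℚ.- q) ℚ.+ q ∣ ℚ.- ℚ.∣ q ∣
      ≤⟨ ℚ.+-monoˡ-≤ (ℚ.- ℚ.∣ q ∣) (ℚ.∣p+q∣≤∣p∣+∣q∣ (p ℚ.- q) q) ⟩
    (ℚ.∣ p ℚ.- q ∣ ℚ.+ ℚ.∣ q ∣) ℚ.- ℚ.∣ q ∣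
      ≡⟨ //-rightDividesʳ ℚ.∣ q ∣ ℚ.∣ p ℚ.- q ∣ ⟩
    ℚ.∣ p ℚ.- q ∣ ∎
    where open ℚ.≤-Reasoning

  abs-distance : ∀ p q → ℚ.∣ ℚ.∣ p ∣ ℚ.- ℚ.∣ q ∣ ∣ ℚ.≤ ℚ.∣ p ℚ.- q ∣
  abs-distance p q with ℚ.∣p∣≡p∨∣p∣≡-p (ℚ.∣ p ∣ ℚ.- ℚ.∣ q ∣)
  ... | inj₁ eq = subst (ℚ._≤ ℚ.∣ p ℚ.- q ∣) (sym eq) (one-sided p q)
  ... | inj₂ eq = begin
    ℚ.∣ ℚ.∣ p ∣ ℚ.- ℚ.∣ q ∣ ∣   ≡⟨ eq ⟩
    ℚ.- (ℚ.∣ p ∣ ℚ.- ℚ.∣ q ∣)   ≡⟨ ⁻¹-anti-homo-// ℚ.∣ p ∣ ℚ.∣ q ∣ ⟩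
    ℚ.∣ q ∣ ℚ.- ℚ.∣ p ∣         ≤⟨ one-sided q p ⟩
    ℚ.∣ q ℚ.- p ∣               ≡⟨ cong ℚ.∣_∣ (⁻¹-anti-homo-// p q) ⟨
    ℚ.∣ ℚ.- (p ℚ.- q) ∣         ≡⟨ ℚ.∣-p∣≡∣p∣ (p ℚ.- q) ⟩
    ℚ.∣ p ℚ.- q ∣               ∎
    where open ℚ.≤-Reasoning

infixl 6 _+ᴿ_ _-ᴿ_

_+ᴿ_ : ℝ → ℝ → ℝ
x +ᴿ y = mkℝ (λ n → seq x n ℚ.+ seq y n) λ δ 0<δ →
  let M , x-close = cauchy x (½ ℚ.* δ) (0<half 0<δ)
      N , y-close = cauchy y (½ ℚ.* δ) (0<half 0<δ)
  in M ℕ.⊔ N , λ m n N≤m N≤n → begin-strict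
    ℚ.∣ (seq x m ℚ.+ seq y m) ℚ.- (seq x n ℚ.+ seq y n) ∣
      ≡⟨ cong ℚ.∣_∣ (difference-of-sums (seq x m) (seq y m) (seq x n) (seq y n)) ⟩
    ℚ.∣ (seq x m ℚ.- seq x n) ℚ.+ (seq y m ℚ.- seq y n) ∣
      ≤⟨ ℚ.∣p+q∣≤∣p∣+∣q∣ (seq x m ℚ.- seq x n) (seq y m ℚ.- seq y n) ⟩
    ℚ.∣ seq x m ℚ.- seq x n ∣ ℚ.+ ℚ.∣ seq y m ℚ.- seq y n ∣
      <⟨ ℚ.+-mono-< (x-close m n (ℕ.m⊔n≤o⇒m≤o M N N≤m) (ℕ.m⊔n≤o⇒m≤o M N N≤n))
                    (y-close m n (ℕ.m⊔n≤o⇒n≤o M N N≤m) (ℕ.m⊔n≤o⇒n≤o M N N≤n)) ⟩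
    ½ ℚ.* δ ℚ.+ ½ ℚ.* δ
      ≡⟨ half+half δ ⟩
    δ ∎
  where open ℚ.≤-Reasoning

-ᴿ_ : ℝ → ℝ
-ᴿ x = mkℝ (λ n → ℚ.- seq x n) λ δ 0<δ →
  let N , close = cauchy x δ 0<δ
  in N , λ m n N≤m N≤n →
       subst (ℚ._< δ) (sym (neg-distance (seq x m) (seq x n))) (close m n N≤m N≤n)

_-ᴿ_ : ℝ → ℝ → ℝ
x -ᴿ y = x +ᴿ (-ᴿ y)

∣_∣ᴿ : ℝ → ℝ
∣ x ∣ᴿ = mkℝ (λ n → ℚ.∣ seq x n ∣) λ δ 0<δ →
  let N , close = cauchy x δ 0<δ
  in N , λ m n N≤m N≤n →
       ℚ.≤-<-trans (abs-distance (seq x m) (seq x n)) (close m n N≤m N≤n)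

-- A finite set given as a predicate, together with a list of its elements
-- without repetition.
Enumeration : {A : Set} → (A → Set) → Set
Enumeration P = ∃ λ xs → Unique xs × (∀ x → x ∈ xs ⇔ P x)

data ℕ∞ : Set where
  fin : ℕ → ℕ∞
  ∞   : ℕ∞

infix 4 _≤∞_ _<∞_

_≤∞_ : ℕ → ℕ∞ → Set
m ≤∞ fin n = m ℕ.≤ n
m ≤∞ ∞     = ⊤

_<∞_ : ℕ → ℕ∞ → Set
m <∞ k = suc m ≤∞ k

≤-≤∞-trans : ∀ {m n} k → m ℕ.≤ n → n ≤∞ k → m ≤∞ k
≤-≤∞-trans (fin _) = ℕ.≤-trans
≤-≤∞-trans ∞       = λ _ _ → tt

-- A tree whose edges are oriented away from the root: every vertex is reached
-- from the root by exactly one oriented path.  In particular there is at most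
-- one edge between two vertices.
record RootedTree : Set₁ where
  infix 4 _⟶_
  field
    Vertex      : Set
    _⟶_         : Vertex → Vertex → Set
    root        : Vertex
    path        : ∀ v → Star _⟶_ root v
    path-unique : ∀ {v} (p q : Star _⟶_ root v) → p ≡ q

module _ (T : RootedTree) where
  open RootedTree T

  Edge : Set
  Edge = ∃₂ _⟶_

  source target : Edge → Vertex
  source (u , _ , _) = u
  target (_ , v , _) = v

  Incident : Vertex → Edge → Set
  Incident v e = source e ≡ v ⊎ target e ≡ v

  LocallyFinite : Set
  LocallyFinite = ∀ v → Enumeration (Incident v)

  IsLeaf : Vertex → Set
  IsLeaf v = (v ≢ root × ∃! _≡_ (Incident v))
           ⊎ (v ≡ root × (∀ u → u ≡ root))

  -- The proof is irrelevant, so that leaves are equal as soon as the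
  -- underlying vertices are.
  record Leaf : Set where
    constructor mkLeaf
    field
      vertex  : Vertex
      .isLeaf : IsLeaf vertex

  record LengthFunction : Set where
    field
      len      : Edge → ℝ
      positive : ∀ e → 0ᴿ <ᴿ len e

  record CapacityFunction : Set where
    field
      cap      : Leaf → ℕ∞
      positive : ∀ v → 0 <∞ cap v

  record Ray : Set where
    field
      at    : ℕ → Vertex
      start : at 0 ≡ root
      step  : ∀ n → at n ⟶ at (suc n)

  data ExtendedBoundary : Set where
    ray  : Ray → ExtendedBoundary
    leaf : Leaf → ExtendedBoundary

  -- Rays are compared pointwise; there is no choice for the edges between
  -- given vertices.
  infix 4 _≋_
  _≋_ : ExtendedBoundary → ExtendedBoundary → Set
  ray ρ  ≋ ray τ  = ∀ n → Ray.at ρ n ≡ Ray.at τ n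
  leaf v ≋ leaf w = v ≡ w
  _      ≋ _      = ⊥

  infix 4 _∈ₚ_
  data _∈ₚ_ (e : Edge) : ∀ {u v} → Star _⟶_ u v → Set where
    here  : ∀ {u v w} {s : u ⟶ v} {p : Star _⟶_ v w} →
            e ≡ (u , v , s) → e ∈ₚ (s ◅ p)
    there : ∀ {u v w} {s : u ⟶ v} {p : Star _⟶_ v w} →
            e ∈ₚ p → e ∈ₚ (s ◅ p)

  E⟨_⟩ : ExtendedBoundary → Edge → Set
  E⟨ ray ρ  ⟩ e = ∃ λ n → e ≡ (Ray.at ρ n , Ray.at ρ (suc n) , Ray.step ρ n)
  E⟨ leaf v ⟩ e = e ∈ₚ path (Leaf.vertex v)

module _ {T : RootedTree} (ℓ : LengthFunction T) where
  open RootedTree T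
  open LengthFunction ℓ

  -- The disjoint union of the vertices and of one interval [0 , len e] for
  -- each edge e.  The end points of the intervals are glued to the vertices by
  -- the metric: points at distance 0 represent the same point of the metric
  -- realization.
  data Point : Set where
    vertex : Vertex → Point
    inside : (e : Edge T) (t : ℝ) → 0ᴿ ≤ᴿ t → t ≤ᴿ len e → Point

  -- The coordinates that a point has on the closed interval of an edge.
  data Coordinate (e : Edge T) : Point → ℝ → Set where
    at-source : Coordinate e (vertex (source T e)) 0ᴿ
    at-target : Coordinate e (vertex (target T e)) (len e)
    at-inside : ∀ {t} (0≤t : 0ᴿ ≤ᴿ t) (t≤ℓ : t ≤ᴿ len e) →
                Coordinate e (inside e t 0≤t t≤ℓ) t

  -- Walk p q d: a piecewise linear path of length d from p to q, each piece of
  -- which stays in the closed interval of a single edge.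
  data Walk : Point → Point → ℝ → Set where
    done : ∀ {p} → Walk p p 0ᴿ
    move : ∀ {e p q r s t d} → Coordinate e p s → Coordinate e q t →
           Walk q r d → Walk p r (∣ s -ᴿ t ∣ᴿ +ᴿ d)

  -- The path metric: d is the infimum of the lengths of paths from p to q.
  record Distance (p q : Point) (d : ℝ) : Set where
    field
      lower    : ∀ {c} → Walk p q c → d ≤ᴿ c
      greatest : ∀ b → (∀ {c} → Walk p q c → b ≤ᴿ c) → b ≤ᴿ d

  SamePoint : Point → Point → Set
  SamePoint p q = Distance p q 0ᴿ

  -- c = ⟨ρ , τ⟩.  For equal rays the set of common edges is infinite and there
  -- is no such c.
  Pairing : ExtendedBoundary T → ExtendedBoundary T → ℝ → Set
  Pairing ρ τ c =
    Σ (Enumeration (λ e → E⟨_⟩ T ρ e × E⟨_⟩ T τ e)) λ common →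
      c ≈ᴿ foldr _+ᴿ_ 0ᴿ (map len (proj₁ common))

  -- s = ⟨ρ , σ₀⟩ + … + ⟨ρ , σₙ₋₁⟩
  PairingSum : ∀ {n} → Vector (ExtendedBoundary T) n → ExtendedBoundary T → ℝ → Set
  PairingSum {n} σ ρ s = Σ (Vector ℝ n) λ c →
    (∀ j → Pairing ρ (σ j) (c j)) × s ≈ᴿ Vector.foldr _+ᴿ_ 0ᴿ c

record RootedIsometry {T₁ : RootedTree} (ℓ₁ : LengthFunction T₁)
                      {T₂ : RootedTree} (ℓ₂ : LengthFunction T₂) : Set where
  field
    to         : Point ℓ₁ → Point ℓ₂
    isometric  : ∀ p q d → Distance ℓ₁ p q d → Distance ℓ₂ (to p) (to q) d
    surjective : ∀ q → ∃ λ p → SamePoint ℓ₂ (to p) q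
    to-root    : SamePoint ℓ₂ (to (vertex (RootedTree.root T₁)))
                              (vertex (RootedTree.root T₂))

  -- Leaves are the end points of the realization other than the root (or its
  -- only point), so the isometry induces a bijection of leaves; v and w below
  -- correspond to each other under it.
  Carries : CapacityFunction T₁ → CapacityFunction T₂ → Set
  Carries χ₁ χ₂ = ∀ (v : Leaf T₁) (w : Leaf T₂) →
    SamePoint ℓ₂ (to (vertex (Leaf.vertex v))) (vertex (Leaf.vertex w)) →
    CapacityFunction.cap χ₁ v ≡ CapacityFunction.cap χ₂ w

module _ {T : RootedTree} (ℓ : LengthFunction T) (χ : CapacityFunction T) where
  open CapacityFunction χ

  Admissible : ∀ {n} → Vector (ExtendedBoundary T) n → ExtendedBoundary T → Set
  Admissible σ (ray ρ)  = ∀ j → ¬ (_≋_ T (σ j) (ray ρ))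
  Admissible σ (leaf v) =
    Σ (Enumeration (λ j → _≋_ T (σ j) (leaf v))) λ occurrences →
      length (proj₁ occurrences) <∞ cap v

  -- ρ may be chosen after σ, with value s.  For n = 0 every ρ may be chosen
  -- and s is an empty sum.
  record Choice {n} (σ : Vector (ExtendedBoundary T) n)
                (ρ : ExtendedBoundary T) (s : ℝ) : Set where
    field
      admissible : Admissible σ ρ
      value      : PairingSum ℓ σ ρ s
      minimal    : ∀ ρ′ s′ → Admissible σ ρ′ → PairingSum ℓ σ ρ′ s′ → s ≤ᴿ s′

  -- A sequence ρ₀, ρ₁, … produced by the greedy procedure, continued as long
  -- as possible, with its sequence of values a₀, a₁, …; both are indexed by
  -- the n < size.
  record GreedySequence : Set where
    field
      size : ℕ∞
      ρ    : ∀ n → .(n <∞ size) → ExtendedBoundary T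
      a    : ∀ n → .(n <∞ size) → ℝ

    prefix : ∀ n → .(n ≤∞ size) → Vector (ExtendedBoundary T) n
    prefix n n≤size j = ρ (toℕ j) (≤-≤∞-trans size (toℕ<n j) n≤size)

    field
      greedy  : ∀ n (n<size : n <∞ size) →
                Choice (prefix n (≤-≤∞-trans size (ℕ.n≤1+n n) n<size))
                       (ρ n n<size) (a n n<size)
      maximal : ∀ n (n≤size : n ≤∞ size) →
                ∃₂ (Choice (prefix n n≤size)) → n <∞ size

{-# OPTIONS --safe #-}
module Submission where

-- Call a finite list of elements of the extended boundary feasible if it
-- repeats no ray and respects the capacities, and let its energy be the sum of
-- the pairings ⟨ρ , τ⟩ over all pairs of entries.  If S and L are feasible and S
-- is shorter, then some ρ in L has the property that every vertex on ρ is passed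
-- by fewer entries of S than of L; adding this ρ to S is allowed and costs at
-- most what its removal from L saves.  Hence greedy choices keep the energy
-- minimal among all feasible lists of the same length, aₙ is the difference of
-- two consecutive minima, and the procedure can continue as long as some energy-
-- minimal list has one more entry.
--
-- It remains to see that an isometry preserves feasible lists and energies.
-- Order the points by p ≼ q if p lies on the segment from the root to q, that
-- is, d(p , q) = H q - H p for the distance H from the root.  The extended
-- boundary consists of the maximal chains of this order, and ⟨ρ , τ⟩ is the
-- largest value of H on the intersection of two of them.

open import Defs
open import Level using (0ℓ)
open import Axiom.ExcludedMiddle using (ExcludedMiddle)
open import Algebra.Bundles using (AbelianGroup; CommutativeMonoid)
import Algebra.Properties.CommutativeSemigroup as CommutativeSemigroupProperties
import Algebra.Properties.Group as GroupProperties
import Algebra.Solver.CommutativeMonoid as CommutativeMonoidSolver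
open import Data.Empty using (⊥; ⊥-elim; ⊥-elim-irr)
open import Data.Fin as Fin using (Fin; fromℕ; inject₁)
open import Data.Fin.Properties using (toℕ-fromℕ; toℕ-inject₁)
open import Data.List using (List; []; _∷_; _++_; map; foldr; length; filter; tabulate; allFin)
open import Data.List.Membership.Propositional using (_∈_)
open import Data.List.Membership.Propositional.Properties
  using (∈-∃++; ∈-filter⁺; ∈-filter⁻; ∈-allFin)
open import Data.List.Properties
  using (filter-accept; filter-reject; length-map; length-tabulate; map-tabulate; tabulate-cong)
open import Data.List.Relation.Binary.Permutation.Propositional
  using (_↭_; prep; swap; ↭-sym; ↭-trans; ↭-refl; ↭-reflexive)
import Data.List.Relation.Binary.Permutation.Propositional as Perm
open import Data.List.Relation.Binary.Permutation.Propositional.Properties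
  using (All-resp-↭; ∈-resp-↭; ↭-length; filter-↭; shift)
open import Data.List.Relation.Unary.All as All using (All; []; _∷_)
import Data.List.Relation.Unary.All.Properties as All
open import Data.List.Relation.Unary.AllPairs as AllPairs using (AllPairs; []; _∷_)
import Data.List.Relation.Unary.AllPairs.Properties as AllPairs
open import Data.List.Relation.Unary.Any using (here; there)
open import Data.List.Relation.Unary.Unique.Propositional using (Unique)
import Data.List.Relation.Unary.Unique.Propositional.Properties as Unique
open import Data.Maybe using (Maybe; just; nothing)
open import Data.Maybe.Properties using (just-injective)
open import Data.Nat using (ℕ)
open import Data.Nat as ℕ using (zero; suc; z≤n; s≤s)
import Data.Nat.Properties as ℕ
open import Data.Product using (Σ; _×_; _,_; ∃; ∃₂; proj₁; proj₂)
open import Data.Rational as ℚ using (ℚ; 0ℚ; ½)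
import Data.Rational.Properties as ℚ
open import Data.Sum using (_⊎_; inj₁; inj₂; [_,_]′)
open import Data.Unit using (tt)
import Data.Vec.Functional as Vector
open Vector using (Vector)
open import Function using (_∘_; id; mk⇔; Equivalence)
open import Relation.Binary using (Rel; IsTotalOrder; Symmetric)
open import Relation.Binary.Construct.Closure.ReflexiveTransitive using (Star; ε; _◅_; _◅◅_)
open import Relation.Binary.PropositionalEquality using (_≡_)
open import Relation.Binary.PropositionalEquality
  using (_≢_; refl; sym; trans; cong; cong₂; subst; subst₂; module ≡-Reasoning)
open import Relation.Nullary using (¬_; Dec; yes; no)
open import Relation.Nullary.Negation using (contradiction)

-- Real numbers as an ordered group

-- An isometry need not send vertices to vertices, since a vertex of valence two leaves no trace in
-- the metric. What is transported is therefore phrased for points, heights and the order `≼`; only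
-- afterwards is a maximal chain read as a ray or a leaf.
--
-- Distances are given only as infima of walk lengths, and an isometry transports a distance only
-- once it is known. Exact distances are computed in two cases: for comparable points, where `H`
-- bounds every walk from below, and for points that branch apart, where the bound comes from `H`
-- reflected at the branching vertex.
--
-- The exchange works because the value of ρ against a list is a sum over the edges of ρ, each
-- weighted by the number of entries through it. Although ρ may be infinite, entries distinct from ρ
-- share only finitely many edges with it. Two equal rays have no pairing, which is why distinctness
-- conditions appear throughout.

record OrderedAbelianGroup : Set₁ where
  infix 4 _≤_ _<_
  field
    abelianGroup : AbelianGroup 0ℓ 0ℓ
  open AbelianGroup abelianGroup public
    using (Carrier; _≈_; commutativeMonoid)
    renaming ( _∙_ to infixl 6 _+_; ε to 0#; _⁻¹ to -_; ∙-cong to +-cong; assoc to +-assoc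
             ; comm to +-comm; identityˡ to +-identityˡ; identityʳ to +-identityʳ
             ; inverseˡ to -‿inverseˡ; inverseʳ to -‿inverseʳ
             ; refl to ≈-refl; sym to ≈-sym; trans to ≈-trans; reflexive to ≈-reflexive)
  field
    _≤_          : Rel Carrier 0ℓ
    isTotalOrder : IsTotalOrder _≈_ _≤_
    +-monoˡ-≤    : ∀ z {x y} → x ≤ y → (x + z) ≤ (y + z)
  open IsTotalOrder isTotalOrder public
    using ()
    renaming ( reflexive to ≤-reflexive; trans to ≤-trans; antisym to ≤-antisym; total to ≤-total
             ; refl to ≤-refl)

  -- Since the order is total, the negated reverse inequality is the strict order; in this form its
  -- transitivity laws are contrapositions.
  _<_ : Rel Carrier 0ℓ
  x < y = ¬ (y ≤ x)

module OrderedAbelianGroupProperties (G : OrderedAbelianGroup) where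
  open OrderedAbelianGroup G

  <⇒≤ : ∀ {x y} → x < y → x ≤ y
  <⇒≤ {x} {y} x<y with ≤-total x y
  ... | inj₁ x≤y = x≤y
  ... | inj₂ y≤x = contradiction y≤x x<y

  ≤-<-trans : ∀ {x y z} → x ≤ y → y < z → x < z
  ≤-<-trans x≤y y<z z≤x = y<z (≤-trans z≤x x≤y)

  <-≤-trans : ∀ {x y z} → x < y → y ≤ z → x < z
  <-≤-trans x<y y≤z z≤x = x<y (≤-trans y≤z z≤x)

  +-mono-≤ : ∀ {x y u v} → x ≤ y → u ≤ v → x + u ≤ y + v
  +-mono-≤ {x} {y} {u} {v} x≤y u≤v =
    ≤-trans (+-monoˡ-≤ u x≤y)
      (≤-trans (≤-reflexive (+-comm y u))
        (≤-trans (+-monoˡ-≤ y u≤v) (≤-reflexive (+-comm v y))))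

  private
    x+z-z≈x : ∀ x z → (x + z) + - z ≈ x
    x+z-z≈x x z = ≈-trans (+-assoc x z (- z))
      (≈-trans (+-cong ≈-refl (-‿inverseʳ z)) (+-identityʳ x))

  +-cancelʳ-≤ : ∀ {x y} z → x + z ≤ y + z → x ≤ y
  +-cancelʳ-≤ {x} {y} z le =
    ≤-trans (≤-reflexive (≈-sym (x+z-z≈x x z)))
      (≤-trans (+-monoˡ-≤ (- z) le) (≤-reflexive (x+z-z≈x y z)))

  +-cancelʳ-≈ : ∀ {x y} z → x + z ≈ y + z → x ≈ y
  +-cancelʳ-≈ z eq = ≤-antisym (+-cancelʳ-≤ z (≤-reflexive eq))
                               (+-cancelʳ-≤ z (≤-reflexive (≈-sym eq)))

  -- An inequality x ≤ y follows from u ≤ v as soon as y - x = v - u, with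
  -- both sides moved so that no subtraction occurs.
  ≤-by : ∀ {x y u v} → u ≤ v → x + v ≈ y + u → x ≤ y
  ≤-by {x} {y} {u} {v} u≤v eq =
    +-cancelʳ-≤ u (≤-trans (+-mono-≤ ≤-refl u≤v) (≤-reflexive eq))

  ≈-by : ∀ {x y u v} → u ≈ v → x + v ≈ y + u → x ≈ y
  ≈-by {x} {y} {u} {v} u≈v eq =
    +-cancelʳ-≈ u (≈-trans (+-cong ≈-refl u≈v) eq)

  -- For the final step: x and y are the values aₙ of two greedy sequences, u and v their minimal
  -- energies before the choice, u′ and v′ those after it.
  increments-≈ : ∀ {x y u u′ v v′} → u′ ≈ x + u → v′ ≈ y + v → u ≈ v → u′ ≈ v′ → x ≈ y
  increments-≈ {u = u} u′≈x+u v′≈y+v u≈v u′≈v′ = +-cancelʳ-≈ u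
    (≈-trans (≈-sym u′≈x+u) (≈-trans u′≈v′ (≈-trans v′≈y+v (+-cong ≈-refl (≈-sym u≈v)))))

  +-monoʳ-≤ : ∀ z {x y} → x ≤ y → z + x ≤ z + y
  +-monoʳ-≤ z = +-mono-≤ ≤-refl

  x≤x+y : ∀ {x y} → 0# ≤ y → x ≤ x + y
  x≤x+y {x} 0≤y = ≤-trans (≤-reflexive (≈-sym (+-identityʳ x))) (+-monoʳ-≤ x 0≤y)

  x<x+y : ∀ {x y} → 0# < y → x < x + y
  x<x+y {x} {y} 0<y x+y≤x = 0<y (+-cancelʳ-≤ x (≤-trans (≤-reflexive (+-comm y x))
    (≤-trans x+y≤x (≤-reflexive (≈-sym (+-identityˡ x))))))

  difference : ∀ x y → ∃ λ d → d + x ≈ y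
  difference x y = y + - x ,
    ≈-trans (+-assoc y (- x) x) (≈-trans (+-cong ≈-refl (-‿inverseˡ x)) (+-identityʳ y))

module ℝ-Order where
  open ℝ

  halve : ∀ {δ} → 0ℚ ℚ.< δ → ∃ λ η → 0ℚ ℚ.< η × η ℚ.+ η ≡ δ
  halve {δ} 0<δ = ½ ℚ.* δ ,
    subst (ℚ._< ½ ℚ.* δ) (ℚ.*-zeroʳ ½) (ℚ.*-monoʳ-<-pos ½ 0<δ) ,
    trans (sym (ℚ.*-distribʳ-+ δ ½ ½)) (ℚ.*-identityˡ δ)

  p<p+δ : ∀ {p δ} → 0ℚ ℚ.< δ → p ℚ.< p ℚ.+ δ
  p<p+δ {p} {δ} 0<δ = subst (ℚ._< p ℚ.+ δ) (ℚ.+-identityʳ p) (ℚ.+-monoʳ-< p 0<δ)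

  open GroupProperties ℚ.+-0-group
    using (//-rightDividesˡ; //-rightDividesʳ; ⁻¹-anti-homo-//; ⁻¹-involutive)
  open CommutativeSemigroupProperties
    (CommutativeMonoid.commutativeSemigroup ℚ.+-0-commutativeMonoid)
    using (xy∙z≈xz∙y)

  p-q<δ⇒p<q+δ : ∀ p q {δ} → p ℚ.- q ℚ.< δ → p ℚ.< q ℚ.+ δ
  p-q<δ⇒p<q+δ p q {δ} lt =
    subst₂ ℚ._<_ (//-rightDividesˡ q p) (ℚ.+-comm δ q) (ℚ.+-monoˡ-< q lt)

  p<q+δ⇒p-q<δ : ∀ p q {δ} → p ℚ.< q ℚ.+ δ → p ℚ.- q ℚ.< δ
  p<q+δ⇒p-q<δ p q {δ} lt =
    subst (p ℚ.- q ℚ.<_) (trans (cong (ℚ._- q) (ℚ.+-comm q δ)) (//-rightDividesʳ q δ))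
      (ℚ.+-monoˡ-< (ℚ.- q) lt)

  p≤∣p∣ : ∀ p → p ℚ.≤ ℚ.∣ p ∣
  p≤∣p∣ p with ℚ.∣p∣≡p∨∣p∣≡-p p | ℚ.≤-total 0ℚ p
  ... | inj₁ eq | _        = ℚ.≤-reflexive (sym eq)
  ... | inj₂ _  | inj₁ 0≤p = ℚ.≤-reflexive (sym (ℚ.0≤p⇒∣p∣≡p 0≤p))
  ... | inj₂ _  | inj₂ p≤0 = ℚ.≤-trans p≤0 (ℚ.0≤∣p∣ p)

  ∣p-q∣<δ⇒p<q+δ : ∀ p q {δ} → ℚ.∣ p ℚ.- q ∣ ℚ.< δ → p ℚ.< q ℚ.+ δ
  ∣p-q∣<δ⇒p<q+δ p q lt = p-q<δ⇒p<q+δ p q (ℚ.≤-<-trans (p≤∣p∣ (p ℚ.- q)) lt)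

  ∣p-q∣≡∣q-p∣ : ∀ p q → ℚ.∣ p ℚ.- q ∣ ≡ ℚ.∣ q ℚ.- p ∣
  ∣p-q∣≡∣q-p∣ p q = trans (sym (ℚ.∣-p∣≡∣p∣ (p ℚ.- q))) (cong ℚ.∣_∣ (⁻¹-anti-homo-// p q))

  ∣p-q∣<δ : ∀ p q {δ} → p ℚ.< q ℚ.+ δ → q ℚ.< p ℚ.+ δ → ℚ.∣ p ℚ.- q ∣ ℚ.< δ
  ∣p-q∣<δ p q {δ} p<q+δ q<p+δ with ℚ.∣p∣≡p∨∣p∣≡-p (p ℚ.- q)
  ... | inj₁ eq = subst (ℚ._< δ) (sym eq) (p<q+δ⇒p-q<δ p q p<q+δ)
  ... | inj₂ eq = subst (ℚ._< δ) (sym (trans eq (⁻¹-anti-homo-// p q))) (p<q+δ⇒p-q<δ q p q<p+δ)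

  pointwise⇒≤ : ∀ {x y} → (∀ n → seq x n ℚ.≤ seq y n) → x ≤ᴿ y
  pointwise⇒≤ le δ 0<δ = 0 , λ n _ → ℚ.≤-<-trans (le n) (p<p+δ 0<δ)

  ≤ᴿ-trans : ∀ {x y z} → x ≤ᴿ y → y ≤ᴿ z → x ≤ᴿ z
  ≤ᴿ-trans {x} {y} {z} x≤y y≤z δ 0<δ =
    let η , 0<η , η+η≡δ = halve 0<δ
        M , x<y = x≤y η 0<η
        N , y<z = y≤z η 0<η
    in M ℕ.⊔ N , λ n le →
      subst (seq x n ℚ.<_) (trans (ℚ.+-assoc (seq z n) η η) (cong (seq z n ℚ.+_) η+η≡δ))
        (ℚ.<-trans (x<y n (ℕ.m⊔n≤o⇒m≤o M N le))
                   (ℚ.+-monoˡ-< η (y<z n (ℕ.m⊔n≤o⇒n≤o M N le))))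

  +ᴿ-monoˡ-≤ : ∀ z {x y} → x ≤ᴿ y → x +ᴿ z ≤ᴿ y +ᴿ z
  +ᴿ-monoˡ-≤ z {x} {y} x≤y δ 0<δ =
    let N , x<y = x≤y δ 0<δ
    in N , λ n le →
      subst (seq x n ℚ.+ seq z n ℚ.<_) (xy∙z≈xz∙y (seq y n) δ (seq z n))
        (ℚ.+-monoˡ-< (seq z n) (x<y n le))

  ≈⇒≤ : ∀ {x y} → x ≈ᴿ y → x ≤ᴿ y
  ≈⇒≤ {x} {y} x≈y δ 0<δ =
    let N , close = x≈y δ 0<δ
    in N , λ n le → ∣p-q∣<δ⇒p<q+δ (seq x n) (seq y n) (close n le)

  ≤ᴿ-antisym : ∀ {x y} → x ≤ᴿ y → y ≤ᴿ x → x ≈ᴿ y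
  ≤ᴿ-antisym {x} {y} x≤y y≤x δ 0<δ =
    let M , x<y = x≤y δ 0<δ
        N , y<x = y≤x δ 0<δ
    in M ℕ.⊔ N , λ n le →
      ∣p-q∣<δ (seq x n) (seq y n) (x<y n (ℕ.m⊔n≤o⇒m≤o M N le)) (y<x n (ℕ.m⊔n≤o⇒n≤o M N le))

  pointwise⇒≈ : ∀ {x y} → (∀ n → seq x n ≡ seq y n) → x ≈ᴿ y
  pointwise⇒≈ {x} {y} eq = ≤ᴿ-antisym {x} {y} (pointwise⇒≤ {x} {y} (ℚ.≤-reflexive ∘ eq))
                                              (pointwise⇒≤ {y} {x} (ℚ.≤-reflexive ∘ sym ∘ eq))

  ≈ᴿ-refl : ∀ {x} → x ≈ᴿ x
  ≈ᴿ-refl {x} = pointwise⇒≈ {x} {x} λ _ → refl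

  ≈ᴿ-sym : ∀ {x y} → x ≈ᴿ y → y ≈ᴿ x
  ≈ᴿ-sym {x} {y} x≈y δ 0<δ =
    let N , close = x≈y δ 0<δ
    in N , λ n le → subst (ℚ._< δ) (∣p-q∣≡∣q-p∣ (seq x n) (seq y n)) (close n le)

  ≈ᴿ-trans : ∀ {x y z} → x ≈ᴿ y → y ≈ᴿ z → x ≈ᴿ z
  ≈ᴿ-trans {x} {y} {z} x≈y y≈z =
    ≤ᴿ-antisym {x} {z}
      (≤ᴿ-trans {x} {y} {z} (≈⇒≤ {x} {y} x≈y) (≈⇒≤ {y} {z} y≈z))
      (≤ᴿ-trans {z} {y} {x} (≈⇒≤ {z} {y} (≈ᴿ-sym {y} {z} y≈z)) (≈⇒≤ {y} {x} (≈ᴿ-sym {x} {y} x≈y)))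

  +ᴿ-comm : ∀ x y → x +ᴿ y ≈ᴿ y +ᴿ x
  +ᴿ-comm x y = pointwise⇒≈ {x +ᴿ y} {y +ᴿ x} λ n → ℚ.+-comm (seq x n) (seq y n)

  +ᴿ-mono-≤ : ∀ {x y u v} → x ≤ᴿ y → u ≤ᴿ v → x +ᴿ u ≤ᴿ y +ᴿ v
  +ᴿ-mono-≤ {x} {y} {u} {v} x≤y u≤v =
    ≤ᴿ-trans {x +ᴿ u} {y +ᴿ u} {y +ᴿ v} (+ᴿ-monoˡ-≤ u {x} {y} x≤y)
      (≤ᴿ-trans {y +ᴿ u} {u +ᴿ y} {y +ᴿ v} (≈⇒≤ {y +ᴿ u} {u +ᴿ y} (+ᴿ-comm y u))
        (≤ᴿ-trans {u +ᴿ y} {v +ᴿ y} {y +ᴿ v} (+ᴿ-monoˡ-≤ y {u} {v} u≤v)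
          (≈⇒≤ {v +ᴿ y} {y +ᴿ v} (+ᴿ-comm v y))))

  -ᴿ-antimono-≤ : ∀ {x y} → x ≤ᴿ y → -ᴿ y ≤ᴿ -ᴿ x
  -ᴿ-antimono-≤ {x} {y} x≤y δ 0<δ =
    let N , x<y = x≤y δ 0<δ
    in N , λ n le → p-q<δ⇒p<q+δ (ℚ.- seq y n) (ℚ.- seq x n)
         (subst (ℚ._< δ) (trans (ℚ.+-comm (seq x n) (ℚ.- seq y n))
                            (cong (ℚ.- seq y n ℚ.+_) (sym (⁻¹-involutive (seq x n)))))
           (p<q+δ⇒p-q<δ (seq x n) (seq y n) (x<y n le)))

  ℝ-abelianGroup : AbelianGroup 0ℓ 0ℓ
  ℝ-abelianGroup = record
    { Carrier = ℝ ; _≈_ = _≈ᴿ_ ; _∙_ = _+ᴿ_ ; ε = 0ᴿ ; _⁻¹ = -ᴿ_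
    ; isAbelianGroup = record
      { isGroup = record
        { isMonoid = record
          { isSemigroup = record
            { isMagma = record
              { isEquivalence = record
                { refl  = λ {x} → ≈ᴿ-refl {x}
                ; sym   = λ {x} {y} → ≈ᴿ-sym {x} {y}
                ; trans = λ {x} {y} {z} → ≈ᴿ-trans {x} {y} {z} }
              ; ∙-cong = λ {x} {y} {u} {v} x≈y u≈v →
                  ≤ᴿ-antisym {x +ᴿ u} {y +ᴿ v}
                    (+ᴿ-mono-≤ {x} {y} {u} {v} (≈⇒≤ {x} {y} x≈y) (≈⇒≤ {u} {v} u≈v))
                    (+ᴿ-mono-≤ {y} {x} {v} {u} (≈⇒≤ {y} {x} (≈ᴿ-sym {x} {y} x≈y))
                                               (≈⇒≤ {v} {u} (≈ᴿ-sym {u} {v} u≈v))) }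
            ; assoc = λ x y z → pointwise⇒≈ {(x +ᴿ y) +ᴿ z} {x +ᴿ (y +ᴿ z)}
                λ n → ℚ.+-assoc (seq x n) (seq y n) (seq z n) }
          ; identity = (λ x → pointwise⇒≈ {0ᴿ +ᴿ x} {x} λ n → ℚ.+-identityˡ (seq x n))
                     , (λ x → pointwise⇒≈ {x +ᴿ 0ᴿ} {x} λ n → ℚ.+-identityʳ (seq x n)) }
        ; inverse = (λ x → pointwise⇒≈ {(-ᴿ x) +ᴿ x} {0ᴿ} λ n → ℚ.+-inverseˡ (seq x n))
                  , (λ x → pointwise⇒≈ {x -ᴿ x} {0ᴿ} λ n → ℚ.+-inverseʳ (seq x n))
        ; ⁻¹-cong = λ {x} {y} x≈y →
            ≤ᴿ-antisym { -ᴿ x} { -ᴿ y}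
              (-ᴿ-antimono-≤ {y} {x} (≈⇒≤ {y} {x} (≈ᴿ-sym {x} {y} x≈y)))
              (-ᴿ-antimono-≤ {x} {y} (≈⇒≤ {x} {y} x≈y)) }
      ; comm = +ᴿ-comm } }

  module _ (em : ExcludedMiddle 0ℓ) where

    -- Suppose x ≤ y fails at δ. One late index with x below y would, by the Cauchy property with δ
    -- / 2 for each sequence, give x below y + δ at all late indices. So y is termwise at most x
    -- from `K` on.
    ≤ᴿ-total : ∀ x y → x ≤ᴿ y ⊎ y ≤ᴿ x
    ≤ᴿ-total x y with em {∃ λ δ → 0ℚ ℚ.< δ ×
                            ¬ (∃ λ N → ∀ n → N ℕ.≤ n → seq x n ℚ.< seq y n ℚ.+ δ)}
    ... | no ∄δ = inj₁ λ δ 0<δ → decide δ 0<δ em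
      where
      decide : ∀ δ → 0ℚ ℚ.< δ → Dec (∃ λ N → ∀ n → N ℕ.≤ n → seq x n ℚ.< seq y n ℚ.+ δ) →
               ∃ λ N → ∀ n → N ℕ.≤ n → seq x n ℚ.< seq y n ℚ.+ δ
      decide δ 0<δ (yes holds) = holds
      decide δ 0<δ (no fails)  = contradiction (δ , 0<δ , fails) ∄δ
    ... | yes (δ , 0<δ , fails) = inj₂ λ κ 0<κ → K , λ n le → ℚ.≤-<-trans (y≤x n le) (p<p+δ 0<κ)
      where
      η = proj₁ (halve 0<δ)
      0<η = proj₁ (proj₂ (halve 0<δ))
      η+η≡δ = proj₂ (proj₂ (halve 0<δ))
      M = proj₁ (cauchy x η 0<η)
      N = proj₁ (cauchy y η 0<η)
      K = M ℕ.⊔ N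
      y≤x : ∀ n → K ℕ.≤ n → seq y n ℚ.≤ seq x n
      y≤x n K≤n = ℚ.≮⇒≥ λ x<y → fails (K , λ m K≤m →
        subst (seq x m ℚ.<_) (trans (ℚ.+-assoc (seq y m) η η) (cong (seq y m ℚ.+_) η+η≡δ))
          (ℚ.<-trans
            (∣p-q∣<δ⇒p<q+δ (seq x m) (seq x n)
              (proj₂ (cauchy x η 0<η) m n (ℕ.m⊔n≤o⇒m≤o M N K≤m) (ℕ.m⊔n≤o⇒m≤o M N K≤n)))
            (ℚ.+-monoˡ-< η
              (ℚ.<-trans x<y
                (∣p-q∣<δ⇒p<q+δ (seq y n) (seq y m)
                  (proj₂ (cauchy y η 0<η) n m (ℕ.m⊔n≤o⇒n≤o M N K≤n) (ℕ.m⊔n≤o⇒n≤o M N K≤m)))))))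

    ℝ-orderedAbelianGroup : OrderedAbelianGroup
    ℝ-orderedAbelianGroup = record
      { abelianGroup = ℝ-abelianGroup
      ; _≤_ = _≤ᴿ_
      ; isTotalOrder = record
        { isPartialOrder = record
          { isPreorder = record
            { isEquivalence = AbelianGroup.isEquivalence ℝ-abelianGroup
            ; reflexive = λ {x} {y} → ≈⇒≤ {x} {y}
            ; trans = λ {x} {y} {z} → ≤ᴿ-trans {x} {y} {z} }
          ; antisym = λ {x} {y} → ≤ᴿ-antisym {x} {y} }
        ; total = ≤ᴿ-total }
      ; +-monoˡ-≤ = λ z {x} {y} → +ᴿ-monoˡ-≤ z {x} {y} }

  <ᴿ⇒≱ : ∀ {x y} → x <ᴿ y → ¬ (y ≤ᴿ x)
  <ᴿ⇒≱ {x} {y} (δ , 0<δ , M , x+δ≤y) y≤x =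
    let N , y<x+δ = y≤x δ 0<δ
        n = M ℕ.⊔ N
    in ℚ.<-irrefl refl (ℚ.<-≤-trans (y<x+δ n (ℕ.m≤n⊔m M N)) (x+δ≤y n (ℕ.m≤m⊔n M N)))

  ∣x-y∣-sym : ∀ x y → ∣ x -ᴿ y ∣ᴿ ≈ᴿ ∣ y -ᴿ x ∣ᴿ
  ∣x-y∣-sym x y = pointwise⇒≈ {∣ x -ᴿ y ∣ᴿ} {∣ y -ᴿ x ∣ᴿ} λ n → ∣p-q∣≡∣q-p∣ (seq x n) (seq y n)

  x≤y+∣x-y∣ : ∀ x y → x ≤ᴿ y +ᴿ ∣ x -ᴿ y ∣ᴿ
  x≤y+∣x-y∣ x y = pointwise⇒≤ {x} {y +ᴿ ∣ x -ᴿ y ∣ᴿ} λ n →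
    subst (ℚ._≤ seq y n ℚ.+ ℚ.∣ seq x n ℚ.- seq y n ∣)
      (trans (ℚ.+-comm (seq y n) (seq x n ℚ.- seq y n)) (//-rightDividesˡ (seq y n) (seq x n)))
      (ℚ.+-monoʳ-≤ (seq y n) (p≤∣p∣ (seq x n ℚ.- seq y n)))

  ∣x-y∣+x≤y : ∀ x y → x ≤ᴿ y → ∣ x -ᴿ y ∣ᴿ +ᴿ x ≤ᴿ y
  ∣x-y∣+x≤y x y x≤y δ 0<δ =
    let η , 0<η , η+η≡δ = halve 0<δ
        N , x<y = x≤y η 0<η
    in N , λ n le → bound (seq x n) (seq y n) 0<δ 0<η η+η≡δ (x<y n le)
    where
    bound : ∀ p q {δ η} → 0ℚ ℚ.< δ → 0ℚ ℚ.< η → η ℚ.+ η ≡ δ → p ℚ.< q ℚ.+ η →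
            ℚ.∣ p ℚ.- q ∣ ℚ.+ p ℚ.< q ℚ.+ δ
    bound p q {δ} {η} 0<δ 0<η η+η≡δ p<q+η with ℚ.∣p∣≡p∨∣p∣≡-p (p ℚ.- q)
    ... | inj₁ eq = subst₂ ℚ._<_ (cong (ℚ._+ p) (sym eq))
      (trans (ℚ.+-comm η (q ℚ.+ η)) (trans (ℚ.+-assoc q η η) (cong (q ℚ.+_) η+η≡δ)))
      (ℚ.+-mono-< (p<q+δ⇒p-q<δ p q p<q+η) p<q+η)
    ... | inj₂ eq = subst (ℚ._< q ℚ.+ δ)
      (sym (trans (cong (ℚ._+ p) (trans eq (⁻¹-anti-homo-// p q))) (//-rightDividesˡ p q)))
      (p<p+δ 0<δ)

-- Trees

module TreeProperties (T : RootedTree) where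
  open RootedTree T

  infix 4 _⊑_
  _⊑_ : Vertex → Vertex → Set
  u ⊑ v = Star _⟶_ u v

  steps : ∀ {u v} → u ⊑ v → ℕ
  steps ε       = 0
  steps (_ ◅ p) = suc (steps p)

  steps-◅◅ : ∀ {u v w} (p : u ⊑ v) (q : v ⊑ w) → steps (p ◅◅ q) ≡ steps p ℕ.+ steps q
  steps-◅◅ ε       q = refl
  steps-◅◅ (_ ◅ p) q = cong suc (steps-◅◅ p q)

  depth : Vertex → ℕ
  depth v = steps (path v)

  depth-⊑ : ∀ {u v} (p : u ⊑ v) → depth v ≡ depth u ℕ.+ steps p
  depth-⊑ {u} {v} p = trans (cong steps (path-unique (path v) (path u ◅◅ p))) (steps-◅◅ (path u) p)

  depth-⟶ : ∀ {u v} → u ⟶ v → depth v ≡ suc (depth u)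
  depth-⟶ {u} s = trans (depth-⊑ (s ◅ ε)) (ℕ.+-comm (depth u) 1)

  depth-root : depth root ≡ 0
  depth-root = cong steps (path-unique (path root) ε)

  depth-mono : ∀ {u v} → u ⊑ v → depth u ℕ.≤ depth v
  depth-mono {u} p = ℕ.≤-trans (ℕ.m≤m+n (depth u) (steps p)) (ℕ.≤-reflexive (sym (depth-⊑ p)))

  acyclic : ∀ {u v} → u ⟶ v → ¬ (v ⊑ u)
  acyclic s p = ℕ.1+n≰n (ℕ.≤-trans (ℕ.≤-reflexive (sym (depth-⟶ s))) (depth-mono p))

  ⊑-antisym : ∀ {u v} → u ⊑ v → v ⊑ u → u ≡ v
  ⊑-antisym ε       _ = refl
  ⊑-antisym (s ◅ p) q = ⊥-elim (acyclic s (p ◅◅ q))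

  private
    lastEdge : ∀ {u v} → u ⊑ v → Maybe (Edge T)
    lastEdge ε                         = nothing
    lastEdge (_◅_ {u} {v} s ε)         = just (u , v , s)
    lastEdge (_ ◅ p@(_ ◅ _))           = lastEdge p

    lastEdge-▻ : ∀ {u v w} (p : u ⊑ v) (s : v ⟶ w) → lastEdge (p ◅◅ (s ◅ ε)) ≡ just (v , w , s)
    lastEdge-▻ ε             s = refl
    lastEdge-▻ (_ ◅ ε)       s = refl
    lastEdge-▻ (_ ◅ p@(_ ◅ _)) s = lastEdge-▻ p s

    tail : ∀ {w} → Σ Vertex (_⊑ w) → Maybe (Σ Vertex (_⊑ w))
    tail (_ , ε)     = nothing
    tail (_ , s ◅ p) = just (_ , p)

    -- Two factorizations of one path are peeled step by step until `a` or `b` is used up; what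
    -- remains of the other joins u and v. The starting vertices move along, so the paths are
    -- compared as pairs with their sources.
    compare : ∀ {r r′ u v w} (a : r ⊑ u) (b : r′ ⊑ v) (p : u ⊑ w) (q : v ⊑ w) →
              _≡_ {A = Σ Vertex (_⊑ w)} (r , a ◅◅ p) (r′ , b ◅◅ q) → u ⊑ v ⊎ v ⊑ u
    compare {v = v} ε b p q eq = inj₁ (subst (_⊑ v) (sym (cong proj₁ eq)) b)
    compare {u = u} a ε p q eq = inj₂ (subst (_⊑ u) (cong proj₁ eq) a)
    compare (_ ◅ a) (_ ◅ b) p q eq = compare a b p q (just-injective (cong tail eq))

  -- Appending each edge to the path to its source gives two paths from the root to v. They
  -- coincide, hence so do their last edges.
  ⟶-unique : ∀ {u u′ v} (s : u ⟶ v) (s′ : u′ ⟶ v) → _≡_ {A = Edge T} (u , v , s) (u′ , v , s′)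
  ⟶-unique {u} {u′} s s′ = just-injective (begin
    just (u , _ , s)                ≡⟨ lastEdge-▻ (path u) s ⟨
    lastEdge (path u ◅◅ (s ◅ ε))    ≡⟨ cong lastEdge (path-unique (path u ◅◅ (s ◅ ε)) (path u′ ◅◅ (s′ ◅ ε))) ⟩
    lastEdge (path u′ ◅◅ (s′ ◅ ε))  ≡⟨ lastEdge-▻ (path u′) s′ ⟩
    just (u′ , _ , s′)              ∎)
    where open ≡-Reasoning

  parent-unique : ∀ {u u′ v} → u ⟶ v → u′ ⟶ v → u ≡ u′
  parent-unique s s′ = cong proj₁ (⟶-unique s s′)

  ⊑-comparable : ∀ {u v w} → u ⊑ w → v ⊑ w → u ⊑ v ⊎ v ⊑ u
  ⊑-comparable {u} {v} p q =
    compare (path u) (path v) p q (cong (root ,_) (path-unique (path u ◅◅ p) (path v ◅◅ q)))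

  unsnoc : ∀ {u v} → u ⊑ v → u ≡ v ⊎ ∃ λ w → u ⊑ w × w ⟶ v
  unsnoc ε       = inj₁ refl
  unsnoc (s ◅ p) with unsnoc p
  ... | inj₁ refl         = inj₂ (_ , ε , s)
  ... | inj₂ (w , q , s′) = inj₂ (w , s ◅ q , s′)

  ⊑-parent : ∀ {u v w} → u ⊑ v → w ⟶ v → u ≡ v ⊎ u ⊑ w
  ⊑-parent {u} p s with unsnoc p
  ... | inj₁ u≡v          = inj₁ u≡v
  ... | inj₂ (w , q , s′) = inj₂ (subst (u ⊑_) (parent-unique s′ s) q)

  uncons : ∀ {u v} → u ⊑ v → u ≢ v → ∃ λ c → u ⟶ c × c ⊑ v
  uncons ε       u≢u = contradiction refl u≢u
  uncons (s ◅ p) _   = _ , s , p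

  ≢root⇒parent : ∀ {v} → v ≢ root → ∃ λ u → u ⟶ v
  ≢root⇒parent {v} v≢root with unsnoc (path v)
  ... | inj₁ root≡v      = contradiction (sym root≡v) v≢root
  ... | inj₂ (u , _ , s) = u , s

  root-⊑-only : ∀ {v} → v ⊑ root → v ≡ root
  root-⊑-only {v} p = ⊑-antisym p (path v)

  -- Away from the root, the edge from the parent already is the only incident edge; an edge to a
  -- child would coincide with it and close a cycle.
  leaf-childless : ∀ {v} → IsLeaf T v → ∀ {c} → ¬ (v ⟶ c)
  leaf-childless (inj₁ (v≢root , _ , _ , unique)) s =
    let u , s₀ = ≢root⇒parent v≢root
        parent≡child = trans (sym (unique {_ , _ , s₀} (inj₂ refl))) (unique {_ , _ , s} (inj₁ refl))
    in acyclic s (subst (_⊑ _) (cong (target T) parent≡child) ε)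
  leaf-childless (inj₂ (v≡root , all≡root)) {c} s =
    acyclic s (subst (_⊑ _) (sym (all≡root c)) (path _))

  module _ (em : ExcludedMiddle 0ℓ) where

    childless⇒leaf : ∀ {v} → (∀ {c} → ¬ (v ⟶ c)) → IsLeaf T v
    childless⇒leaf {v} childless with em {v ≡ root}
    ... | yes v≡root = inj₂ (v≡root , λ u → only u (path u))
      where
      only : ∀ u → root ⊑ u → u ≡ root
      only u ε       = refl
      only u (s ◅ _) = ⊥-elim (childless (subst (_⟶ _) (sym v≡root) s))
    ... | no v≢root =
      let u , s = ≢root⇒parent v≢root
      in inj₁ (v≢root , (u , v , s) , inj₂ refl , λ {e} → only-incoming s e)
      where
      only-incoming : ∀ {u} (s : u ⟶ v) e → Incident T v e → (u , v , s) ≡ e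
      only-incoming s (_ , _ , s′) (inj₁ refl) = ⊥-elim (childless s′)
      only-incoming s (_ , _ , s′) (inj₂ refl) = ⟶-unique s s′

    -- Testing P along the path finds an edge that leaves P. This one search yields meets, branching
    -- vertices and first bad vertices.
    firstExit : ∀ (P : Vertex → Set) {u v} → P u → u ⊑ v → ¬ P v →
                ∃₂ λ w c → w ⟶ c × u ⊑ w × c ⊑ v × P w × ¬ P c
    firstExit P Pu ε       ¬Pv = contradiction Pu ¬Pv
    firstExit P Pu (_◅_ {j = c} s p) ¬Pv with em {P c}
    ... | no  ¬Pc = _ , _ , s , ε , p , Pu , ¬Pc
    ... | yes Pc  =
      let w , c′ , s′ , p′ , rest = firstExit P Pc p ¬Pv
      in w , c′ , s′ , s ◅ p′ , rest

  -- Rays and leaves become the same kind of object: a chain of vertices closed under ancestors.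
  OnPath : ExtendedBoundary T → Vertex → Set
  OnPath (ray ρ)  v = ∃ λ n → v ≡ Ray.at ρ n
  OnPath (leaf l) v = v ⊑ Leaf.vertex l

  at-depth : ∀ (ρ : Ray T) n → depth (Ray.at ρ n) ≡ n
  at-depth ρ zero    = trans (cong depth (Ray.start ρ)) depth-root
  at-depth ρ (suc n) = trans (depth-⟶ (Ray.step ρ n)) (cong suc (at-depth ρ n))

  onRay-at : ∀ (ρ : Ray T) {v} → OnPath (ray ρ) v → v ≡ Ray.at ρ (depth v)
  onRay-at ρ (n , refl) = cong (Ray.at ρ) (sym (at-depth ρ n))

  at-mono : ∀ (ρ : Ray T) {m n} → m ℕ.≤′ n → Ray.at ρ m ⊑ Ray.at ρ n
  at-mono ρ ℕ.≤′-refl     = ε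
  at-mono ρ (ℕ.≤′-step p) = at-mono ρ p ◅◅ (Ray.step ρ _ ◅ ε)

  onPath-root : ∀ ρ → OnPath ρ root
  onPath-root (ray ρ)  = 0 , sym (Ray.start ρ)
  onPath-root (leaf l) = path (Leaf.vertex l)

  onPath-⊑ : ∀ ρ {u v} → u ⊑ v → OnPath ρ v → OnPath ρ u
  onPath-⊑ (leaf l) p q = p ◅◅ q
  onPath-⊑ (ray ρ) {u} p (n , refl) = below n p
    where
    below : ∀ n → u ⊑ Ray.at ρ n → OnPath (ray ρ) u
    below zero    p = 0 , trans (root-⊑-only (subst (u ⊑_) (Ray.start ρ) p)) (sym (Ray.start ρ))
    below (suc n) p with ⊑-parent p (Ray.step ρ n)
    ... | inj₁ u≡ = suc n , u≡
    ... | inj₂ q  = below n q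

  onPath-comparable : ∀ ρ {u v} → OnPath ρ u → OnPath ρ v → u ⊑ v ⊎ v ⊑ u
  onPath-comparable (leaf l) p q = ⊑-comparable p q
  onPath-comparable (ray ρ) (m , refl) (n , refl) with ℕ.≤-total m n
  ... | inj₁ m≤n = inj₁ (at-mono ρ (ℕ.≤⇒≤′ m≤n))
  ... | inj₂ n≤m = inj₂ (at-mono ρ (ℕ.≤⇒≤′ n≤m))

  onRay-next : ∀ (ρ : Ray T) {v} → OnPath (ray ρ) v → ∃ λ c → v ⟶ c × OnPath (ray ρ) c
  onRay-next ρ (n , refl) = _ , Ray.step ρ n , suc n , refl

  ray-unbounded : ∀ (ρ : Ray T) {w} → ¬ (∀ v → OnPath (ray ρ) v → v ⊑ w)
  ray-unbounded ρ {w} bounded =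
    ℕ.1+n≰n (subst (ℕ._≤ depth w) (at-depth ρ (suc (depth w)))
      (depth-mono (bounded _ (suc (depth w) , refl))))

  leaf-top : ∀ (l : Leaf T) {v} → Leaf.vertex l ⊑ v → v ≡ Leaf.vertex l
  leaf-top l ε = refl
  leaf-top (mkLeaf _ isLeaf) (s ◅ _) = ⊥-elim-irr (leaf-childless isLeaf s)

  leaf-≡ : ∀ {l l′ : Leaf T} → Leaf.vertex l ≡ Leaf.vertex l′ → l ≡ l′
  leaf-≡ refl = refl

  ≋⇒OnPath : ∀ ρ τ → _≋_ T ρ τ → ∀ {v} → OnPath ρ v → OnPath τ v
  ≋⇒OnPath (ray ρ)  (ray τ)  ρ≋τ (n , v≡) = n , trans v≡ (ρ≋τ n)
  ≋⇒OnPath (leaf l) (leaf _) refl         = id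

  ≋-sym : ∀ ρ τ → _≋_ T ρ τ → _≋_ T τ ρ
  ≋-sym (ray ρ)  (ray τ)  ρ≋τ n = sym (ρ≋τ n)
  ≋-sym (leaf l) (leaf m) l≡m   = sym l≡m

  OnPath⇒≋ : ∀ ρ τ → (∀ v → OnPath ρ v → OnPath τ v) → (∀ v → OnPath τ v → OnPath ρ v) →
             _≋_ T ρ τ
  OnPath⇒≋ (ray ρ)  (ray τ)  ⊆ ⊇ n =
    trans (onRay-at τ (⊆ _ (n , refl))) (cong (Ray.at τ) (at-depth ρ n))
  OnPath⇒≋ (ray ρ)  (leaf l) ⊆ ⊇ = ray-unbounded ρ ⊆
  OnPath⇒≋ (leaf l) (ray τ)  ⊆ ⊇ = ray-unbounded τ ⊇
  OnPath⇒≋ (leaf l) (leaf m) ⊆ ⊇ = leaf-≡ (⊑-antisym (⊆ _ ε) (⊇ _ ε))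

  -- A path cannot continue beyond a leaf. Thus the number of entries through a leaf is the number
  -- of its occurrences, and capacities can be read off from the counts at vertices.
  onPath-leaf⇒≋ : ∀ ρ (l : Leaf T) → OnPath ρ (Leaf.vertex l) → _≋_ T ρ (leaf l)
  onPath-leaf⇒≋ ρ l on = OnPath⇒≋ ρ (leaf l) below (λ v p → onPath-⊑ ρ p on)
    where
    below : ∀ v → OnPath ρ v → v ⊑ Leaf.vertex l
    below v on′ with onPath-comparable ρ on′ on
    ... | inj₁ v⊑l = v⊑l
    ... | inj₂ l⊑v = subst (_⊑ _) (sym (leaf-top l l⊑v)) ε

  ∈ₚ⇒⊑ : ∀ {e u v} {p : u ⊑ v} → _∈ₚ_ T e p → target T e ⊑ v
  ∈ₚ⇒⊑ (here {p = p} refl) = p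
  ∈ₚ⇒⊑ (there e∈p)         = ∈ₚ⇒⊑ e∈p

  private
    ∈ₚ-++ : ∀ {u v w x} (p : u ⊑ v) (s : v ⟶ w) (q : w ⊑ x) →
            _∈ₚ_ T (v , w , s) (p ◅◅ (s ◅ q))
    ∈ₚ-++ ε       s q = here refl
    ∈ₚ-++ (_ ◅ p) s q = there (∈ₚ-++ p s q)

  ⊑⇒∈ₚ : ∀ e {v} → target T e ⊑ v → _∈ₚ_ T e (path v)
  ⊑⇒∈ₚ e@(u , _ , s) q = subst (_∈ₚ_ T e) (path-unique _ _) (∈ₚ-++ (path u) s q)

  E⟨⟩⇒OnPath : ∀ ρ e → E⟨_⟩ T ρ e → OnPath ρ (target T e)
  E⟨⟩⇒OnPath (ray ρ)  e (n , refl) = suc n , refl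
  E⟨⟩⇒OnPath (leaf l) e e∈         = ∈ₚ⇒⊑ e∈

  OnPath⇒E⟨⟩ : ∀ ρ e → OnPath ρ (target T e) → E⟨_⟩ T ρ e
  -- Index zero is the root, which is the target of no edge; the edge into vertex n + 1 has index n.
  OnPath⇒E⟨⟩ (ray ρ) (u , .(Ray.at ρ zero) , s) (zero , refl) =
    ⊥-elim (acyclic s (subst (_⊑ u) (sym (Ray.start ρ)) (path u)))
  OnPath⇒E⟨⟩ (ray ρ) (u , .(Ray.at ρ (suc n)) , s) (suc n , refl) = n , ⟶-unique s (Ray.step ρ n)
  OnPath⇒E⟨⟩ (leaf l) e q = ⊑⇒∈ₚ e q

  -- Equality is restricted to rays because a leaf may be repeated: it has a finite pairing with
  -- itself, namely its height.
  SameRay : ExtendedBoundary T → ExtendedBoundary T → Set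
  SameRay (ray ρ) (ray τ) = _≋_ T (ray ρ) (ray τ)
  SameRay _       _       = ⊥

  SameRay-sym : ∀ ρ τ → SameRay ρ τ → SameRay τ ρ
  SameRay-sym (ray ρ) (ray τ) = ≋-sym (ray ρ) (ray τ)

  SameRay⇒≋ : ∀ ρ τ → SameRay ρ τ → _≋_ T ρ τ
  SameRay⇒≋ (ray ρ) (ray τ) = id

  Distinct : ExtendedBoundary T → ExtendedBoundary T → Set
  Distinct ρ τ = ¬ SameRay ρ τ

  Distinct-sym : ∀ {ρ τ} → Distinct ρ τ → Distinct τ ρ
  Distinct-sym {ρ} {τ} distinct = distinct ∘ SameRay-sym τ ρ

  -- The last common vertex. The common edges are those of the path to it, so its height is the
  -- pairing; a leaf meets itself at its own vertex.
  record Meet (ρ τ : ExtendedBoundary T) (w : Vertex) : Set where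
    constructor mkMeet
    field
      onˡ : OnPath ρ w
      onʳ : OnPath τ w
      max : ∀ {v} → OnPath ρ v → OnPath τ v → v ⊑ w

  Meet-sym : ∀ {ρ τ w} → Meet ρ τ w → Meet τ ρ w
  Meet-sym (mkMeet onˡ onʳ max) = mkMeet onʳ onˡ λ p q → max q p

  Meet-unique : ∀ {ρ τ w w′} → Meet ρ τ w → Meet ρ τ w′ → w ≡ w′
  Meet-unique (mkMeet onˡ onʳ max) (mkMeet onˡ′ onʳ′ max′) = ⊑-antisym (max′ onˡ onʳ) (max onˡ′ onʳ′)

  Meet⇒Distinct : ∀ ρ τ {w} → Meet ρ τ w → Distinct ρ τ
  Meet⇒Distinct (ray ρ) (ray τ) meet ρ≋τ =
    ray-unbounded ρ λ v on → Meet.max meet on (≋⇒OnPath (ray ρ) (ray τ) ρ≋τ on)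

  module _ (em : ExcludedMiddle 0ℓ) where

    -- If ρ leaves τ, it does so along an edge from w to c. A common vertex is comparable with c and
    -- cannot lie at or above it, so it lies below w. If ρ never leaves τ, then ρ is a leaf, and its
    -- vertex is the meet.
    meet : ∀ ρ τ → Distinct ρ τ → ∃ (Meet ρ τ)
    meet ρ τ distinct with em {∃ λ v → OnPath ρ v × ¬ OnPath τ v}
    ... | yes (v , onρ , offτ) =
      let w , c , s , _ , c⊑v , onτ , c-offτ =
            firstExit em (OnPath τ) (onPath-root τ) (path v) offτ
          c-onρ = onPath-⊑ ρ c⊑v onρ
      in w , mkMeet (onPath-⊑ ρ (s ◅ ε) c-onρ) onτ
           λ {u} u-onρ u-onτ → below s c-offτ u-onτ (onPath-comparable ρ u-onρ c-onρ)
      where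
      below : ∀ {u w c} → w ⟶ c → ¬ OnPath τ c → OnPath τ u → u ⊑ c ⊎ c ⊑ u → u ⊑ w
      below s c-offτ u-onτ (inj₂ c⊑u) = contradiction (onPath-⊑ τ c⊑u u-onτ) c-offτ
      below s c-offτ u-onτ (inj₁ u⊑c) with ⊑-parent u⊑c s
      ... | inj₁ refl = contradiction u-onτ c-offτ
      ... | inj₂ u⊑w  = u⊑w
    ... | no ρ⊆τ = meet-⊆ ρ τ distinct on
      where
      on : ∀ v → OnPath ρ v → OnPath τ v
      on v onρ with em {OnPath τ v}
      ... | yes onτ  = onτ
      ... | no  offτ = contradiction (v , onρ , offτ) ρ⊆τ
      meet-⊆ : ∀ ρ τ → Distinct ρ τ → (∀ v → OnPath ρ v → OnPath τ v) → ∃ (Meet ρ τ)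
      meet-⊆ (leaf l) τ        _        on = _ , mkMeet ε (on _ ε) λ p _ → p
      meet-⊆ (ray ρ)  (leaf l) _        on = ⊥-elim (ray-unbounded ρ on)
      meet-⊆ (ray ρ)  (ray τ)  distinct on = ⊥-elim (distinct λ n →
        trans (onRay-at τ (on _ (n , refl))) (cong (Ray.at τ) (at-depth ρ n)))

-- Points, maximal chains and the extended boundary

module Height (G : OrderedAbelianGroup) (T : RootedTree)
              (len : Edge T → OrderedAbelianGroup.Carrier G) where
  open OrderedAbelianGroup G
  open OrderedAbelianGroupProperties G
  open RootedTree T
  open TreeProperties T

  edges : ∀ {u v} → u ⊑ v → List (Edge T)
  edges ε                 = []
  edges (_◅_ {u} {v} s p) = (u , v , s) ∷ edges p

  totalLength : List (Edge T) → Carrier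
  totalLength es = foldr _+_ 0# (map len es)

  height : Vertex → Carrier
  height v = totalLength (edges (path v))

  private
    totalLength-▻ : ∀ {u v w} (p : u ⊑ v) (s : v ⟶ w) →
                    totalLength (edges (p ◅◅ (s ◅ ε))) ≈ totalLength (edges p) + len (v , w , s)
    totalLength-▻ ε       s = +-comm _ _
    totalLength-▻ (_ ◅ p) s = ≈-trans (+-cong ≈-refl (totalLength-▻ p s)) (≈-sym (+-assoc _ _ _))

  height-⟶ : ∀ {u v} (s : u ⟶ v) → height v ≈ height u + len (u , v , s)
  height-⟶ {u} {v} s = ≈-trans
    (≈-reflexive (cong (totalLength ∘ edges) (path-unique (path v) (path u ◅◅ (s ◅ ε)))))
    (totalLength-▻ (path u) s)

  height-root : height root ≈ 0#
  height-root = ≈-reflexive (cong (totalLength ∘ edges) (path-unique (path root) ε))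

  module _ (positive : ∀ e → 0# < len e) where

    height-<-⟶ : ∀ {u v} → u ⟶ v → height u < height v
    height-<-⟶ s = <-≤-trans (x<x+y (positive _)) (≤-reflexive (≈-sym (height-⟶ s)))

    height-mono : ∀ {u v} → u ⊑ v → height u ≤ height v
    height-mono ε       = ≤-refl
    height-mono (s ◅ p) = ≤-trans (<⇒≤ (height-<-⟶ s)) (height-mono p)

    0≤height : ∀ v → 0# ≤ height v
    0≤height v = ≤-trans (≤-reflexive (≈-sym height-root)) (height-mono (path v))

-- top p is the first vertex v such that p lies on the segment from the root to
-- v, and H p is the distance of p from the root.
record RealizedTree (G : OrderedAbelianGroup) : Set₁ where
  open OrderedAbelianGroup G
  field
    tree     : RootedTree
    len      : Edge tree → Carrier
    positive : ∀ e → 0# < len e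
  open RootedTree tree public
  open TreeProperties tree public
  open Height G tree len public
  field
    Pt         : Set
    pt         : Vertex → Pt
    top        : Pt → Vertex
    H          : Pt → Carrier
    top-pt     : ∀ v → top (pt v) ≡ v
    H-pt       : ∀ v → H (pt v) ≡ height v
    0≤H        : ∀ p → 0# ≤ H p
    H≤height   : ∀ p → H p ≤ height (top p)
    height<H   : ∀ p {u} → u ⟶ top p → height u < H p

  infix 4 _≼_
  -- Points with the same top lie on one edge and are compared by `H`; when the tops differ, their
  -- order already forces that of the heights. This is a preorder: glued points lie below each
  -- other.
  record _≼_ (p q : Pt) : Set where
    constructor mk≼
    field
      top-⊑ : top p ⊑ top q
      H-≤   : H p ≤ H q

  Comparable : Pt → Pt → Set
  Comparable p q = p ≼ q ⊎ q ≼ p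

  record MaximalChain (C : Pt → Set) : Set where
    field
      chain   : ∀ {p q} → C p → C q → Comparable p q
      maximal : ∀ p → (∀ q → C q → Comparable p q) → C p

  -- Testing the top is enough, because no element of the extended boundary ends in the interior of
  -- an edge.
  OnPathᵖ : ExtendedBoundary tree → Pt → Set
  OnPathᵖ ρ p = OnPath ρ (top p)

module PointOrder {G : OrderedAbelianGroup} (X : RealizedTree G) where
  open OrderedAbelianGroup G
  open OrderedAbelianGroupProperties G
  open RealizedTree X
  open _≼_

  ≼-trans : ∀ {p q r} → p ≼ q → q ≼ r → p ≼ r
  ≼-trans (mk≼ s a) (mk≼ t b) = mk≼ (s ◅◅ t) (≤-trans a b)

  height≤H : ∀ {v w} q → v ⊑ w → w ⟶ top q → height v < H q
  height≤H q v⊑w s = ≤-<-trans (height-mono positive v⊑w) (height<H q s)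

  ⊏⇒H< : ∀ p q {w} → top p ⊑ w → w ⟶ top q → H p < H q
  ⊏⇒H< p q t s = ≤-<-trans (H≤height p) (height≤H q t s)

  ≼-by-top : ∀ {p q} → top p ⊑ top q ⊎ top q ⊑ top p → Comparable p q
  ≼-by-top {p} {q} = [ go p q , flip ∘ go q p ]′
    where
    flip : ∀ {p q} → Comparable p q → Comparable q p
    flip (inj₁ p≼q) = inj₂ p≼q
    flip (inj₂ q≼p) = inj₁ q≼p
    go : ∀ p q → top p ⊑ top q → Comparable p q
    go p q t with unsnoc t
    ... | inj₂ (_ , t′ , s) = inj₁ (mk≼ t (<⇒≤ (⊏⇒H< p q t′ s)))
    ... | inj₁ eq with ≤-total (H p) (H q)
    ...   | inj₁ p≤q = inj₁ (mk≼ t p≤q)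
    ...   | inj₂ q≤p = inj₂ (mk≼ (subst (top q ⊑_) (sym eq) ε) q≤p)

  ≼-reverse : ∀ {p q} → p ≼ q → H q ≤ H p → q ≼ p
  ≼-reverse {p} {q} (mk≼ t _) q≤p with unsnoc t
  ... | inj₁ eq           = mk≼ (subst (top q ⊑_) (sym eq) ε) q≤p
  ... | inj₂ (_ , t′ , s) = contradiction q≤p (⊏⇒H< p q t′ s)

  ≼pt : ∀ {p v} → top p ⊑ v → p ≼ pt v
  ≼pt {p} {v} t = mk≼ (subst (top p ⊑_) (sym (top-pt v)) t)
    (≤-trans (H≤height p) (≤-trans (height-mono positive t) (≤-reflexive (≈-reflexive (sym (H-pt v))))))

  pt≼⇒⊑ : ∀ {v p} → pt v ≼ p → v ⊑ top p
  pt≼⇒⊑ {v} {p} (mk≼ t _) = subst (_⊑ top p) (top-pt v) t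

  ≼pt⇒⊑ : ∀ {v p} → p ≼ pt v → top p ⊑ v
  ≼pt⇒⊑ {v} {p} (mk≼ t _) = subst (top p ⊑_) (top-pt v) t

  H0⇒top-root : ∀ p → H p ≤ 0# → top p ≡ root
  H0⇒top-root p H≤0 with unsnoc (path (top p))
  ... | inj₁ eq          = sym eq
  ... | inj₂ (u , _ , s) = contradiction (≤-trans H≤0 (0≤height positive u)) (height<H p s)

  -- For maximality, p is compared with a single point: the leaf, beyond which there is nothing, or
  -- a vertex of the ray one level deeper than the top of p. In the latter case p must lie below
  -- that vertex.
  onPath-maximal : ∀ ρ → MaximalChain (OnPathᵖ ρ)
  onPath-maximal ρ = record
    { chain   = λ p-on q-on → ≼-by-top (onPath-comparable ρ p-on q-on)
    ; maximal = max ρ }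
    where
    max : ∀ ρ p → (∀ q → OnPathᵖ ρ q → Comparable p q) → OnPathᵖ ρ p
    max (leaf l) p cmp with cmp (pt v) (subst (_⊑ v) (sym (top-pt v)) ε)
      where v = Leaf.vertex l
    ... | inj₁ p≼v = ≼pt⇒⊑ p≼v
    ... | inj₂ v≼p = subst (_⊑ Leaf.vertex l) (sym (leaf-top l (pt≼⇒⊑ v≼p))) ε
    max (ray ρ) p cmp = decide (cmp (pt v) (subst (OnPath (ray ρ)) (sym (top-pt v)) (n , refl)))
      where
      n = suc (depth (top p))
      v = Ray.at ρ n
      decide : Comparable p (pt v) → OnPathᵖ (ray ρ) p
      decide (inj₁ p≼v) = onPath-⊑ (ray ρ) (≼pt⇒⊑ p≼v) (n , refl)
      decide (inj₂ v≼p) = ⊥-elim (ℕ.1+n≰n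
        (subst (ℕ._≤ depth (top p)) (at-depth ρ n) (depth-mono (pt≼⇒⊑ v≼p))))

  module _ (em : ExcludedMiddle 0ℓ) {C : Pt → Set} (C-max : MaximalChain C) where
    open MaximalChain C-max

    root∈C : C (pt root)
    root∈C = maximal (pt root) λ q _ → ≼-by-top (inj₁ (subst (_⊑ top q) (sym (top-pt root)) (path (top q))))

    private
      pt∈C : ∀ v → (∀ q → C q → v ⊑ top q ⊎ top q ⊑ v) → C (pt v)
      pt∈C v cmp = maximal (pt v) λ q q∈C →
        ≼-by-top (subst (λ x → x ⊑ top q ⊎ top q ⊑ x) (sym (top-pt v)) (cmp q q∈C))

    -- Suppose p in C lies beyond v, and let c be the next vertex from v towards p. Every point of C
    -- is comparable with p, hence with c, so maximality would put c into C.
    below-childless : ∀ {v} → C (pt v) → (∀ {c} → v ⟶ c → ¬ C (pt c)) →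
                      ∀ p → C p → top p ⊑ v
    below-childless {v} v∈C no-child p p∈C with chain v∈C p∈C
    ... | inj₂ p≼v = ≼pt⇒⊑ p≼v
    ... | inj₁ v≼p with pt≼⇒⊑ v≼p
    ...   | v⊑p with em {v ≡ top p}
    ...     | yes eq = subst (_⊑ v) eq ε
    ...     | no v≢p =
      let c , s , c⊑p = uncons v⊑p v≢p
      in contradiction (pt∈C c λ q q∈C → cmp c⊑p (chain q∈C p∈C)) (no-child s)
      where
      cmp : ∀ {c q} → c ⊑ top p → Comparable q p → c ⊑ top q ⊎ top q ⊑ c
      cmp c⊑p (inj₁ q≼p) = ⊑-comparable c⊑p (top-⊑ q≼p)
      cmp c⊑p (inj₂ p≼q) = inj₁ (c⊑p ◅◅ top-⊑ p≼q)

    -- A child of v would lie above all of C and so belong to C by maximality.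
    childless-in-C⇒leaf : ∀ {v} → C (pt v) → (∀ {c} → v ⟶ c → ¬ C (pt c)) → IsLeaf tree v
    childless-in-C⇒leaf {v} v∈C no-child = childless⇒leaf em λ {c} s →
      no-child s (pt∈C c λ q q∈C → inj₂ (below-childless v∈C no-child q q∈C ◅◅ (s ◅ ε)))

    -- Either some vertex of C has no child in C, and C is the path to this leaf, or a child in C
    -- can be chosen again and again from the root, which builds a ray.
    boundaryPoint : ∃ λ ρ → (∀ p → C p → OnPathᵖ ρ p) × (∀ p → OnPathᵖ ρ p → C p)
    boundaryPoint with em {∃ λ v → C (pt v) × (∀ {c} → v ⟶ c → ¬ C (pt c))}
    ... | yes (v , v∈C , no-child) =
      leaf (mkLeaf v (childless-in-C⇒leaf v∈C no-child)) ,
      below-childless v∈C no-child ,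
      λ p p⊑v → maximal p λ q q∈C →
        ≼-by-top (⊑-comparable p⊑v (below-childless v∈C no-child q q∈C))
    ... | no ∄end = ray ρ , ⊆ , ⊇
      where
      extend : (x : ∃ (C ∘ pt)) → ∃ λ (y : ∃ (C ∘ pt)) → proj₁ x ⟶ proj₁ y
      extend (v , v∈C) with em {∃ λ c → v ⟶ c × C (pt c)}
      ... | yes (c , s , c∈C) = (c , c∈C) , s
      ... | no  ∄c            = contradiction (v , v∈C , λ {c} s c∈C → ∄c (c , s , c∈C)) ∄end
      walk : ℕ → ∃ (C ∘ pt)
      walk zero    = root , root∈C
      walk (suc n) = proj₁ (extend (walk n))
      ρ : Ray tree
      ρ = record { at = proj₁ ∘ walk ; start = refl ; step = λ n → proj₂ (extend (walk n)) }
      -- Here the maximality of the ray is used: its vertices are in C, so a point of C is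
      -- comparable with all of it.
      ⊆ : ∀ p → C p → OnPathᵖ (ray ρ) p
      ⊆ p p∈C = MaximalChain.maximal (onPath-maximal (ray ρ)) p λ q (n , eq) → cmp q n eq
        where
        cmp : ∀ q n → top q ≡ Ray.at ρ n → Comparable p q
        cmp q n eq with chain p∈C (proj₂ (walk n))
        ... | inj₂ n≼p = ≼-by-top (inj₂ (subst (_⊑ top p) (sym eq) (pt≼⇒⊑ n≼p)))
        ... | inj₁ p≼n = ≼-by-top (inj₁ (subst (top p ⊑_) (sym eq) (≼pt⇒⊑ p≼n)))
      ⊇ : ∀ p → OnPathᵖ (ray ρ) p → C p
      ⊇ p p-on = maximal p λ q q∈C → ≼-by-top (onPath-comparable (ray ρ) p-on (⊆ q q∈C))

-- The symmetric content of a rooted isometry. The maps are inverse only up to gluing, that is, up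
-- to `≼` in both directions.
record PointIso {G : OrderedAbelianGroup} (X Y : RealizedTree G) : Set where
  open OrderedAbelianGroup G
  private
    module X = RealizedTree X
    module Y = RealizedTree Y
  field
    to        : X.Pt → Y.Pt
    from      : Y.Pt → X.Pt
    to-mono   : ∀ {p q} → p X.≼ q → to p Y.≼ to q
    from-mono : ∀ {p q} → p Y.≼ q → from p X.≼ from q
    to∘from   : ∀ q → to (from q) Y.≼ q × q Y.≼ to (from q)
    from∘to   : ∀ p → from (to p) X.≼ p × p X.≼ from (to p)
    H-to      : ∀ p → Y.H (to p) ≈ X.H p
    H-from    : ∀ q → X.H (from q) ≈ Y.H q

PointIso-sym : ∀ {G} {X Y : RealizedTree G} → PointIso X Y → PointIso Y X
PointIso-sym φ = record
  { to = from ; from = to ; to-mono = from-mono ; from-mono = to-mono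
  ; to∘from = from∘to ; from∘to = to∘from ; H-to = H-from ; H-from = H-to }
  where open PointIso φ

module Boundary (em : ExcludedMiddle 0ℓ) {G : OrderedAbelianGroup} {X Y : RealizedTree G}
                (φ : PointIso X Y) where
  open OrderedAbelianGroup G
  private
    module X = RealizedTree X
    module Y = RealizedTree Y
    module ≼X = PointOrder X
    module ≼Y = PointOrder Y
  open PointIso φ

  private
    from-reflects : ∀ {p q} → from p X.≼ from q → p Y.≼ q
    from-reflects {p} {q} le =
      ≼Y.≼-trans (proj₂ (to∘from p)) (≼Y.≼-trans (to-mono le) (proj₁ (to∘from q)))

    cmp-from : ∀ {p q} → Y.Comparable p q → X.Comparable (from p) (from q)
    cmp-from (inj₁ le) = inj₁ (from-mono le)
    cmp-from (inj₂ le) = inj₂ (from-mono le)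

    reflect-cmp : ∀ {p q} → X.Comparable (from p) (from q) → Y.Comparable p q
    reflect-cmp (inj₁ le) = inj₁ (from-reflects le)
    reflect-cmp (inj₂ le) = inj₂ (from-reflects le)

    -- A point p comparable with the whole preimage is in particular comparable with each `to q` for
    -- q on ρ. Replacing `from (to q)` by q makes `from p` comparable with all of ρ.
    image-maximal : ∀ ρ → Y.MaximalChain (X.OnPathᵖ ρ ∘ from)
    image-maximal ρ = record
      { chain   = λ p-on q-on → reflect-cmp (X.MaximalChain.chain C p-on q-on)
      ; maximal = λ p cmp → X.MaximalChain.maximal C (from p) λ q q-on →
          replace q (cmp-from (cmp (to q)
            (X.onPath-⊑ ρ (X._≼_.top-⊑ (proj₁ (from∘to q))) q-on))) }
      where
      C = ≼X.onPath-maximal ρ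
      replace : ∀ {p} q → X.Comparable p (from (to q)) → X.Comparable p q
      replace q (inj₁ le) = inj₁ (≼X.≼-trans le (proj₁ (from∘to q)))
      replace q (inj₂ le) = inj₂ (≼X.≼-trans (proj₂ (from∘to q)) le)

  image : ExtendedBoundary X.tree → ExtendedBoundary Y.tree
  image ρ = proj₁ (≼Y.boundaryPoint em (image-maximal ρ))

  image-on⁻ : ∀ ρ q → Y.OnPathᵖ (image ρ) q → X.OnPathᵖ ρ (from q)
  image-on⁻ ρ = proj₂ (proj₂ (≼Y.boundaryPoint em (image-maximal ρ)))

  image-on⁺ : ∀ ρ p → X.OnPathᵖ ρ p → Y.OnPathᵖ (image ρ) (to p)
  image-on⁺ ρ p p-on = proj₁ (proj₂ (≼Y.boundaryPoint em (image-maximal ρ))) (to p)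
    (X.onPath-⊑ ρ (X._≼_.top-⊑ (proj₁ (from∘to p))) p-on)

  private
    image-⊆ : ∀ ρ τ → _≋_ Y.tree (image ρ) (image τ) → ∀ v → X.OnPath ρ v → X.OnPath τ v
    image-⊆ ρ τ eq v on = X.onPath-⊑ τ (≼X.pt≼⇒⊑ (proj₂ (from∘to (X.pt v))))
      (image-on⁻ τ (to (X.pt v))
        (Y.≋⇒OnPath (image ρ) (image τ) eq (image-on⁺ ρ (X.pt v) (subst (X.OnPath ρ) (sym (X.top-pt v)) on))))

  image-injective : ∀ ρ τ → _≋_ Y.tree (image ρ) (image τ) → _≋_ X.tree ρ τ
  image-injective ρ τ eq = X.OnPath⇒≋ ρ τ (image-⊆ ρ τ eq)
    (image-⊆ τ ρ (Y.≋-sym (image ρ) (image τ) eq))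

  -- In terms of the order, leaves are the elements with a greatest point, and rays have none. The
  -- greatest point of the image, pulled back, is greatest on ρ.
  image-leaf : ∀ ρ l → _≋_ Y.tree (image ρ) (leaf l) →
               ∃ λ m → ρ ≡ leaf m × X.pt (Leaf.vertex m) X.≼ from (Y.pt (Leaf.vertex l))
                                  × from (Y.pt (Leaf.vertex l)) X.≼ X.pt (Leaf.vertex m)
  image-leaf ρ l eq = go ρ greatest on
    where
    v = from (Y.pt (Leaf.vertex l))
    on : X.OnPathᵖ ρ v
    on = image-on⁻ ρ _ (Y.≋⇒OnPath (leaf l) (image ρ) (Y.≋-sym (image ρ) (leaf l) eq)
           (subst (Y._⊑ _) (sym (Y.top-pt _)) ε))
    greatest : ∀ p → X.OnPathᵖ ρ p → p X.≼ v
    greatest p p-on = ≼X.≼-trans (proj₂ (from∘to p))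
      (from-mono (≼Y.≼pt (Y.≋⇒OnPath (image ρ) (leaf l) eq (image-on⁺ ρ p p-on))))
    go : ∀ ρ → (∀ p → X.OnPathᵖ ρ p → p X.≼ v) → X.OnPathᵖ ρ v →
         ∃ λ m → ρ ≡ leaf m × X.pt (Leaf.vertex m) X.≼ v × v X.≼ X.pt (Leaf.vertex m)
    go (leaf m) greatest on =
      m , refl , greatest _ (subst (X._⊑ _) (sym (X.top-pt _)) ε) , ≼X.≼pt on
    go (ray ρ) greatest on = ⊥-elim (X.ray-unbounded ρ λ u u-on →
      ≼X.pt≼⇒⊑ (greatest (X.pt u) (subst (X.OnPath (ray ρ)) (sym (X.top-pt u)) u-on)))

  -- The point of v goes to a common point of the images with the same `H`, whose top lies below w;
  -- this gives one inequality. Pulling back the point of w gives the other.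
  image-meet : ∀ ρ τ {v w} → X.Meet ρ τ v → Y.Meet (image ρ) (image τ) w → X.height v ≈ Y.height w
  image-meet ρ τ {v} {w} mv mw = ≤-antisym v≤w w≤v
    where
    module mv = X.Meet mv
    module mw = Y.Meet mw
    on-pt : ∀ σ {u} → X.OnPath σ u → X.OnPathᵖ σ (X.pt u)
    on-pt σ {u} = subst (X.OnPath σ) (sym (X.top-pt u))
    on-ptʸ : ∀ σ {u} → Y.OnPath σ u → Y.OnPathᵖ σ (Y.pt u)
    on-ptʸ σ {u} = subst (Y.OnPath σ) (sym (Y.top-pt u))
    v≤w : X.height v ≤ Y.height w
    v≤w = ≤-trans (≤-reflexive (≈-sym (≈-trans (H-to (X.pt v)) (≈-reflexive (X.H-pt v)))))
      (≤-trans (Y.H≤height (to (X.pt v)))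
        (Y.height-mono Y.positive
          (mw.max (image-on⁺ ρ _ (on-pt ρ mv.onˡ)) (image-on⁺ τ _ (on-pt τ mv.onʳ)))))
    w≤v : Y.height w ≤ X.height v
    w≤v = ≤-trans (≤-reflexive (≈-sym (≈-trans (H-from (Y.pt w)) (≈-reflexive (Y.H-pt w)))))
      (≤-trans (X.H≤height (from (Y.pt w)))
        (X.height-mono X.positive
          (mv.max (image-on⁻ ρ _ (on-ptʸ (image ρ) mw.onˡ)) (image-on⁻ τ _ (on-ptʸ (image τ) mw.onʳ)))))

-- The exchange property

AllPairs-resp-↭ : ∀ {A : Set} {R : A → A → Set} → Symmetric R →
                  ∀ {xs ys} → xs ↭ ys → AllPairs R xs → AllPairs R ys
AllPairs-resp-↭ R-sym Perm.refl p = p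
AllPairs-resp-↭ R-sym (prep x σ) (a ∷ p) = All-resp-↭ σ a ∷ AllPairs-resp-↭ R-sym σ p
AllPairs-resp-↭ R-sym (swap x y σ) ((xy ∷ a) ∷ b ∷ p) =
  (R-sym xy ∷ All-resp-↭ σ b) ∷ All-resp-↭ σ a ∷ AllPairs-resp-↭ R-sym σ p
AllPairs-resp-↭ R-sym (Perm.trans σ τ) p = AllPairs-resp-↭ R-sym τ (AllPairs-resp-↭ R-sym σ p)

∈⇒↭ : ∀ {A : Set} {x : A} {xs} → x ∈ xs → ∃ λ ys → xs ↭ x ∷ ys
∈⇒↭ {x = x} x∈xs with ∈-∃++ x∈xs
... | as , bs , refl = as ++ bs , shift x as bs

Unique-⇔⇒↭ : ∀ {A : Set} {xs ys : List A} → Unique xs → Unique ys →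
              (∀ {z} → z ∈ xs → z ∈ ys) → (∀ {z} → z ∈ ys → z ∈ xs) → xs ↭ ys
Unique-⇔⇒↭ {xs = []} {[]}    _ _ ⊆ ⊇ = ↭-refl
Unique-⇔⇒↭ {xs = []} {_ ∷ _} _ _ ⊆ ⊇ with () ← ⊇ (here refl)
Unique-⇔⇒↭ {xs = x ∷ xs} (x∉xs ∷ xs!) ys! ⊆ ⊇ with ∈⇒↭ (⊆ (here refl))
... | zs , σ with AllPairs-resp-↭ (λ x≢y → x≢y ∘ sym) σ ys!
...   | x∉zs ∷ zs! = ↭-trans (prep x (Unique-⇔⇒↭ xs! zs! ⊆′ ⊇′)) (↭-sym σ)
  where
  ⊆′ : ∀ {z} → z ∈ xs → z ∈ zs
  ⊆′ z∈xs with ∈-resp-↭ σ (⊆ (there z∈xs))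
  ... | here refl  = contradiction refl (All.lookup x∉xs z∈xs)
  ... | there z∈zs = z∈zs
  ⊇′ : ∀ {z} → z ∈ zs → z ∈ xs
  ⊇′ z∈zs with ⊇ (∈-resp-↭ (↭-sym σ) (there z∈zs))
  ... | here refl  = contradiction refl (All.lookup x∉zs z∈zs)
  ... | there z∈xs = z∈xs

-- Makes pairings and numbers of occurrences independent of the enumeration through which they are
-- specified.
enumeration-↭ : ∀ {A : Set} {P : A → Set} (e e′ : Enumeration P) → proj₁ e ↭ proj₁ e′
enumeration-↭ (xs , xs! , xs⇔) (ys , ys! , ys⇔) = Unique-⇔⇒↭ xs! ys!
  (λ {z} → Equivalence.from (ys⇔ z) ∘ Equivalence.to (xs⇔ z))
  (λ {z} → Equivalence.from (xs⇔ z) ∘ Equivalence.to (ys⇔ z))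

module Counting (em : ExcludedMiddle 0ℓ) where

  count : {A : Set} (P : A → Set) → List A → ℕ
  count P xs = length (filter (λ x → em {P x}) xs)

  module _ {A : Set} {P : A → Set} where

    count-accept : ∀ {x xs} → P x → count P (x ∷ xs) ≡ suc (count P xs)
    count-accept Px = cong length (filter-accept (λ x → em {P x}) Px)

    count-reject : ∀ {x xs} → ¬ P x → count P (x ∷ xs) ≡ count P xs
    count-reject ¬Px = cong length (filter-reject (λ x → em {P x}) ¬Px)

    count-↭ : ∀ {xs ys} → xs ↭ ys → count P xs ≡ count P ys
    count-↭ σ = ↭-length (filter-↭ (λ x → em {P x}) σ)

    count-∷-≤ : ∀ x xs → count P xs ℕ.≤ count P (x ∷ xs)
    count-∷-≤ x xs with em {P x}
    ... | yes _ = ℕ.n≤1+n _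
    ... | no  _ = ℕ.≤-refl

    count-all : ∀ {xs} → All P xs → count P xs ≡ length xs
    count-all []        = refl
    count-all (px ∷ ps) = trans (count-accept px) (cong suc (count-all ps))

    count-none : ∀ {xs} → All (¬_ ∘ P) xs → count P xs ≡ 0
    count-none []          = refl
    count-none (¬px ∷ ¬ps) = trans (count-reject ¬px) (count-none ¬ps)

    count≡0⇒none : ∀ xs → count P xs ≡ 0 → All (¬_ ∘ P) xs
    count≡0⇒none []       _ = []
    count≡0⇒none (x ∷ xs) eq with em {P x}
    ... | yes _  with () ← eq
    ... | no ¬px = ¬px ∷ count≡0⇒none xs eq

    0<count⇒↭ : ∀ xs → 0 ℕ.< count P xs → ∃₂ λ y ys → P y × xs ↭ y ∷ ys
    0<count⇒↭ (x ∷ xs) 0<n with em {P x}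
    ... | yes px = x , xs , px , ↭-refl
    ... | no  _  =
      let y , ys , py , σ = 0<count⇒↭ xs 0<n
      in y , x ∷ ys , py , ↭-trans (prep x σ) (swap x y ↭-refl)

  count-map-≤ : ∀ {A B : Set} {P : B → Set} {Q : A → Set} (f : A → B) →
                (∀ x → P (f x) → Q x) → ∀ xs → count P (map f xs) ℕ.≤ count Q xs
  count-map-≤ f imp [] = z≤n
  count-map-≤ {P = P} {Q} f imp (x ∷ xs) with em {P (f x)} | em {Q x}
  ... | yes _  | yes _  = s≤s (count-map-≤ f imp xs)
  ... | yes p  | no ¬q  = contradiction (imp x p) ¬q
  ... | no _   | yes _  = ℕ.m≤n⇒m≤1+n (count-map-≤ f imp xs)
  ... | no _   | no _   = count-map-≤ f imp xs

  count-map : ∀ {A B : Set} {P : B → Set} (f : A → B) → ∀ xs → count P (map f xs) ≡ count (P ∘ f) xs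
  count-map f [] = refl
  count-map {P = P} f (x ∷ xs) with em {P (f x)}
  ... | yes _ = cong suc (count-map f xs)
  ... | no  _ = count-map f xs

  count-≤ : ∀ {A : Set} {P Q : A → Set} → (∀ x → P x → Q x) → ∀ xs → count P xs ℕ.≤ count Q xs
  count-≤ imp [] = z≤n
  count-≤ {P = P} {Q} imp (x ∷ xs) with em {P x} | em {Q x}
  ... | yes _  | yes _  = s≤s (count-≤ imp xs)
  ... | yes p  | no ¬q  = contradiction (imp x p) ¬q
  ... | no _   | yes _  = ℕ.m≤n⇒m≤1+n (count-≤ imp xs)
  ... | no _   | no _   = count-≤ imp xs

  -- The induction removes x together with an entry y of `ys` from the same block. Disjointness
  -- keeps both out of all other blocks, so the blockwise inequalities survive.
  blockwise-≤⇒length-≤ : ∀ {A I : Set} (B : I → A → Set) →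
    (∀ {i j x} → B i x → B j x → i ≡ j) →
    ∀ xs ys → All (λ x → ∃ λ i → B i x) xs → (∀ i → count (B i) xs ℕ.≤ count (B i) ys) →
    length xs ℕ.≤ length ys
  blockwise-≤⇒length-≤ B disjoint [] ys _ _ = z≤n
  blockwise-≤⇒length-≤ B disjoint (x ∷ xs) ys ((i , xi) ∷ cover) le
    with 0<count⇒↭ ys (ℕ.≤-trans (ℕ.≤-trans (s≤s z≤n) (ℕ.≤-reflexive (sym (count-accept xi)))) (le i))
  ... | y , ys′ , yi , σ =
    subst (suc (length xs) ℕ.≤_) (sym (↭-length σ)) (s≤s (blockwise-≤⇒length-≤ B disjoint xs ys′ cover le′))
    where
    le′ : ∀ j → count (B j) xs ℕ.≤ count (B j) ys′
    le′ j with em {B j x}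
    ... | yes xj with refl ← disjoint xi xj =
      ℕ.≤-pred (subst₂ ℕ._≤_ (count-accept xi) (trans (count-↭ σ) (count-accept yi)) (le j))
    ... | no ¬xj =
      subst₂ ℕ._≤_ (count-reject ¬xj)
        (trans (count-↭ σ) (count-reject λ yj → ¬xj (subst (λ k → B k x) (disjoint yi yj) xi))) (le j)

-- Finite sums and multiples

module Sums (G : OrderedAbelianGroup) where
  open OrderedAbelianGroup G
  open OrderedAbelianGroupProperties G
  open CommutativeMonoidSolver commutativeMonoid using (solve; _⊜_; _⊕_)

  sumOver : {A : Set} → (A → Carrier) → List A → Carrier
  sumOver f xs = foldr _+_ 0# (map f xs)

  module _ {A : Set} where

    sumOver-↭ : (f : A → Carrier) → ∀ {xs ys} → xs ↭ ys → sumOver f xs ≈ sumOver f ys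
    sumOver-↭ f Perm.refl = ≈-refl
    sumOver-↭ f (prep x σ) = +-cong ≈-refl (sumOver-↭ f σ)
    sumOver-↭ f (swap x y σ) = ≈-trans (+-cong ≈-refl (+-cong ≈-refl (sumOver-↭ f σ)))
      (solve 3 (λ a b c → a ⊕ (b ⊕ c) ⊜ b ⊕ (a ⊕ c)) ≈-refl _ _ _)
    sumOver-↭ f (Perm.trans σ τ) = ≈-trans (sumOver-↭ f σ) (sumOver-↭ f τ)

    sumOver-cong : {f g : A → Carrier} → ∀ {xs} → All (λ x → f x ≈ g x) xs → sumOver f xs ≈ sumOver g xs
    sumOver-cong []         = ≈-refl
    sumOver-cong (eq ∷ eqs) = +-cong eq (sumOver-cong eqs)

    sumOver-+ : (f g : A → Carrier) → ∀ xs → sumOver (λ x → f x + g x) xs ≈ sumOver f xs + sumOver g xs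
    sumOver-+ f g [] = ≈-sym (+-identityˡ 0#)
    sumOver-+ f g (x ∷ xs) = ≈-trans (+-cong ≈-refl (sumOver-+ f g xs))
      (solve 4 (λ a b c d → (a ⊕ b) ⊕ (c ⊕ d) ⊜ (a ⊕ c) ⊕ (b ⊕ d)) ≈-refl _ _ _ _)

    foldr-tabulate : (f : A → Carrier) → ∀ {n} (σ : Vector A n) (c : Vector Carrier n) →
                     (∀ j → c j ≈ f (σ j)) → Vector.foldr _+_ 0# c ≈ sumOver f (tabulate σ)
    foldr-tabulate f {zero}  σ c eq = ≈-refl
    foldr-tabulate f {suc n} σ c eq =
      +-cong (eq Fin.zero) (foldr-tabulate f (σ ∘ Fin.suc) (c ∘ Fin.suc) (eq ∘ Fin.suc))

  infixr 7 _·_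
  _·_ : ℕ → Carrier → Carrier
  zero  · a = 0#
  suc n · a = a + n · a

  0≤n·a : ∀ {a} → 0# ≤ a → ∀ n → 0# ≤ n · a
  0≤n·a 0≤a zero    = ≤-refl
  0≤n·a 0≤a (suc n) = ≤-trans 0≤a (x≤x+y (0≤n·a 0≤a n))

  ·-monoˡ-≤ : ∀ {a} → 0# ≤ a → ∀ {m n} → m ℕ.≤ n → m · a ≤ n · a
  ·-monoˡ-≤ 0≤a {n = n} z≤n = 0≤n·a 0≤a n
  ·-monoˡ-≤ 0≤a (s≤s m≤n)   = +-monoʳ-≤ _ (·-monoˡ-≤ 0≤a m≤n)

  module _ (em : ExcludedMiddle 0ℓ) where
    open Counting em

    indicator : Set → Carrier → Carrier
    indicator P a with em {P}
    ... | yes _ = a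
    ... | no  _ = 0#

    indicator-yes : ∀ {P a} → P → indicator P a ≈ a
    indicator-yes {P} p with em {P}
    ... | yes _ = ≈-refl
    ... | no ¬p = contradiction p ¬p

    indicator-no : ∀ {P a} → ¬ P → indicator P a ≈ 0#
    indicator-no {P} ¬p with em {P}
    ... | yes p = contradiction p ¬p
    ... | no  _ = ≈-refl

    sumOver-indicator : ∀ {A : Set} (P : A → Set) a xs →
                        sumOver (λ x → indicator (P x) a) xs ≈ count P xs · a
    sumOver-indicator P a [] = ≈-refl
    sumOver-indicator P a (x ∷ xs) with em {P x}
    ... | yes _ = +-cong ≈-refl (sumOver-indicator P a xs)
    ... | no  _ = ≈-trans (+-identityˡ _) (sumOver-indicator P a xs)

-- Pairings as shared lengths

module Pairings (em : ExcludedMiddle 0ℓ) (G : OrderedAbelianGroup) (T : RootedTree)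
                (len : Edge T → OrderedAbelianGroup.Carrier G)
                (positive : ∀ e → OrderedAbelianGroup._<_ G (OrderedAbelianGroup.0# G) (len e)) where
  open OrderedAbelianGroup G
  open OrderedAbelianGroupProperties G
  open RootedTree T
  open TreeProperties T
  open Height G T len
  open Counting em
  open Sums G
  open CommutativeMonoidSolver commutativeMonoid using (solve; _⊜_; _⊕_)

  CommonEdges : ExtendedBoundary T → ExtendedBoundary T → Set
  CommonEdges ρ τ = Enumeration (λ e → E⟨_⟩ T ρ e × E⟨_⟩ T τ e)

  private
    ∈ₚ⇒∈edges : ∀ {e u v} {p : u ⊑ v} → _∈ₚ_ T e p → e ∈ edges p
    ∈ₚ⇒∈edges (here eq)   = here eq
    ∈ₚ⇒∈edges (there e∈p) = there (∈ₚ⇒∈edges e∈p)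

    ∈edges⇒⊑ : ∀ {e u v} (p : u ⊑ v) → e ∈ edges p → target T e ⊑ v
    ∈edges⇒⊑ (s ◅ p) (here refl) = p
    ∈edges⇒⊑ (s ◅ p) (there e∈)  = ∈edges⇒⊑ p e∈

    edges-below : ∀ {u v} (p : u ⊑ v) → All (λ e → u ⊑ source T e) (edges p)
    edges-below ε       = []
    edges-below (s ◅ p) = ε ∷ All.map (s ◅_) (edges-below p)

    edges-unique : ∀ {u v} (p : u ⊑ v) → Unique (edges p)
    edges-unique ε       = []
    edges-unique (s ◅ p) =
      All.map (λ c⊑ eq → acyclic s (subst (λ e → _ ⊑ source T e) (sym eq) c⊑)) (edges-below p) ∷ edges-unique p

  meet⇒commonEdges : ∀ {ρ τ w} → Meet ρ τ w → CommonEdges ρ τ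
  meet⇒commonEdges {ρ} {τ} {w} (mkMeet onˡ onʳ max) =
    edges (path w) , edges-unique (path w) , λ e → mk⇔
      (λ e∈ → let e⊑w = ∈edges⇒⊑ (path w) e∈
              in OnPath⇒E⟨⟩ ρ e (onPath-⊑ ρ e⊑w onˡ) , OnPath⇒E⟨⟩ τ e (onPath-⊑ τ e⊑w onʳ))
      (λ (e∈ρ , e∈τ) → ∈ₚ⇒∈edges (⊑⇒∈ₚ e (max (E⟨⟩⇒OnPath ρ e e∈ρ) (E⟨⟩⇒OnPath τ e e∈τ))))

  commonEdges-height : ∀ {ρ τ w} → Meet ρ τ w → (es : CommonEdges ρ τ) →
                       totalLength (proj₁ es) ≈ height w
  commonEdges-height meet es = sumOver-↭ len (enumeration-↭ es (meet⇒commonEdges meet))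

  -- Pairs without a meet are pairs of equal rays; the junk value 0# is never used
  -- for them.
  pairing : ExtendedBoundary T → ExtendedBoundary T → Carrier
  pairing ρ τ with em {∃ (Meet ρ τ)}
  ... | yes (w , _) = height w
  ... | no  _       = 0#

  pairing-meet : ∀ {ρ τ w} → Meet ρ τ w → pairing ρ τ ≈ height w
  pairing-meet {ρ} {τ} meet with em {∃ (Meet ρ τ)}
  ... | yes (_ , meet′) = ≈-reflexive (cong height (Meet-unique meet′ meet))
  ... | no  ∄meet       = contradiction (_ , meet) ∄meet

  pairing-sym : ∀ ρ τ → pairing ρ τ ≈ pairing τ ρ
  pairing-sym ρ τ with em {∃ (Meet ρ τ)}
  ... | yes (_ , meet) = ≈-sym (pairing-meet (Meet-sym meet))
  ... | no  ∄meet with em {∃ (Meet τ ρ)}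
  ...   | yes (_ , meet) = contradiction (_ , Meet-sym meet) ∄meet
  ...   | no  _          = ≈-refl

  value : ExtendedBoundary T → List (ExtendedBoundary T) → Carrier
  value ρ L = sumOver (pairing ρ) L

  energy : List (ExtendedBoundary T) → Carrier
  energy []      = 0#
  energy (ρ ∷ L) = value ρ L + energy L

  energy-↭ : ∀ {L L′} → L ↭ L′ → energy L ≈ energy L′
  energy-↭ Perm.refl        = ≈-refl
  energy-↭ (prep ρ σ)       = +-cong (sumOver-↭ (pairing ρ) σ) (energy-↭ σ)
  energy-↭ (swap ρ τ σ)     = ≈-trans
    (+-cong (+-cong (pairing-sym ρ τ) (sumOver-↭ (pairing ρ) σ))
            (+-cong (sumOver-↭ (pairing τ) σ) (energy-↭ σ)))
    (solve 4 (λ a b c d → (a ⊕ b) ⊕ (c ⊕ d) ⊜ (a ⊕ c) ⊕ (b ⊕ d)) ≈-refl _ _ _ _)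
  energy-↭ (Perm.trans σ τ) = ≈-trans (energy-↭ σ) (energy-↭ τ)

  private
    -- The part of ⟨ρ , τ⟩ contributed by a finite path. Written with indicators, it can be summed
    -- over τ first, which turns a sum over entries into a sum over edges.
    shared : ∀ {u v} → u ⊑ v → ExtendedBoundary T → Carrier
    shared ε                         τ = 0#
    shared (_◅_ {u} {c} s p) τ = indicator em (OnPath τ c) (len (u , c , s)) + shared p τ

    shared-◅◅ : ∀ {u v w} (p : u ⊑ v) (q : v ⊑ w) τ → shared (p ◅◅ q) τ ≈ shared p τ + shared q τ
    shared-◅◅ ε       q τ = ≈-sym (+-identityˡ _)
    shared-◅◅ (s ◅ p) q τ = ≈-trans (+-cong ≈-refl (shared-◅◅ p q τ)) (≈-sym (+-assoc _ _ _))

    shared-on : ∀ {u v} (p : u ⊑ v) τ → OnPath τ v → shared p τ ≈ totalLength (edges p)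
    shared-on ε       τ on = ≈-refl
    shared-on (s ◅ p) τ on = +-cong (indicator-yes em (onPath-⊑ τ p on)) (shared-on p τ on)

    shared-off : ∀ {u v} (p : u ⊑ v) τ → ¬ OnPath τ u → shared p τ ≈ 0#
    shared-off ε       τ off = ≈-refl
    shared-off (s ◅ p) τ off = ≈-trans
      (+-cong (indicator-no em (off ∘ onPath-⊑ τ (s ◅ ε)))
              (shared-off p τ (off ∘ onPath-⊑ τ (s ◅ ε))))
      (+-identityˡ 0#)

    shared-beyond : ∀ {ρ τ w z} → Meet ρ τ w → OnPath ρ z → (q : w ⊑ z) → shared q τ ≈ 0#
    shared-beyond             meet on ε       = ≈-refl
    shared-beyond {ρ} {τ} {w} meet on (_◅_ {j = c} s q) = ≈-trans
      (+-cong (indicator-no em off) (shared-off q τ off)) (+-identityˡ 0#)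
      where
      off : ¬ OnPath τ c
      off c-on = acyclic s (Meet.max meet (onPath-⊑ ρ q on) c-on)

    shared-meet : ∀ {ρ τ w z} → Meet ρ τ w → OnPath ρ z → w ⊑ z → shared (path z) τ ≈ pairing ρ τ
    shared-meet {ρ} {τ} {w} {z} meet on w⊑z = ≈-trans
      (≈-reflexive (cong (λ p → shared p τ) (path-unique (path z) (path w ◅◅ w⊑z))))
      (≈-trans (shared-◅◅ (path w) w⊑z τ)
        (≈-trans (+-cong (shared-on (path w) τ (Meet.onʳ meet)) (shared-beyond meet on w⊑z))
          (≈-trans (+-identityʳ _) (≈-sym (pairing-meet meet)))))

  through : Vertex → List (ExtendedBoundary T) → ℕ
  through v = count (λ ρ → OnPath ρ v)

  private
    -- After interchanging the sums, the edge into c contributes its length times `through c`, and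
    -- the inequality holds edge by edge.
    shared-≤ : ∀ {u z} (p : u ⊑ z) S L → (∀ c → c ⊑ z → through c S ℕ.≤ through c L) →
                sumOver (shared p) S ≤ sumOver (shared p) L
    shared-≤ ε S L le = ≤-reflexive (≈-trans (zeros S) (≈-sym (zeros L)))
      where
      zeros : ∀ {A : Set} (xs : List A) → sumOver (λ _ → 0#) xs ≈ 0#
      zeros []       = ≈-refl
      zeros (_ ∷ xs) = ≈-trans (+-identityˡ _) (zeros xs)
    shared-≤ (_◅_ {u} {c} s p) S L le =
      ≤-trans (≤-reflexive (split S))
        (≤-trans (+-mono-≤ (·-monoˡ-≤ (<⇒≤ (positive _)) (le c p)) (shared-≤ p S L le))
          (≤-reflexive (≈-sym (split L))))
      where
      split : ∀ xs → sumOver (shared (s ◅ p)) xs ≈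
                     through c xs · len (u , c , s) + sumOver (shared p) xs
      split xs = ≈-trans (sumOver-+ _ (shared p) xs)
        (+-cong (sumOver-indicator em (λ τ → OnPath τ c) (len (u , c , s)) xs) ≈-refl)

  -- Reduces a possibly infinite ρ to a finite path: the finitely many meets lie on the chain ρ, so
  -- one vertex of ρ lies beyond them all.
  beyondMeets : ∀ ρ L → All (Distinct ρ) L →
                ∃ λ z → OnPath ρ z × All (λ τ → ∃ λ w → Meet ρ τ w × w ⊑ z) L
  beyondMeets ρ []      []       = root , onPath-root ρ , []
  beyondMeets ρ (τ ∷ L) (d ∷ ds) with beyondMeets ρ L ds | meet em ρ τ d
  ... | z , z-on , below | w , m with onPath-comparable ρ z-on (Meet.onˡ m)
  ...   | inj₁ z⊑w = w , Meet.onˡ m , (w , m , ε) ∷ All.map (λ (w′ , m′ , le) → w′ , m′ , le ◅◅ z⊑w) below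
  ...   | inj₂ w⊑z = z , z-on , (w , m , w⊑z) ∷ below

  value-≤ : ∀ ρ S L → All (Distinct ρ) S → All (Distinct ρ) L →
            (∀ v → OnPath ρ v → through v S ℕ.≤ through v L) → value ρ S ≤ value ρ L
  value-≤ ρ S L dS dL le =
    ≤-trans (≤-reflexive (≈-sym (shareds S (All.++⁻ˡ S below))))
      (≤-trans (shared-≤ (path z) S L (λ c c⊑z → le c (onPath-⊑ ρ c⊑z z-on)))
        (≤-reflexive (shareds L (All.++⁻ʳ S below))))
    where
    -- Concatenation gives one vertex beyond the meets with both lists, so both values are sums over
    -- the same edges.
    deep = beyondMeets ρ (S ++ L) (All.++⁺ dS dL)
    z = proj₁ deep
    z-on = proj₁ (proj₂ deep)
    below = proj₂ (proj₂ deep)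
    shareds : ∀ xs → All (λ τ → ∃ λ w → Meet ρ τ w × w ⊑ z) xs →
               sumOver (shared (path z)) xs ≈ value ρ xs
    shareds xs ms = sumOver-cong (All.map (λ (w , m , w⊑z) → shared-meet m z-on w⊑z) ms)

  -- Otherwise the first vertices v with through v L ≤ through v S on the elements
  -- of L would partition L.
  through-exchange : ∀ S L → length S ℕ.< length L →
                     ∃ λ ρ → ρ ∈ L × (∀ v → OnPath ρ v → through v S ℕ.< through v L)
  through-exchange S L S<L with em {∃ λ ρ → ρ ∈ L × (∀ v → OnPath ρ v → through v S ℕ.< through v L)}
  ... | yes found = found
  ... | no ∄ρ = contradiction
      (blockwise-≤⇒length-≤ Block disjoint L S (All.tabulate cover) blockwise) (ℕ.<⇒≱ S<L)
    where
    Good AllGood : Vertex → Set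
    Good v = through v S ℕ.< through v L
    AllGood v = ∀ u → u ⊑ v → Good u
    FirstBad : Vertex → Set
    FirstBad c = ∃ λ w → w ⟶ c × AllGood w × ¬ Good c
    -- Blocks are indexed by all vertices; those at vertices which are not first bad are empty.
    Block : Vertex → ExtendedBoundary T → Set
    Block c ρ = OnPath ρ c × FirstBad c

    through-root : ∀ xs → through root xs ≡ length xs
    through-root xs = count-all (All.universal onPath-root xs)

    -- Everything passes through the root, so goodness there is the inequality between the lengths.
    root-good : AllGood root
    root-good u u⊑root with refl ← root-⊑-only u⊑root =
      subst₂ ℕ._<_ (sym (through-root S)) (sym (through-root L)) S<L

    -- As no entry of `L` consists of good vertices only, each one has a bad vertex, and the first
    -- exit from `AllGood` on the way there is a first bad vertex.
    cover : ∀ {ρ} → ρ ∈ L → ∃ λ c → Block c ρ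
    cover {ρ} ρ∈L with em {∃ λ v → OnPath ρ v × ¬ Good v}
    ... | no ∄v = contradiction (ρ , ρ∈L , good) ∄ρ
      where
      good : ∀ v → OnPath ρ v → Good v
      good v on with em {Good v}
      ... | yes g = g
      ... | no ¬g = contradiction (v , on , ¬g) ∄v
    ... | yes (v , on , ¬g) =
      let w , c , s , _ , c⊑v , w-good , ¬c-good =
            firstExit em AllGood root-good (path v) (λ all → ¬g (all v ε))
      in c , onPath-⊑ ρ c⊑v on , w , s , w-good , λ c-good → ¬c-good λ u u⊑c →
           [ (λ { refl → c-good }) , w-good u ]′ (⊑-parent u⊑c s)

    first : ∀ {c c′} → c ⊑ c′ → FirstBad c → FirstBad c′ → c ≡ c′
    first c⊑c′ (_ , _ , _ , ¬g) (w′ , s′ , w′-good , _) with ⊑-parent c⊑c′ s′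
    ... | inj₁ c≡c′ = c≡c′
    ... | inj₂ c⊑w′ = contradiction (w′-good _ c⊑w′) ¬g

    disjoint : ∀ {c c′ ρ} → Block c ρ → Block c′ ρ → c ≡ c′
    disjoint {ρ = ρ} (on , bad) (on′ , bad′) with onPath-comparable ρ on on′
    ... | inj₁ c⊑c′ = first c⊑c′ bad bad′
    ... | inj₂ c′⊑c = sym (first c′⊑c bad′ bad)

    blockwise : ∀ c → count (Block c) L ℕ.≤ count (Block c) S
    blockwise c with em {FirstBad c}
    -- Badness of c says that at least as many entries of `S` as of `L` pass through c, and these
    -- are exactly the entries of the block.
    ... | yes bad@(_ , _ , _ , ¬g) = ℕ.≤-trans (count-≤ (λ ρ → proj₁) L)
      (ℕ.≤-trans (ℕ.≮⇒≥ ¬g) (count-≤ (λ ρ on → on , bad) S))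
    ... | no ¬bad = subst (ℕ._≤ count (Block c) S) (sym (count-none (All.universal (λ ρ → ¬bad ∘ proj₂) L))) z≤n

  -- Feasible and optimal lists

  module Capacity (χ : CapacityFunction T) where
    open CapacityFunction χ using (cap)

    occurrences : Leaf T → List (ExtendedBoundary T) → ℕ
    occurrences l = count (λ ρ → _≋_ T ρ (leaf l))

    AdmissibleTo : List (ExtendedBoundary T) → ExtendedBoundary T → Set
    AdmissibleTo L (ray ρ)  = All (λ τ → ¬ (_≋_ T τ (ray ρ))) L
    AdmissibleTo L (leaf l) = occurrences l L <∞ cap l

    record Feasible (L : List (ExtendedBoundary T)) : Set where
      constructor mkFeasible
      field
        distinct : AllPairs Distinct L
        capacity : ∀ l → occurrences l L ≤∞ cap l

    admissible⇒distinct : ∀ L ρ → AdmissibleTo L ρ → All (Distinct ρ) L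
    admissible⇒distinct L (ray ρ)  adm =
      All.map (λ {τ} τ≢ρ same → τ≢ρ (≋-sym (ray ρ) τ (SameRay⇒≋ (ray ρ) τ same))) adm
    admissible⇒distinct L (leaf l) adm = All.universal (λ _ ()) L

    feasible-[] : Feasible []
    feasible-[] = mkFeasible [] λ l → ≤-≤∞-trans (cap l) z≤n (CapacityFunction.positive χ l)

    feasible-∷ : ∀ {L} ρ → Feasible L → AdmissibleTo L ρ → Feasible (ρ ∷ L)
    feasible-∷ {L} ρ (mkFeasible distinct capacity) adm =
      mkFeasible (admissible⇒distinct L ρ adm ∷ distinct) (cap′ ρ adm)
      where
      cap′ : ∀ ρ → AdmissibleTo L ρ → ∀ l → occurrences l (ρ ∷ L) ≤∞ cap l
      cap′ ρ adm l with em {_≋_ T ρ (leaf l)}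
      cap′ ρ adm l | no _ = capacity l
      cap′ (leaf l) adm .l | yes refl = adm

    feasible-tail : ∀ {ρ L} → Feasible (ρ ∷ L) → Feasible L
    feasible-tail {ρ} {L} (mkFeasible (_ ∷ distinct) capacity) =
      mkFeasible distinct λ l → ≤-≤∞-trans (cap l) (count-∷-≤ ρ L) (capacity l)

    feasible-↭ : ∀ {L L′} → L ↭ L′ → Feasible L → Feasible L′
    feasible-↭ σ (mkFeasible distinct capacity) = mkFeasible
      (AllPairs-resp-↭ (λ {ρ} {τ} → Distinct-sym {ρ} {τ}) σ distinct)
      λ l → subst (_≤∞ cap l) (count-↭ σ) (capacity l)

    -- The strict inequalities on ρ become weak ones once ρ is removed from `L`, which compares the
    -- values. At the vertex of a leaf, the strict inequality says that `S` contains this leaf less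
    -- often than `L`, hence less often than its capacity.
    exchange : ∀ {S L} → Feasible L → length S ℕ.< length L →
               ∃₂ λ ρ L′ → L ↭ ρ ∷ L′ × AdmissibleTo S ρ × value ρ S ≤ value ρ L′
    exchange {S} {L} L-feasible S<L with through-exchange S L S<L
    ... | ρ , ρ∈L , lt with ∈⇒↭ ρ∈L
    ...   | L′ , σ with feasible-↭ σ L-feasible
    ...     | mkFeasible (ρ≢L′ ∷ _) capacity =
      ρ , L′ , σ , adm ρ refl , value-≤ ρ S L′ (admissible⇒distinct S ρ (adm ρ refl)) ρ≢L′ le
      where
      lt′ : ∀ v → OnPath ρ v → through v S ℕ.< suc (through v L′)
      lt′ v on = subst (through v S ℕ.<_) (trans (count-↭ σ) (count-accept on)) (lt v on)
      le : ∀ v → OnPath ρ v → through v S ℕ.≤ through v L′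
      le v on = ℕ.≤-pred (lt′ v on)
      adm : ∀ ρ′ → ρ ≡ ρ′ → AdmissibleTo S ρ′
      adm (leaf l) refl = ≤-≤∞-trans (cap l)
        (ℕ.≤-trans (s≤s (count-≤ (λ τ τ≋l → ≋⇒OnPath (leaf l) τ (≋-sym τ (leaf l) τ≋l) ε) S))
          (ℕ.≤-trans (lt (Leaf.vertex l) ε)
            (ℕ.≤-trans (count-≤ (λ τ → onPath-leaf⇒≋ τ l) L) (ℕ.≤-reflexive (count-↭ σ)))))
        (capacity l)
      -- Beyond all meets with `L′`, no entry of `L′` passes through c. By the weak inequality no
      -- entry of `S` does, so `S` does not contain the ray.
      adm (ray r) refl with beyondMeets ρ L′ ρ≢L′
      ... | z , z-on , below with onRay-next r z-on
      ...   | c , s , c-on = All.map (λ {τ} off τ≋r → off (≋⇒OnPath (ray r) τ (≋-sym τ (ray r) τ≋r) c-on))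
        (count≡0⇒none S (ℕ.n≤0⇒n≡0 (ℕ.≤-trans (le c c-on)
          (ℕ.≤-reflexive (count-none (All.map
            (λ (w , m , w⊑z) c-onτ → acyclic s (Meet.max m c-on c-onτ ◅◅ w⊑z)) below))))))

    record Optimal (L : List (ExtendedBoundary T)) : Set where
      constructor mkOptimal
      field
        feasible : Feasible L
        minimal  : ∀ {L′} → Feasible L′ → length L′ ≡ length L → energy L ≤ energy L′

    Cheapest : List (ExtendedBoundary T) → ExtendedBoundary T → Set
    Cheapest L ρ = AdmissibleTo L ρ × (∀ ρ′ → AdmissibleTo L ρ′ → value ρ L ≤ value ρ′ L)

    optimal-[] : Optimal []
    optimal-[] = mkOptimal feasible-[] λ { {[]} _ _ → ≤-refl }

    optimal-↭ : ∀ {L L′} → L ↭ L′ → Optimal L → Optimal L′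
    optimal-↭ σ (mkOptimal feasible minimal) = mkOptimal (feasible-↭ σ feasible) λ M eq →
      ≤-trans (≤-reflexive (≈-sym (energy-↭ σ))) (minimal M (trans eq (sym (↭-length σ))))

    optimal-≈ : ∀ {L L′} → Optimal L → Optimal L′ → length L ≡ length L′ → energy L ≈ energy L′
    optimal-≈ L L′ eq = ≤-antisym (Optimal.minimal L (Optimal.feasible L′) (sym eq))
                                  (Optimal.minimal L′ (Optimal.feasible L) eq)

    private
      -- With ρ moved to the front of M, the energy of M splits into a value, bounded below by
      -- `exchange`, and the energy of a list as long as L, bounded below by optimality.
      exchange-energy : ∀ {L M} → Optimal L → Feasible M → length M ≡ suc (length L) →
                        ∃ λ ρ → AdmissibleTo L ρ × value ρ L + energy L ≤ energy M
      exchange-energy {L} {M} L-opt M-feasible eq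
        with exchange {L} M-feasible (ℕ.≤-reflexive (sym eq))
      ... | ρ , M′ , σ , adm , le = ρ , adm ,
        ≤-trans (+-mono-≤ le (Optimal.minimal L-opt (feasible-tail (feasible-↭ σ M-feasible))
                                (ℕ.suc-injective (trans (sym (↭-length σ)) eq))))
          (≤-reflexive (≈-sym (energy-↭ σ)))

    -- A competitor costs at least as much as L extended by some admissible element, and the
    -- cheapest extension costs no more than that one.
    optimal-∷ : ∀ {L ρ} → Optimal L → Cheapest L ρ → Optimal (ρ ∷ L)
    optimal-∷ {L} {ρ} L-opt (adm , cheapest) =
      mkOptimal (feasible-∷ ρ (Optimal.feasible L-opt) adm) λ M-feasible eq →
        let ρ′ , adm′ , le = exchange-energy L-opt M-feasible eq
        in ≤-trans (+-monoˡ-≤ (energy L) (cheapest ρ′ adm′)) le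

    -- A minimum over infinitely many admissible elements need not be attained. Here an optimal list
    -- with one more entry bounds all extensions of L from below, and the exchanged element attains
    -- this bound.
    optimal-extends : ∀ {L M} → Optimal L → Optimal M → length M ≡ suc (length L) → ∃ (Cheapest L)
    optimal-extends {L} L-opt M-opt eq =
      let ρ , adm , le = exchange-energy L-opt (Optimal.feasible M-opt) eq
      in ρ , adm , λ ρ′ adm′ → +-cancelʳ-≤ (energy L)
           (≤-trans le (Optimal.minimal M-opt (feasible-∷ ρ′ (Optimal.feasible L-opt) adm′) (sym eq)))

-- Transport along an isomorphism of points

module Configurations (em : ExcludedMiddle 0ℓ) {G : OrderedAbelianGroup} (X : RealizedTree G)
                      (χ : CapacityFunction (RealizedTree.tree X)) where
  open Pairings em G (RealizedTree.tree X) (RealizedTree.len X) (RealizedTree.positive X) public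
  open Capacity χ public

SameCapacities : ∀ {G} {X Y : RealizedTree G} → PointIso X Y →
                 CapacityFunction (RealizedTree.tree X) → CapacityFunction (RealizedTree.tree Y) → Set
SameCapacities {X = X} {Y} φ χ χ′ =
  ∀ (l : Leaf X.tree) (m : Leaf Y.tree) →
  X.pt (Leaf.vertex l) X.≼ from (Y.pt (Leaf.vertex m)) →
  from (Y.pt (Leaf.vertex m)) X.≼ X.pt (Leaf.vertex l) →
  CapacityFunction.cap χ l ≡ CapacityFunction.cap χ′ m
  where
  open PointIso φ
  module X = RealizedTree X
  module Y = RealizedTree Y

SameCapacities-sym : ∀ {G} {X Y : RealizedTree G} {φ : PointIso X Y} {χ χ′} →
                     SameCapacities φ χ χ′ → SameCapacities (PointIso-sym φ) χ′ χ
SameCapacities-sym {X = X} {Y} {φ} same m l m≼l l≼m = sym (same l m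
  (≼X.≼-trans (proj₂ (from∘to _)) (from-mono l≼m))
  (≼X.≼-trans (from-mono m≼l) (proj₁ (from∘to _))))
  where
  open PointIso φ
  module ≼X = PointOrder X

module Transport (em : ExcludedMiddle 0ℓ) {G : OrderedAbelianGroup} {X Y : RealizedTree G}
                 (φ : PointIso X Y)
                 {χ : CapacityFunction (RealizedTree.tree X)}
                 {χ′ : CapacityFunction (RealizedTree.tree Y)}
                 (same : SameCapacities φ χ χ′) where
  open OrderedAbelianGroup G
  open Boundary em φ
  open PointIso φ
  open Counting em
  private
    module X = RealizedTree X
    module Y = RealizedTree Y
    module ≼X = PointOrder X
    module ≼Y = PointOrder Y
    module CX = Configurations em X χ
    module CY = Configurations em Y χ′

    -- Rules out that the image of a leaf is a ray: its greatest point provides a meet with anything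
    -- equal to it, whereas equal rays have no meet.
    image-leaf-meet : ∀ l τ → _≋_ Y.tree (image (leaf l)) (image τ) → ∃ (Y.Meet (image (leaf l)) (image τ))
    image-leaf-meet l τ eq = Y.top (to p) , Y.mkMeet p-on
      (Y.≋⇒OnPath (image (leaf l)) (image τ) eq p-on) λ {v} v-on _ → ≼Y.pt≼⇒⊑
        (≼Y.≼-trans (proj₂ (to∘from (Y.pt v))) (to-mono (≼X.≼pt
          (image-on⁻ (leaf l) (Y.pt v) (subst (Y.OnPath (image (leaf l))) (sym (Y.top-pt v)) v-on)))))
      where
      p = X.pt (Leaf.vertex l)
      p-on : Y.OnPath (image (leaf l)) (Y.top (to p))
      p-on = image-on⁺ (leaf l) p (subst (X._⊑ Leaf.vertex l) (sym (X.top-pt _)) ε)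

    image-sameRay : ∀ ρ τ → Y.SameRay (image ρ) (image τ) → X.SameRay ρ τ
    image-sameRay (ray ρ) (ray τ) eq =
      image-injective (ray ρ) (ray τ) (Y.SameRay⇒≋ (image (ray ρ)) (image (ray τ)) eq)
    image-sameRay (leaf l) τ eq = contradiction eq
      (Y.Meet⇒Distinct (image (leaf l)) (image τ)
        (proj₂ (image-leaf-meet l τ (Y.SameRay⇒≋ (image (leaf l)) (image τ) eq))))
    image-sameRay (ray ρ) (leaf l) eq = contradiction eq′
      (Y.Meet⇒Distinct (image (leaf l)) (image (ray ρ))
        (proj₂ (image-leaf-meet l (ray ρ) (Y.SameRay⇒≋ (image (leaf l)) (image (ray ρ)) eq′))))
      where eq′ = Y.SameRay-sym (image (ray ρ)) (image (leaf l)) eq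

    -- If some leaf l corresponds to m, every entry whose image is m equals l, so the count is
    -- bounded by the capacity of l.
    image-occurrences : ∀ m L → (∀ l → CX.occurrences l L ≤∞ CapacityFunction.cap χ l) →
                        CY.occurrences m (map image L) ≤∞ CapacityFunction.cap χ′ m
    image-occurrences m L capacity
      with em {∃ λ l → X.pt (Leaf.vertex l) X.≼ from (Y.pt (Leaf.vertex m)) ×
                       from (Y.pt (Leaf.vertex m)) X.≼ X.pt (Leaf.vertex l)}
    ... | yes (l , l≼m , m≼l) = ≤-≤∞-trans (CapacityFunction.cap χ′ m)
      (count-map-≤ image preimage L)
      (subst (CX.occurrences l L ≤∞_) (same l m l≼m m≼l) (capacity l))
      where
      preimage : ∀ ρ → _≋_ Y.tree (image ρ) (leaf m) → _≋_ X.tree ρ (leaf l)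
      preimage ρ eq with image-leaf ρ m eq
      ... | l′ , refl , l′≼m , m≼l′ = X.leaf-≡ (X.⊑-antisym
        (subst (X._⊑ _) (X.top-pt _) (≼X.≼pt⇒⊑ (≼X.≼-trans l′≼m m≼l)))
        (subst (X._⊑ _) (X.top-pt _) (≼X.≼pt⇒⊑ (≼X.≼-trans l≼m m≼l′))))
    -- Without a corresponding leaf nothing in `L` is sent to m, and a count of zero respects any
    -- capacity.
    ... | no ∄l = subst (_≤∞ CapacityFunction.cap χ′ m)
      (sym (count-none (All.map⁺ (All.universal none L))))
      (≤-≤∞-trans (CapacityFunction.cap χ′ m) z≤n (CapacityFunction.positive χ′ m))
      where
      none : ∀ ρ → ¬ (_≋_ Y.tree (image ρ) (leaf m))
      none ρ eq with image-leaf ρ m eq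
      ... | l , _ , l≼m , m≼l = ∄l (l , l≼m , m≼l)

    image-pairing : ∀ ρ τ → X.Distinct ρ τ → CX.pairing ρ τ ≈ CY.pairing (image ρ) (image τ)
    image-pairing ρ τ d =
      let v , mv = X.meet em ρ τ d
          w , mw = Y.meet em (image ρ) (image τ) (d ∘ image-sameRay ρ τ)
      in ≈-trans (CX.pairing-meet mv) (≈-trans (image-meet ρ τ mv mw) (≈-sym (CY.pairing-meet mw)))

    image-value : ∀ ρ L → All (X.Distinct ρ) L → CX.value ρ L ≈ CY.value (image ρ) (map image L)
    image-value ρ []      []       = ≈-refl
    image-value ρ (τ ∷ L) (d ∷ ds) = +-cong (image-pairing ρ τ d) (image-value ρ L ds)

  image-energy : ∀ {L} → AllPairs X.Distinct L → CX.energy L ≈ CY.energy (map image L)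
  image-energy []               = ≈-refl
  image-energy {ρ ∷ L} (d ∷ ds) = +-cong (image-value ρ L d) (image-energy ds)

  image-feasible : ∀ {L} → CX.Feasible L → CY.Feasible (map image L)
  image-feasible {L} (CX.mkFeasible distinct capacity) = CY.mkFeasible
    (AllPairs.map⁺ (AllPairs.map (λ {ρ} {τ} d → d ∘ image-sameRay ρ τ) distinct))
    (λ m → image-occurrences m L capacity)

-- A competitor on the side of Y is pulled back along the inverse isomorphism to a feasible list of
-- the same length and energy, where the optimality of L applies.
image-optimal : ∀ (em : ExcludedMiddle 0ℓ) {G} {X Y : RealizedTree G} (φ : PointIso X Y) {χ χ′} →
  SameCapacities φ χ χ′ → ∀ {L} → Configurations.Optimal em X χ L →
  Configurations.Optimal em Y χ′ (map (Boundary.image em φ) L) ×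
  OrderedAbelianGroup._≈_ G (Configurations.energy em X χ L)
    (Configurations.energy em Y χ′ (map (Boundary.image em φ) L))
image-optimal em {G} {X} {Y} φ {χ} {χ′} same {L} L-opt =
  CY.mkOptimal (Forth.image-feasible L-feasible) (λ {M} M-feasible eq →
    ≤-trans (≤-reflexive (≈-sym L≈))
      (≤-trans (CX.Optimal.minimal L-opt (Back.image-feasible M-feasible)
                 (trans (length-map _ M) (trans eq (length-map _ L))))
        (≤-reflexive (≈-sym (Back.image-energy (CY.Feasible.distinct M-feasible)))))) ,
  L≈
  where
  open OrderedAbelianGroup G
  module CX = Configurations em X χ
  module CY = Configurations em Y χ′
  module Forth = Transport em φ same
  module Back = Transport em (PointIso-sym φ) {χ′} {χ} (SameCapacities-sym {φ = φ} {χ} {χ′} same)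
  L-feasible = CX.Optimal.feasible L-opt
  L≈ = Forth.image-energy (CX.Feasible.distinct L-feasible)

-- Length spaces and isometries

-- The points, coordinates and walks of a metric realization, over an arbitrary
-- ordered group.
record LengthSpace (G : OrderedAbelianGroup) : Set₁ where
  open OrderedAbelianGroup G
  field
    realizedTree : RealizedTree G
  open RealizedTree realizedTree public
  field
    gap      : Carrier → Carrier → Carrier
    gap-sym  : ∀ s t → gap s t ≈ gap t s
    gap-≥    : ∀ s t → s ≤ t + gap s t
    gap-+    : ∀ s t → s ≤ t → gap s t + s ≈ t

    Coord        : Edge tree → Pt → Carrier → Set
    coord-source : ∀ e → Coord e (pt (source tree e)) 0#
    coord-target : ∀ e → Coord e (pt (target tree e)) (len e)
    coord-H      : ∀ {e p s} → Coord e p s → H p ≈ height (source tree e) + s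
    coord-top    : ∀ {e p s} → Coord e p s →
                   (s ≈ 0# × top p ≡ source tree e) ⊎ top p ≡ target tree e
    coordinate   : ∀ p → p ≡ pt (top p) ⊎ ∃₂ λ e s → Coord e p s

    Path      : Pt → Pt → Carrier → Set
    stay      : ∀ {p} → Path p p 0#
    follow    : ∀ {e p q r s t d} → Coord e p s → Coord e q t → Path q r d → Path p r (gap s t + d)
    path-++   : ∀ {p q r c d} → Path p q c → Path q r d → ∃ λ b → b ≈ c + d × Path p r b
    -- The source of all lower bounds on walk lengths: a function that is 1-Lipschitz on each closed
    -- edge is so along every walk.
    lipschitz : (f : Pt → Carrier) →
                (∀ {e p q s t} → Coord e p s → Coord e q t → f q ≤ f p + gap s t) →
                ∀ {p q c} → Path p q c → f q ≤ f p + c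

  record Dist (p q : Pt) (d : Carrier) : Set where
    constructor mkDist
    field
      lower    : ∀ {c} → Path p q c → d ≤ c
      greatest : ∀ b → (∀ {c} → Path p q c → b ≤ c) → b ≤ d

-- Distances of comparable and of branching points

module Distances (em : ExcludedMiddle 0ℓ) {G : OrderedAbelianGroup} (X : LengthSpace G) where
  open OrderedAbelianGroup G
  open OrderedAbelianGroupProperties G
  open LengthSpace X
  open PointOrder realizedTree
  open CommutativeMonoidSolver commutativeMonoid using (solve; _⊜_; _⊕_)

  Dist-unique : ∀ {p q d d′} → Dist p q d → Dist p q d′ → d ≈ d′
  Dist-unique D D′ = ≤-antisym (Dist.greatest D′ _ (Dist.lower D)) (Dist.greatest D _ (Dist.lower D′))

  private
    -- The Lipschitz estimate for a function of slope -1 on an edge: function plus coordinate is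
    -- constant. In `ascending` the slope is 1.
    descending : ∀ {a b s t} → a + s ≈ b + t → b ≤ a + gap s t
    descending {a} {b} {s} {t} eq = ≤-by (gap-≥ s t)
      (≈-trans (solve 3 (λ b t g → b ⊕ (t ⊕ g) ⊜ (b ⊕ t) ⊕ g) ≈-refl b t (gap s t))
        (≈-trans (+-cong (≈-sym eq) ≈-refl)
          (solve 3 (λ a s g → (a ⊕ s) ⊕ g ⊜ (a ⊕ g) ⊕ s) ≈-refl a s (gap s t))))

    ascending : ∀ {a b h s t} → a ≈ h + s → b ≈ h + t → b ≤ a + gap s t
    ascending {a} {b} {h} {s} {t} a≈ b≈ = ≤-trans
      (descending {a} {b} {t} {s} (≈-trans (+-cong a≈ ≈-refl)
        (≈-trans (solve 3 (λ h s t → (h ⊕ s) ⊕ t ⊜ (h ⊕ t) ⊕ s) ≈-refl h s t)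
          (+-cong (≈-sym b≈) ≈-refl))))
      (+-monoʳ-≤ a (≤-reflexive (gap-sym t s)))

    0≤gap : ∀ s t → 0# ≤ gap s t
    0≤gap s t with ≤-total s t
    ... | inj₁ s≤t = +-cancelʳ-≤ s (≤-trans (≤-reflexive (+-identityˡ s))
                       (≤-trans s≤t (≤-reflexive (≈-sym (gap-+ s t s≤t)))))
    ... | inj₂ t≤s = +-cancelʳ-≤ t (≤-trans (≤-reflexive (+-identityˡ t))
                       (≤-trans t≤s (≤-reflexive (≈-sym (≈-trans (+-cong (gap-sym s t) ≈-refl) (gap-+ t s t≤s))))))

  H-lipschitz : ∀ {p q c} → Path p q c → H q ≤ H p + c
  H-lipschitz = lipschitz H λ x y → ascending (coord-H x) (coord-H y)

  -H-lipschitz : ∀ {p q c} → Path p q c → - H q ≤ - H p + c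
  -H-lipschitz = lipschitz (λ p → - H p) λ {e} x y → descending
      (≈-trans (cancel (coord-H x)) (≈-sym (cancel (coord-H y))))
    where
    cancel : ∀ {x h s} → x ≈ h + s → - x + s ≈ - h
    cancel {x} {h} {s} x≈ = +-cancelʳ-≈ h (≈-trans
      (≈-trans (+-assoc (- x) s h) (≈-trans (+-cong ≈-refl (≈-trans (+-comm s h) (≈-sym x≈))) (-‿inverseˡ x)))
      (≈-sym (-‿inverseˡ h)))

  -- The difference of the values of f is a lower bound for all walk lengths, hence for their
  -- infimum.
  Dist-lipschitz : (f : Pt → Carrier) → (∀ {p q c} → Path p q c → f q ≤ f p + c) →
                   ∀ {p q d} → Dist p q d → f q ≤ f p + d
  Dist-lipschitz f lip {p} {q} {d} D =
    let b , b+fp≈fq = difference (f p) (f q)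
    in ≤-trans (≤-reflexive (≈-trans (≈-sym b+fp≈fq) (+-comm b (f p))))
         (+-monoʳ-≤ (f p) (Dist.greatest D b λ {c} walk → +-cancelʳ-≤ (f p)
           (≤-trans (≤-reflexive b+fp≈fq) (≤-trans (lip walk) (≤-reflexive (+-comm (f p) c))))))

  0≤Dist : ∀ {p q d} → Dist p q d → 0# ≤ d
  0≤Dist {d = d} D = ≤-trans (Dist-lipschitz (λ _ → 0#)
    (lipschitz (λ _ → 0#) λ {e} {p} {q} {s} {t} _ _ →
      ≤-trans (0≤gap s t) (≤-reflexive (≈-sym (+-identityˡ _)))) D)
    (≤-reflexive (+-identityˡ d))

  -- The reflection of H at the vertex w on the part of the tree that is entered
  -- through the edge from w to c.
  module Fold {w c} (s₀ : RootedTree._⟶_ tree w c) where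

    folded : Pt → Carrier
    folded p with em {c ⊑ top p}
    ... | yes _ = (height w + height w) + - H p
    ... | no  _ = H p

    folded-above : ∀ {p} → c ⊑ top p → folded p + H p ≈ height w + height w
    folded-above {p} c⊑p with em {c ⊑ top p}
    ... | yes _   = ≈-trans (+-assoc _ (- H p) (H p)) (≈-trans (+-cong ≈-refl (-‿inverseˡ (H p))) (+-identityʳ _))
    ... | no  c⋢p = contradiction c⊑p c⋢p

    folded-beside : ∀ {p} → ¬ (c ⊑ top p) → folded p ≈ H p
    folded-beside {p} c⋢p with em {c ⊑ top p}
    ... | yes c⊑p = contradiction c⊑p c⋢p
    ... | no  _   = ≈-refl

    private
      between : ∀ {e p s} → Coord e p s → source tree e ⊑ top p × top p ⊑ target tree e
      between {u , v , st} {p} x with coord-top x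
      ... | inj₁ (_ , eq) = subst (u ⊑_) (sym eq) ε , subst (_⊑ v) (sym eq) (st ◅ ε)
      ... | inj₂ eq       = subst (u ⊑_) (sym eq) (st ◅ ε) , subst (_⊑ v) (sym eq) ε

      above : ∀ {e p s} → c ⊑ source tree e → Coord e p s →
              (folded p + s) + height (source tree e) ≈ height w + height w
      above {e} {p} {s} c⊑ x = ≈-trans
        (≈-trans (+-assoc _ s _) (+-cong ≈-refl (≈-trans (+-comm s _) (≈-sym (coord-H x)))))
        (folded-above (c⊑ ◅◅ proj₁ (between x)))

      on-edge : ∀ {e p s} → source tree e ≡ w → target tree e ≡ c → Coord e p s →
                folded p + s ≈ height w
      on-edge {e} {p} {s} refl refl x with coord-top x
      ... | inj₁ (s≈0 , eq) = ≈-trans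
        (+-cong (≈-trans (folded-beside λ c⊑p → acyclic s₀ (subst (c ⊑_) eq c⊑p))
                  (≈-trans (coord-H x) (≈-trans (+-cong ≈-refl s≈0) (+-identityʳ _)))) s≈0)
        (+-identityʳ _)
      ... | inj₂ eq = +-cancelʳ-≈ (height w) (≈-trans
        (≈-trans (+-assoc _ s _) (+-cong ≈-refl (≈-trans (+-comm s _) (≈-sym (coord-H x)))))
        (folded-above (subst (c ⊑_) (sym eq) ε)))

      -- On edges outside the branch `folded` has slope 1, on edges inside it slope -1. The edge
      -- from w to c also has slope -1, since reflection fixes the height of w.
      step : ∀ {e p q s t} → Coord e p s → Coord e q t → folded q ≤ folded p + gap s t
      step {e@(u , v , st)} {p} {q} {s} {t} x y with em {c ⊑ v}
      ... | no c⋢v = ascending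
        (≈-trans (folded-beside λ c⊑ → c⋢v (c⊑ ◅◅ proj₂ (between x))) (coord-H x))
        (≈-trans (folded-beside λ c⊑ → c⋢v (c⊑ ◅◅ proj₂ (between y))) (coord-H y))
      ... | yes c⊑v with ⊑-parent c⊑v st
      ...   | inj₂ c⊑u = descending (+-cancelʳ-≈ (height u) (≈-trans (above c⊑u x) (≈-sym (above c⊑u y))))
      ...   | inj₁ refl = descending
        (≈-trans (on-edge (parent-unique st s₀) refl x) (≈-sym (on-edge (parent-unique st s₀) refl y)))

    folded-lipschitz : ∀ {p q c} → Path p q c → folded q ≤ folded p + c
    folded-lipschitz = lipschitz folded step

    private
      -- Leaving the branch means descending from p to w and climbing to q. The Lipschitz bound on
      -- `folded` says that this costs at least the two height differences.
      detour : ∀ {p q d} → c ⊑ top p → ¬ (c ⊑ top q) → folded q ≤ folded p + d →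
               H q + H p ≤ (height w + height w) + d
      detour {p} {q} {d} c⊑p c⋢q le = ≤-trans
        (+-monoˡ-≤ (H p) (≤-trans (≤-reflexive (≈-sym (folded-beside c⋢q))) le))
        (≤-reflexive (≈-trans (solve 3 (λ f d h → (f ⊕ d) ⊕ h ⊜ (f ⊕ h) ⊕ d) ≈-refl (folded p) d (H p))
          (+-cong (folded-above c⊑p) ≈-refl)))

    path-detour : ∀ {p q d} → c ⊑ top p → ¬ (c ⊑ top q) → Path p q d →
                  H q + H p ≤ (height w + height w) + d
    path-detour c⊑p c⋢q walk = detour c⊑p c⋢q (folded-lipschitz walk)

    Dist-detour : ∀ {p q d} → c ⊑ top p → ¬ (c ⊑ top q) → Dist p q d →
                  H q + H p ≤ (height w + height w) + d
    Dist-detour c⊑p c⋢q D = detour c⊑p c⋢q (Dist-lipschitz folded folded-lipschitz D)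

  branch : ∀ p q → ¬ (top p ⊑ top q) →
           ∃₂ λ w c → RootedTree._⟶_ tree w c × w ⊑ top q × c ⊑ top p × ¬ (c ⊑ top q)
  branch p q p⋢q =
    let w , c , s , _ , c⊑p , w⊑q , c⋢q =
          firstExit em (_⊑ top q) (RootedTree.path tree (top q)) (RootedTree.path tree (top p)) p⋢q
    in w , c , s , w⊑q , c⊑p , c⋢q

  branch<H : ∀ p {w c} → RootedTree._⟶_ tree w c → c ⊑ top p → height w < H p
  branch<H p s c⊑p with unsnoc c⊑p
  ... | inj₁ refl          = height<H p s
  ... | inj₂ (_ , c⊑ , s′) = height≤H p (s ◅ c⊑) s′

  -- If p branched away from q at w, the detour through w would make d exceed the difference of
  -- heights, because p lies strictly above w.
  Dist⇒≼ : ∀ {p q d} → Dist p q d → d + H p ≈ H q → p ≼ q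
  Dist⇒≼ {p} {q} {d} D d+Hp≈Hq with em {top p ⊑ top q}
  ... | yes p⊑q = mk≼ p⊑q (≤-trans (x≤x+y (0≤Dist D)) (≤-reflexive (≈-trans (+-comm (H p) d) d+Hp≈Hq)))
  ... | no  p⋢q =
    let w , c , s , w⊑q , c⊑p , c⋢q = branch p q p⋢q
        w<p = branch<H p s c⊑p
        p+p≤w+w = ≤-by {H p + H p} {height w + height w} (Fold.Dist-detour s c⊑p c⋢q D)
          (≈-trans (solve 3 (λ p w d → (p ⊕ p) ⊕ ((w ⊕ w) ⊕ d) ⊜ (w ⊕ w) ⊕ ((d ⊕ p) ⊕ p)) ≈-refl
                     (H p) (height w) d)
            (+-cong ≈-refl (+-cong d+Hp≈Hq ≈-refl)))
        le = +-cancelʳ-≤ (H p) (≤-trans p+p≤w+w (+-monoʳ-≤ (height w) (<⇒≤ w<p)))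
    in contradiction le w<p

  -- Both directions are recorded because a walk between branches runs down one of them and up the
  -- other.
  Joined : Pt → Pt → Carrier → Set
  Joined p q d = (∃ λ c → c ≈ d × Path p q c) × (∃ λ c → c ≈ d × Path q p c)

  private
    joined-trans : ∀ {p q r c d} → Joined p q c → Joined q r d → Joined p r (c + d)
    joined-trans ((_ , c₁≈ , P₁) , (_ , c₂≈ , P₂)) ((_ , d₁≈ , Q₁) , (_ , d₂≈ , Q₂)) =
      let _ , b₁≈ , R₁ = path-++ P₁ Q₁
          _ , b₂≈ , R₂ = path-++ Q₂ P₂
      in (_ , ≈-trans b₁≈ (+-cong c₁≈ d₁≈) , R₁) ,
         (_ , ≈-trans b₂≈ (≈-trans (+-cong d₂≈ c₂≈) (+-comm _ _)) , R₂)

  Up : Pt → Pt → Set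
  Up p q = ∃ λ d → d + H p ≈ H q × Joined p q d

  private
    up-refl : ∀ {p} → Up p p
    up-refl = 0# , +-identityˡ _ , (0# , ≈-refl , stay) , (0# , ≈-refl , stay)

    up-trans : ∀ {p q r} → Up p q → Up q r → Up p r
    up-trans {p} {q} {r} (c , c≈ , J) (d , d≈ , K) = c + d ,
      ≈-trans (solve 3 (λ c d p → (c ⊕ d) ⊕ p ⊜ d ⊕ (c ⊕ p)) ≈-refl c d (H p))
        (≈-trans (+-cong ≈-refl c≈) d≈) ,
      joined-trans J K

    up-edge : ∀ {e p q s t} → Coord e p s → Coord e q t → H p ≤ H q → Up p q
    up-edge {e} {p} {q} {s} {t} x y p≤q = gap s t ,
      ≈-trans (+-cong ≈-refl (coord-H x))
        (≈-trans (solve 3 (λ g h s → g ⊕ (h ⊕ s) ⊜ h ⊕ (g ⊕ s)) ≈-refl _ _ _)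
          (≈-trans (+-cong ≈-refl (gap-+ s t s≤t)) (≈-sym (coord-H y)))) ,
      (_ , +-identityʳ _ , follow x y stay) ,
      (_ , ≈-trans (+-identityʳ _) (gap-sym t s) , follow y x stay)
      where
      s≤t : s ≤ t
      s≤t = ≤-by p≤q (≈-trans (+-cong ≈-refl (coord-H y))
        (≈-trans (solve 3 (λ s h t → s ⊕ (h ⊕ t) ⊜ t ⊕ (h ⊕ s)) ≈-refl _ _ _)
          (+-cong ≈-refl (≈-sym (coord-H x)))))

    H-pt≈ : ∀ v → H (pt v) ≈ height v
    H-pt≈ v = ≈-reflexive (H-pt v)

    up-⊑ : ∀ {v w} → v ⊑ w → Up (pt v) (pt w)
    up-⊑ ε       = up-refl
    up-⊑ (s ◅ p) = up-trans (up-edge (coord-source (_ , _ , s)) (coord-target (_ , _ , s))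
      (≤-trans (≤-reflexive (H-pt≈ _))
        (≤-trans (<⇒≤ (height-<-⟶ positive s)) (≤-reflexive (≈-sym (H-pt≈ _)))))) (up-⊑ p)

    -- A point with coordinate zero lies on an edge that starts at its top instead of ending there;
    -- it is treated as that vertex.
    data Position (p : Pt) : Set where
      atVertex : Up p (pt (top p)) → Up (pt (top p)) p → height (top p) ≤ H p → Position p
      onEdge   : ∀ {e s} → Coord e p s → target tree e ≡ top p → Position p

    position : ∀ p → Position p
    position p with coordinate p
    ... | inj₁ eq = atVertex (subst (Up p) eq up-refl) (subst (λ q → Up q p) eq up-refl)
      (≤-reflexive (≈-sym (≈-trans (≈-reflexive (cong H eq)) (H-pt≈ _))))
    ... | inj₂ (e , s , x) with coord-top x
    ...   | inj₂ eq = onEdge x (sym eq)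
    ...   | inj₁ (s≈0 , eq) = atVertex
      (subst (Up p ∘ pt) (sym eq) (up-edge x (coord-source e) (≤-reflexive Hp≈)))
      (subst (λ v → Up (pt v) p) (sym eq) (up-edge (coord-source e) x (≤-reflexive (≈-sym Hp≈))))
      (≤-reflexive (≈-trans (≈-reflexive (cong height eq)) (≈-trans (≈-sym (H-pt≈ _)) (≈-sym Hp≈))))
      where
      Hp≈ : H p ≈ H (pt (source tree e))
      Hp≈ = ≈-trans (coord-H x) (≈-trans (+-cong ≈-refl s≈0) (≈-trans (+-identityʳ _) (≈-sym (H-pt≈ _))))

    up-top : ∀ {p} → Position p → Up p (pt (top p))
    up-top (atVertex up _ _)   = up
    up-top {p} (onEdge {e} x eq) = subst (Up p ∘ pt) eq (up-edge x (coord-target e)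
      (≤-trans (H≤height p) (≤-reflexive (≈-trans (≈-reflexive (cong height (sym eq))) (≈-sym (H-pt≈ _))))))

    up-parent : ∀ {q w} → Position q → RootedTree._⟶_ tree w (top q) → Up (pt w) q
    up-parent (atVertex _ up _) s = up-trans (up-⊑ (s ◅ ε)) up
    up-parent {q} (onEdge {u , .(top q) , st} x refl) s with refl ← parent-unique st s =
      up-edge (coord-source _) x (≤-trans (≤-reflexive (H-pt≈ _)) (<⇒≤ (height<H q s)))

    up-sameTop : ∀ {p q} → top p ≡ top q → H p ≤ H q → Position p → Position q → Up p q
    up-sameTop {p} eq _ P (atVertex _ up _) = up-trans (subst (Up p ∘ pt) eq (up-top P)) up
    -- Here q must sit at the upper end of its edge: its height is at least that of p, which already
    -- is the height of the common top.
    up-sameTop {p} {q} eq p≤q (atVertex up _ top≤p) (onEdge {e} y eq′) =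
      up-trans (subst (Up p ∘ pt) (trans eq (sym eq′)) up)
        (up-edge (coord-target e) y
          (≤-trans (≤-reflexive (≈-trans (H-pt≈ _) (≈-reflexive (cong height (trans eq′ (sym eq))))))
            (≤-trans top≤p p≤q)))
    up-sameTop {p} {q} eq p≤q (onEdge {u , v , s} x eq₁) (onEdge {u′ , v′ , s′} y eq₂)
      with refl ← trans eq₁ (trans eq (sym eq₂)) with refl ← ⟶-unique s s′ = up-edge x y p≤q

  ≼⇒Up : ∀ {p q} → p ≼ q → Up p q
  ≼⇒Up {p} {q} (mk≼ t p≤q) with unsnoc t
  ... | inj₁ eq          = up-sameTop eq p≤q (position p) (position q)
  ... | inj₂ (w , t′ , s) =
    up-trans (up-top (position p)) (up-trans (up-⊑ t′) (up-parent (position q) s))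

  -- No walk is shorter than the difference of heights, since `H` is 1-Lipschitz, and the ascending
  -- walk attains it.
  ≼⇒Dist : ∀ {p q} → p ≼ q → ∃ λ d → d + H p ≈ H q × Dist p q d
  ≼⇒Dist {p} {q} p≼q with ≼⇒Up p≼q
  ... | d , d≈ , (c , c≈d , walk) , _ = d , d≈ , mkDist
    (λ {c} walk′ → +-cancelʳ-≤ (H p)
      (≤-trans (≤-reflexive d≈) (≤-trans (H-lipschitz walk′) (≤-reflexive (+-comm (H p) c)))))
    λ b b≤ → ≤-trans (b≤ walk) (≤-reflexive c≈d)

  -- The walk down to w and up to q attains the lower bound of `path-detour`. Thus the distance
  -- exists, and an isometry can be applied to it.
  branch⇒Dist : ∀ p q → ¬ (top p ⊑ top q) → H p ≤ H q →
    ∃ λ w → height w < H p ×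
    ∃₂ λ c d → c + height w ≈ H p × d + height w ≈ H q × Dist p q (c + d)
  branch⇒Dist p q p⋢q p≤q with branch p q p⋢q
  ... | w , c , s , w⊑q , c⊑p , c⋢q with branch<H p s c⊑p
  ...   | w<p
    with ≼⇒Up {pt w} {p} (mk≼ (subst (_⊑ top p) (sym (top-pt w)) (s ◅ c⊑p)) (≤-trans (≤-reflexive (H-pt≈ w)) (<⇒≤ w<p)))
       | ≼⇒Up {pt w} {q} (mk≼ (subst (_⊑ top q) (sym (top-pt w)) w⊑q)
           (≤-trans (≤-reflexive (H-pt≈ w)) (≤-trans (<⇒≤ w<p) p≤q)))
  ...   | a , a≈ , _ , (_ , a′≈ , P) | b , b≈ , (_ , b′≈ , Q) , _ =
    w , w<p , a , b , a+w≈ , b+w≈ , mkDist lower λ z z≤ →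
      let _ , e≈ , R = path-++ P Q
      in ≤-trans (z≤ R) (≤-reflexive (≈-trans e≈ (+-cong a′≈ b′≈)))
    where
    a+w≈ : a + height w ≈ H p
    a+w≈ = ≈-trans (+-cong ≈-refl (≈-sym (H-pt≈ w))) a≈
    b+w≈ : b + height w ≈ H q
    b+w≈ = ≈-trans (+-cong ≈-refl (≈-sym (H-pt≈ w))) b≈
    lower : ∀ {d} → Path p q d → a + b ≤ d
    lower {d} walk = ≤-by (Fold.path-detour s c⊑p c⋢q walk)
      (≈-trans (solve 4 (λ a b w d → (a ⊕ b) ⊕ ((w ⊕ w) ⊕ d) ⊜ d ⊕ ((b ⊕ w) ⊕ (a ⊕ w))) ≈-refl a b (height w) d)
        (+-cong ≈-refl (+-cong b+w≈ a+w≈)))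

  SameDist⇒≼ : ∀ {p q} → Dist p q 0# → p ≼ q × q ≼ p
  SameDist⇒≼ {p} {q} D = p≼q , ≼-reverse p≼q q≤p
    where
    q≤p : H q ≤ H p
    q≤p = ≤-trans (Dist-lipschitz H H-lipschitz D) (≤-reflexive (+-identityʳ _))
    p≤q : H p ≤ H q
    p≤q = ≤-by (Dist-lipschitz (λ r → - H r) -H-lipschitz D)
      (≈-trans (+-cong ≈-refl (+-identityʳ _))
        (≈-trans (-‿inverseʳ (H p)) (≈-sym (-‿inverseʳ (H q)))))
    p≼q : p ≼ q
    p≼q = Dist⇒≼ D (≈-trans (+-identityˡ _) (≤-antisym p≤q q≤p))

  ≼≽⇒Dist : ∀ {p q} → p ≼ q → q ≼ p → Dist p q 0#
  ≼≽⇒Dist {p} {q} p≼q q≼p =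
    let d , d≈ , mkDist lower greatest = ≼⇒Dist p≼q
        d≈0 = +-cancelʳ-≈ (H p) (≈-trans d≈
          (≈-trans (≤-antisym (_≼_.H-≤ q≼p) (_≼_.H-≤ p≼q)) (≈-sym (+-identityˡ (H p)))))
    in mkDist (λ walk → ≤-trans (≤-reflexive (≈-sym d≈0)) (lower walk))
              (λ b b≤ → ≤-trans (greatest b b≤) (≤-reflexive d≈0))

-- From isometries to isomorphisms of point orders

module Isometry (em : ExcludedMiddle 0ℓ) {G : OrderedAbelianGroup} (X Y : LengthSpace G) where
  open OrderedAbelianGroup G
  open OrderedAbelianGroupProperties G
  open CommutativeMonoidSolver commutativeMonoid using (solve; _⊜_; _⊕_)
  private
    module X = LengthSpace X
    module Y = LengthSpace Y
    module DX = Distances em X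
    module DY = Distances em Y
    module ≼X = PointOrder X.realizedTree
    module ≼Y = PointOrder Y.realizedTree

  module _ (to : X.Pt → Y.Pt)
           (isometric : ∀ p q d → X.Dist p q d → Y.Dist (to p) (to q) d)
           (surjective : ∀ q → ∃ λ p → Y.Dist (to p) q 0#)
           (to-root : Y.Dist (to (X.pt X.root)) (Y.pt Y.root) 0#) where

    private
      detour-too-long : ∀ {w p q} a b → a + w ≈ p → b + w ≈ q → (a + b) + p ≈ q → ¬ (w < p)
      detour-too-long {w} {p} {q} a b a+w≈p b+w≈q a+b+p≈q w<p = w<p
        (≤-trans (≤-reflexive (≈-sym a+w≈p)) (≤-trans (+-monoʳ-≤ a (<⇒≤ w<p)) (≤-reflexive a+p≈w)))
        where
        a+p≈w : a + p ≈ w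
        a+p≈w = ≈-by (≈-trans a+b+p≈q (≈-sym b+w≈q))
          (solve 4 (λ a b p w → (a ⊕ p) ⊕ (b ⊕ w) ⊜ w ⊕ ((a ⊕ b) ⊕ p)) ≈-refl a b p w)

      H-root : X.H (X.pt X.root) ≈ 0#
      H-root = ≈-trans (≈-reflexive (X.H-pt X.root)) X.height-root

      H-to-root : Y.H (to (X.pt X.root)) ≈ 0#
      H-to-root = ≤-antisym
        (≤-trans (Y._≼_.H-≤ (proj₁ (DY.SameDist⇒≼ to-root)))
          (≤-reflexive (≈-trans (≈-reflexive (Y.H-pt Y.root)) Y.height-root)))
        (Y.0≤H _)

      H-to : ∀ p → Y.H (to p) ≈ X.H p
      H-to p =
        let d , d≈ , D = DX.≼⇒Dist {X.pt X.root} {p} (X.mk≼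
              (subst (X._⊑ X.top p) (sym (X.top-pt X.root)) (X.path (X.top p)))
              (≤-trans (≤-reflexive H-root) (X.0≤H p)))
            c , c≈ , C = DY.≼⇒Dist {to (X.pt X.root)} {to p} (Y.mk≼
              -- The image of the root is known only up to distance zero; its `H` vanishes, which
              -- forces its top to be the root.
              (subst (Y._⊑ Y.top (to p)) (sym (≼Y.H0⇒top-root _ (≤-reflexive H-to-root))) (Y.path _))
              (≤-trans (≤-reflexive H-to-root) (Y.0≤H (to p))))
        in ≈-trans (≈-sym c≈) (≈-trans (+-cong (DY.Dist-unique C (isometric _ _ _ D))
             (≈-trans H-to-root (≈-sym H-root))) d≈)

      to-mono : ∀ {p q} → p X.≼ q → to p Y.≼ to q
      to-mono {p} {q} p≼q =
        let d , d≈ , D = DX.≼⇒Dist p≼q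
        in DY.Dist⇒≼ (isometric p q d D)
             (≈-trans (+-cong ≈-refl (H-to p)) (≈-trans d≈ (≈-sym (H-to q))))

      -- Distances are transported only forwards, so the order is reflected by contradiction: for
      -- branching p and q the distance is computed before mapping, and it exceeds the difference of
      -- heights that the comparable images have.
      to-reflects : ∀ {p q} → to p Y.≼ to q → p X.≼ q
      to-reflects {p} {q} le = X.mk≼ top-⊑ p≤q
        where
        p≤q : X.H p ≤ X.H q
        p≤q = ≤-trans (≤-reflexive (≈-sym (H-to p))) (≤-trans (Y._≼_.H-≤ le) (≤-reflexive (H-to q)))
        top-⊑ : X.top p X.⊑ X.top q
        top-⊑ with em {X.top p X.⊑ X.top q}
        ... | yes p⊑q = p⊑q
        ... | no p⋢q =
          let w , w<p , a , b , a≈ , b≈ , D = DX.branch⇒Dist p q p⋢q p≤q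
              d , d≈ , D′ = DY.≼⇒Dist le
          in contradiction w<p (detour-too-long a b a≈ b≈
               (≈-trans (+-cong (DY.Dist-unique (isometric p q (a + b) D) D′) (≈-sym (H-to p)))
                 (≈-trans d≈ (H-to q))))

      from : Y.Pt → X.Pt
      from q = proj₁ (surjective q)

      to∘from : ∀ q → to (from q) Y.≼ q × q Y.≼ to (from q)
      to∘from q = DY.SameDist⇒≼ (proj₂ (surjective q))

    isometry⇒PointIso : PointIso X.realizedTree Y.realizedTree
    isometry⇒PointIso = record
      { to        = to
      ; from      = from
      ; to-mono   = to-mono
      ; from-mono = λ {p} {q} le → to-reflects
          (≼Y.≼-trans (proj₁ (to∘from p)) (≼Y.≼-trans le (proj₂ (to∘from q))))
      ; to∘from   = to∘from
      ; from∘to   = λ p → to-reflects (proj₁ (to∘from (to p))) , to-reflects (proj₂ (to∘from (to p)))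
      ; H-to      = H-to
      ; H-from    = λ q → ≈-trans (≈-sym (H-to (from q)))
          (≤-antisym (Y._≼_.H-≤ (proj₁ (to∘from q))) (Y._≼_.H-≤ (proj₂ (to∘from q))))
      }

-- The realization over ℝ and greedy sequences

module Realization (em : ExcludedMiddle 0ℓ) (T : RootedTree) (ℓ : LengthFunction T) where
  open ℝ-Order
  private
    G = ℝ-orderedAbelianGroup em
    module R = OrderedAbelianGroup G
    module RP = OrderedAbelianGroupProperties G
  open RootedTree T
  open LengthFunction ℓ using (len)
  open TreeProperties T
  open Height G T len

  len-positive : ∀ e → ¬ (len e ≤ᴿ 0ᴿ)
  len-positive e = <ᴿ⇒≱ {0ᴿ} {len e} (LengthFunction.positive ℓ e)

  private
    side : ∀ e {P : Set} → Dec P → Vertex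
    side e (yes _) = source T e
    side e (no  _) = target T e

  topOf : Point ℓ → Vertex
  topOf (vertex v)       = v
  -- Coordinate zero is glued to the source; any positive coordinate, including the full length, has
  -- the target as its top.
  topOf (inside e t _ _) = side e (em {t ≤ᴿ 0ᴿ})

  heightOf : Point ℓ → ℝ
  heightOf (vertex v)       = height v
  heightOf (inside e t _ _) = height (source T e) +ᴿ t

  private
    0≤heightOf : ∀ p → 0ᴿ ≤ᴿ heightOf p
    0≤heightOf (vertex v) = 0≤height len-positive v
    0≤heightOf (inside e t 0≤t _) =
      R.≤-trans {0ᴿ} {h} {h +ᴿ t} (0≤height len-positive (source T e)) (RP.x≤x+y {h} {t} 0≤t)
      where h = height (source T e)

    heightOf≤ : ∀ p → heightOf p ≤ᴿ height (topOf p)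
    heightOf≤ (vertex v) = R.≤-refl {height v}
    heightOf≤ (inside e t 0≤t t≤ℓ) with em {t ≤ᴿ 0ᴿ}
    ... | yes t≤0 = R.≤-trans {h +ᴿ t} {h +ᴿ 0ᴿ} {h} (RP.+-monoʳ-≤ h {t} {0ᴿ} t≤0)
                      (R.≤-reflexive {h +ᴿ 0ᴿ} {h} (R.+-identityʳ h))
      where h = height (source T e)
    ... | no  _   = R.≤-trans {h +ᴿ t} {h +ᴿ len e} {h′} (RP.+-monoʳ-≤ h {t} {len e} t≤ℓ)
                      (R.≤-reflexive {h +ᴿ len e} {h′}
                        (R.≈-sym {h′} {h +ᴿ len e} (height-⟶ (proj₂ (proj₂ e)))))
      where h  = height (source T e)
            h′ = height (target T e)

    height<heightOf : ∀ p {u} → u ⟶ topOf p → ¬ (heightOf p ≤ᴿ height u)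
    height<heightOf (vertex v) s = height-<-⟶ len-positive s
    height<heightOf (inside e t 0≤t _) {u} s with em {t ≤ᴿ 0ᴿ}
    ... | yes _ = RP.<-≤-trans {height u} {h} {h +ᴿ t} (height-<-⟶ len-positive s) (RP.x≤x+y {h} {t} 0≤t)
      where h = height (source T e)
    ... | no t≰0 with refl ← parent-unique s (proj₂ (proj₂ e)) = RP.x<x+y {height u} {t} t≰0

  realizedTree : RealizedTree G
  realizedTree = record
    { tree = T ; len = len ; positive = len-positive
    ; Pt = Point ℓ ; pt = vertex ; top = topOf ; H = heightOf
    ; top-pt = λ _ → refl ; H-pt = λ _ → refl
    ; 0≤H = 0≤heightOf ; H≤height = heightOf≤ ; height<H = height<heightOf }

  private
    gap-+ : ∀ s t → s ≤ᴿ t → ∣ s -ᴿ t ∣ᴿ +ᴿ s ≈ᴿ t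
    gap-+ s t s≤t = R.≤-antisym {g +ᴿ s} {t} (∣x-y∣+x≤y s t s≤t)
      (R.≤-trans {t} {s +ᴿ ∣ t -ᴿ s ∣ᴿ} {g +ᴿ s} (x≤y+∣x-y∣ t s)
        (R.≤-reflexive {s +ᴿ ∣ t -ᴿ s ∣ᴿ} {g +ᴿ s}
          (R.≈-trans {s +ᴿ ∣ t -ᴿ s ∣ᴿ} {∣ t -ᴿ s ∣ᴿ +ᴿ s} {g +ᴿ s} (R.+-comm s ∣ t -ᴿ s ∣ᴿ)
            (R.+-cong {∣ t -ᴿ s ∣ᴿ} {g} {s} {s} (∣x-y∣-sym t s) (R.≈-refl {s})))))
      where g = ∣ s -ᴿ t ∣ᴿ

    coordinate-height : ∀ {e p s} → Coordinate ℓ e p s → heightOf p ≈ᴿ height (source T e) +ᴿ s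
    coordinate-height {e} at-source = R.≈-sym {height (source T e) +ᴿ 0ᴿ} {height (source T e)}
      (R.+-identityʳ (height (source T e)))
    coordinate-height {e} at-target = height-⟶ (proj₂ (proj₂ e))
    coordinate-height {e} {s = s} (at-inside _ _) = R.≈-refl {height (source T e) +ᴿ s}

    coordinate-top : ∀ {e p s} → Coordinate ℓ e p s →
                     (s ≈ᴿ 0ᴿ × topOf p ≡ source T e) ⊎ topOf p ≡ target T e
    coordinate-top at-source = inj₁ (R.≈-refl {0ᴿ} , refl)
    coordinate-top at-target = inj₂ refl
    coordinate-top {s = t} (at-inside 0≤t _) with em {t ≤ᴿ 0ᴿ}
    ... | yes t≤0 = inj₁ (R.≤-antisym {t} {0ᴿ} t≤0 0≤t , refl)
    ... | no  _   = inj₂ refl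

    coordinate : ∀ p → p ≡ vertex (topOf p) ⊎ ∃₂ λ e s → Coordinate ℓ e p s
    coordinate (vertex v)           = inj₁ refl
    coordinate (inside e t 0≤t t≤ℓ) = inj₂ (e , t , at-inside 0≤t t≤ℓ)

    walk-++ : ∀ {p q r c d} → Walk ℓ p q c → Walk ℓ q r d → ∃ λ b → b ≈ᴿ c +ᴿ d × Walk ℓ p r b
    walk-++ {d = d} done W = d , R.≈-sym {0ᴿ +ᴿ d} {d} (R.+-identityˡ d) , W
    walk-++ {d = d} (move {s = s} {t} {c} x y V) W =
      let b , b≈ , U = walk-++ V W
          g = ∣ s -ᴿ t ∣ᴿ
      in g +ᴿ b ,
         R.≈-trans {g +ᴿ b} {g +ᴿ (c +ᴿ d)} {(g +ᴿ c) +ᴿ d}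
           (R.+-cong {g} {g} {b} {c +ᴿ d} (R.≈-refl {g}) b≈)
           (R.≈-sym {(g +ᴿ c) +ᴿ d} {g +ᴿ (c +ᴿ d)} (R.+-assoc g c d)) ,
         move x y U

    walk-lipschitz : (f : Point ℓ → ℝ) →
      (∀ {e p q s t} → Coordinate ℓ e p s → Coordinate ℓ e q t → f q ≤ᴿ f p +ᴿ ∣ s -ᴿ t ∣ᴿ) →
      ∀ {p q c} → Walk ℓ p q c → f q ≤ᴿ f p +ᴿ c
    walk-lipschitz f step {p} done =
      R.≤-reflexive {f p} {f p +ᴿ 0ᴿ} (R.≈-sym {f p +ᴿ 0ᴿ} {f p} (R.+-identityʳ (f p)))
    walk-lipschitz f step {p} {r} (move {q = q} {s = s} {t} {d} x y W) =
      let g = ∣ s -ᴿ t ∣ᴿ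
      in R.≤-trans {f r} {f q +ᴿ d} {f p +ᴿ (g +ᴿ d)} (walk-lipschitz f step W)
           (R.≤-trans {f q +ᴿ d} {(f p +ᴿ g) +ᴿ d} {f p +ᴿ (g +ᴿ d)}
             (R.+-monoˡ-≤ d {f q} {f p +ᴿ g} (step x y))
             (R.≤-reflexive {(f p +ᴿ g) +ᴿ d} {f p +ᴿ (g +ᴿ d)} (R.+-assoc (f p) g d)))

  lengthSpace : LengthSpace G
  lengthSpace = record
    { realizedTree = realizedTree
    ; gap = λ s t → ∣ s -ᴿ t ∣ᴿ ; gap-sym = ∣x-y∣-sym ; gap-≥ = x≤y+∣x-y∣ ; gap-+ = gap-+
    ; Coord = Coordinate ℓ ; coord-source = λ _ → at-source ; coord-target = λ _ → at-target
    ; coord-H = coordinate-height ; coord-top = coordinate-top ; coordinate = coordinate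
    ; Path = Walk ℓ ; stay = done ; follow = move ; path-++ = walk-++ ; lipschitz = walk-lipschitz }

  open LengthSpace lengthSpace using (Dist; mkDist)

  Distance⇒Dist : ∀ {p q d} → Distance ℓ p q d → Dist p q d
  Distance⇒Dist D = mkDist (Distance.lower D) (Distance.greatest D)

  Dist⇒Distance : ∀ {p q d} → Dist p q d → Distance ℓ p q d
  Dist⇒Distance (mkDist lower greatest) = record { lower = lower ; greatest = greatest }

module RootedIsometries (em : ExcludedMiddle 0ℓ) {T₁ T₂ : RootedTree}
                        {ℓ₁ : LengthFunction T₁} {ℓ₂ : LengthFunction T₂} (φ : RootedIsometry ℓ₁ ℓ₂) where
  private
    module M₁ = Realization em T₁ ℓ₁
    module M₂ = Realization em T₂ ℓ₂
    module ≼₂ = PointOrder M₂.realizedTree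
  open RootedIsometry φ

  pointIso : PointIso M₁.realizedTree M₂.realizedTree
  pointIso = Isometry.isometry⇒PointIso em M₁.lengthSpace M₂.lengthSpace to
    (λ p q d D → M₂.Distance⇒Dist (isometric p q d (M₁.Dist⇒Distance D)))
    (λ q → proj₁ (surjective q) , M₂.Distance⇒Dist (proj₂ (surjective q)))
    (M₂.Distance⇒Dist to-root)

  sameCapacities : ∀ {χ₁ χ₂} → Carries χ₁ χ₂ → SameCapacities pointIso χ₁ χ₂
  sameCapacities carries l m l≼m m≼l = carries l m (M₂.Dist⇒Distance
    (Distances.≼≽⇒Dist em M₂.lengthSpace
      (≼₂.≼-trans (to-mono l≼m) (proj₁ (to∘from (vertex (Leaf.vertex m)))))
      (≼₂.≼-trans (proj₂ (to∘from (vertex (Leaf.vertex m)))) (to-mono m≼l))))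
    where open PointIso pointIso using (to-mono; to∘from)

-- The newest choice stands last in a prefix, whereas energies and optimal lists grow at the head.
tabulate-↭ : ∀ {A : Set} n (f : Fin (suc n) → A) →
             tabulate f ↭ f (fromℕ n) ∷ tabulate (f ∘ inject₁)
tabulate-↭ zero    f = ↭-refl
tabulate-↭ (suc n) f =
  ↭-trans (prep (f Fin.zero) (tabulate-↭ n (f ∘ Fin.suc))) (swap (f Fin.zero) _ ↭-refl)

0≤∞ : ∀ k → 0 ≤∞ k
0≤∞ (fin _) = z≤n
0≤∞ ∞       = tt

≤∞-extensional : ∀ k l → (∀ n → n ≤∞ k → n ≤∞ l) → (∀ n → n ≤∞ l → n ≤∞ k) → k ≡ l
≤∞-extensional (fin m) (fin n) ⊆ ⊇ = cong fin (ℕ.≤-antisym (⊆ m ℕ.≤-refl) (⊇ n ℕ.≤-refl))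
≤∞-extensional (fin m) ∞       ⊆ ⊇ = contradiction (⊇ (suc m) tt) ℕ.1+n≰n
≤∞-extensional ∞       (fin n) ⊆ ⊇ = contradiction (⊆ (suc n) tt) ℕ.1+n≰n
≤∞-extensional ∞       ∞       ⊆ ⊇ = refl

module Greedy (em : ExcludedMiddle 0ℓ) {T : RootedTree} (ℓ : LengthFunction T) (χ : CapacityFunction T) where
  private
    G = ℝ-Order.ℝ-orderedAbelianGroup em
    module R = OrderedAbelianGroup G
  open TreeProperties T
  open Realization em T ℓ using (realizedTree)
  open RealizedTree realizedTree using (height; totalLength)
  open Configurations em realizedTree χ
  open Counting em
  open Sums G using (foldr-tabulate)

  private
    module _ {n : ℕ} (σ : Vector (ExtendedBoundary T) n) where

      pairing⇒≈ : ∀ ρ τ {c} → Distinct ρ τ → Pairing ℓ ρ τ c → c ≈ᴿ pairing ρ τ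
      pairing⇒≈ ρ τ {c} d (es , c≈) =
        let w , m = meet em ρ τ d
        in R.≈-trans {c} {totalLength (proj₁ es)} {pairing ρ τ} c≈
             (R.≈-trans {totalLength (proj₁ es)} {height w} {pairing ρ τ} (commonEdges-height m es)
               (R.≈-sym {pairing ρ τ} {height w} (pairing-meet m)))

      pairing-Pairing : ∀ ρ τ → Distinct ρ τ → Pairing ℓ ρ τ (pairing ρ τ)
      pairing-Pairing ρ τ d =
        let w , m = meet em ρ τ d
            es = meet⇒commonEdges m
        in es , R.≈-trans {pairing ρ τ} {height w} {totalLength (proj₁ es)} (pairing-meet m)
             (R.≈-sym {totalLength (proj₁ es)} {height w} (commonEdges-height m es))

      sum⇒≈ : ∀ ρ {s} → All (Distinct ρ) (tabulate σ) → PairingSum ℓ σ ρ s → s ≈ᴿ value ρ (tabulate σ)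
      sum⇒≈ ρ {s} ds (c , pc , s≈) =
        R.≈-trans {s} {Vector.foldr _+ᴿ_ 0ᴿ c} {value ρ (tabulate σ)} s≈
          (foldr-tabulate (pairing ρ) σ c λ j → pairing⇒≈ ρ (σ j) {c j} (All.tabulate⁻ ds j) (pc j))

      value-PairingSum : ∀ ρ → All (Distinct ρ) (tabulate σ) → PairingSum ℓ σ ρ (value ρ (tabulate σ))
      value-PairingSum ρ ds = c , (λ j → pairing-Pairing ρ (σ j) (All.tabulate⁻ ds j)) ,
        R.≈-sym {Vector.foldr _+ᴿ_ 0ᴿ c} {value ρ (tabulate σ)}
          (foldr-tabulate (pairing ρ) σ c λ j → R.≈-refl {c j})
        where c = λ j → pairing ρ (σ j)

      enumerate : ∀ P → Enumeration {Fin n} P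
      enumerate P = filter P? (allFin n) , Unique.filter⁺ P? (Unique.allFin⁺ n) , λ j → mk⇔
        (λ j∈ → proj₂ (∈-filter⁻ P? {xs = allFin n} j∈)) (∈-filter⁺ P? (∈-allFin j))
        where
        P? : ∀ j → Dec (P j)
        P? j = em

      enumerate-occurrences : ∀ l → length (proj₁ (enumerate λ j → _≋_ T (σ j) (leaf l)))
                                    ≡ occurrences l (tabulate σ)
      enumerate-occurrences l = trans (sym (count-map σ (allFin n)))
        (cong (occurrences l) (map-tabulate id σ))

      admissible⁺ : ∀ ρ → Admissible ℓ χ σ ρ → AdmissibleTo (tabulate σ) ρ
      admissible⁺ (ray ρ)  adm = All.tabulate⁺ adm
      admissible⁺ (leaf l) (js , lt) = subst (_<∞ CapacityFunction.cap χ l)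
        (trans (↭-length (enumeration-↭ js (enumerate _))) (enumerate-occurrences l)) lt

      admissible⁻ : ∀ ρ → AdmissibleTo (tabulate σ) ρ → Admissible ℓ χ σ ρ
      admissible⁻ (ray ρ)  adm = All.tabulate⁻ adm
      admissible⁻ (leaf l) lt  = enumerate _ ,
        subst (_<∞ CapacityFunction.cap χ l) (sym (enumerate-occurrences l)) lt

  -- Minimality in `Choice` concerns elements that come with a `PairingSum`. Every admissible
  -- element has one, because it repeats no ray and therefore meets each earlier choice.
  choice⇒cheapest : ∀ {n} (σ : Vector (ExtendedBoundary T) n) {ρ s} → Choice ℓ χ σ ρ s →
                    Cheapest (tabulate σ) ρ × s ≈ᴿ value ρ (tabulate σ)
  choice⇒cheapest σ {ρ} {s} choice = (adm , λ ρ′ adm′ →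
      R.≤-trans {value ρ L} {s} {value ρ′ L}
        (R.≤-reflexive {value ρ L} {s} (R.≈-sym {s} {value ρ L} s≈))
        (Choice.minimal choice ρ′ (value ρ′ L) (admissible⁻ σ ρ′ adm′)
          (value-PairingSum σ ρ′ (admissible⇒distinct L ρ′ adm′)))) , s≈
    where
    L = tabulate σ
    adm = admissible⁺ σ ρ (Choice.admissible choice)
    s≈ : s ≈ᴿ value ρ L
    s≈ = sum⇒≈ σ ρ {s} (admissible⇒distinct L ρ adm) (Choice.value choice)

  cheapest⇒choice : ∀ {n} (σ : Vector (ExtendedBoundary T) n) {ρ} → Cheapest (tabulate σ) ρ →
                    Choice ℓ χ σ ρ (value ρ (tabulate σ))
  cheapest⇒choice σ {ρ} (adm , cheapest) = record
    { admissible = admissible⁻ σ ρ adm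
    ; value      = value-PairingSum σ ρ (admissible⇒distinct L ρ adm)
    ; minimal    = λ ρ′ s′ adm′ sum′ →
        let adm⁺ = admissible⁺ σ ρ′ adm′
        in R.≤-trans {value ρ L} {value ρ′ L} {s′} (cheapest ρ′ adm⁺)
             (R.≤-reflexive {value ρ′ L} {s′} (R.≈-sym {s′} {value ρ′ L}
               (sum⇒≈ σ ρ′ {s′} (admissible⇒distinct L ρ′ adm⁺) sum′))) }
    where L = tabulate σ

  module _ (r : GreedySequence ℓ χ) where
    open GreedySequence r

    chosen : ∀ n → .(n ≤∞ size) → List (ExtendedBoundary T)
    chosen n n≤size = tabulate (prefix n n≤size)

    length-chosen : ∀ n .(n≤size : n ≤∞ size) → length (chosen n n≤size) ≡ n
    length-chosen n n≤size = length-tabulate (prefix n n≤size)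

    private
      before : ∀ n → n <∞ size → n ≤∞ size
      before n = ≤-≤∞-trans size (ℕ.n≤1+n n)

      ρ-cong : ∀ {m n} .(m<size : m <∞ size) .(n<size : n <∞ size) → m ≡ n → ρ m m<size ≡ ρ n n<size
      ρ-cong _ _ refl = refl

      chosen-suc : ∀ n (n<size : n <∞ size) →
                   chosen (suc n) n<size ↭ ρ n n<size ∷ chosen n (before n n<size)
      chosen-suc n n<size = ↭-trans (tabulate-↭ n (prefix (suc n) n<size)) (↭-reflexive
        (cong₂ _∷_ (ρ-cong _ _ (toℕ-fromℕ n)) (tabulate-cong λ j → ρ-cong _ _ (toℕ-inject₁ j))))

      cheapest : ∀ n (n<size : n <∞ size) →
                 Cheapest (chosen n (before n n<size)) (ρ n n<size) ×
                 a n n<size ≈ᴿ value (ρ n n<size) (chosen n (before n n<size))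
      cheapest n n<size = choice⇒cheapest (prefix n (before n n<size)) (greedy n n<size)

    chosen-optimal : ∀ n (n≤size : n ≤∞ size) → Optimal (chosen n n≤size)
    chosen-optimal zero    _      = optimal-[]
    chosen-optimal (suc n) n<size = optimal-↭ (↭-sym (chosen-suc n n<size))
      (optimal-∷ (chosen-optimal n (before n n<size)) (proj₁ (cheapest n n<size)))

    chosen-energy : ∀ n (n<size : n <∞ size) →
                    energy (chosen (suc n) n<size) ≈ᴿ a n n<size +ᴿ energy (chosen n (before n n<size))
    chosen-energy n n<size = R.≈-trans {energy (chosen (suc n) n<size)} {v +ᴿ E} {a n n<size +ᴿ E}
      (energy-↭ (chosen-suc n n<size))
      (R.+-cong {v} {a n n<size} {E} {E} (R.≈-sym {a n n<size} {v} (proj₂ (cheapest n n<size))) (R.≈-refl {E}))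
      where
      v = value (ρ n n<size) (chosen n (before n n<size))
      E = energy (chosen n (before n n<size))

    optimal⇒continues : ∀ n (n≤size : n ≤∞ size) {L} → Optimal L → length L ≡ suc n → n <∞ size
    optimal⇒continues n n≤size L-opt eq =
      let ρ , ρ-cheapest = optimal-extends (chosen-optimal n n≤size) L-opt
                             (trans eq (cong suc (sym (length-chosen n n≤size))))
      in maximal n n≤size (ρ , _ , cheapest⇒choice (prefix n n≤size) ρ-cheapest)

-- Comparison of two greedy sequences

module Comparison (em : ExcludedMiddle 0ℓ) {T₁ T₂ : RootedTree}
                  {ℓ₁ : LengthFunction T₁} {ℓ₂ : LengthFunction T₂}
                  {χ₁ : CapacityFunction T₁} {χ₂ : CapacityFunction T₂}
                  (φ : PointIso (Realization.realizedTree em T₁ ℓ₁) (Realization.realizedTree em T₂ ℓ₂))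
                  (same : SameCapacities φ χ₁ χ₂)
                  (r₁ : GreedySequence ℓ₁ χ₁) (r₂ : GreedySequence ℓ₂ χ₂) where
  private
    G = ℝ-Order.ℝ-orderedAbelianGroup em
    module R = OrderedAbelianGroup G
    module M₁ = Realization em T₁ ℓ₁
    module M₂ = Realization em T₂ ℓ₂
    module C₁ = Configurations em M₁.realizedTree χ₁
    module C₂ = Configurations em M₂.realizedTree χ₂
    module G₁ = Greedy em ℓ₁ χ₁
    module G₂ = Greedy em ℓ₂ χ₂
  open GreedySequence

  private
    transported = λ n n≤size → image-optimal em φ {χ₁} {χ₂} same (G₁.chosen-optimal r₁ n n≤size)

    length-transported : ∀ n n≤size → length (map (Boundary.image em φ) (G₁.chosen r₁ n n≤size)) ≡ n
    length-transported n n≤size = trans (length-map _ (G₁.chosen r₁ n n≤size)) (G₁.length-chosen r₁ n n≤size)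

  -- The image of the first n + 1 choices of `r₁` is an optimal list for the second triple. It
  -- guarantees that after n choices `r₂` still finds an attained minimum.
  continues : ∀ n → n ≤∞ size r₁ → n ≤∞ size r₂
  continues zero    _      = 0≤∞ (size r₂)
  continues (suc n) n<size = G₂.optimal⇒continues r₂ n
    (continues n (≤-≤∞-trans (size r₁) (ℕ.n≤1+n n) n<size))
    (proj₁ (transported (suc n) n<size)) (length-transported (suc n) n<size)

  energies-≈ : ∀ n (n≤size₁ : n ≤∞ size r₁) (n≤size₂ : n ≤∞ size r₂) →
               C₁.energy (G₁.chosen r₁ n n≤size₁) ≈ᴿ C₂.energy (G₂.chosen r₂ n n≤size₂)
  energies-≈ n n≤size₁ n≤size₂ = R.≈-trans
    {C₁.energy (G₁.chosen r₁ n n≤size₁)}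
    {C₂.energy (map (Boundary.image em φ) (G₁.chosen r₁ n n≤size₁))}
    {C₂.energy (G₂.chosen r₂ n n≤size₂)}
    (proj₂ (transported n n≤size₁))
    (C₂.optimal-≈ (proj₁ (transported n n≤size₁)) (G₂.chosen-optimal r₂ n n≤size₂)
      (trans (length-transported n n≤size₁) (sym (G₂.length-chosen r₂ n n≤size₂))))

  values-≈ : ∀ n (n<size₁ : n <∞ size r₁) (n<size₂ : n <∞ size r₂) → a r₁ n n<size₁ ≈ᴿ a r₂ n n<size₂
  values-≈ n n<size₁ n<size₂ =
    OrderedAbelianGroupProperties.increments-≈ G {a₁} {a₂} {E₁} {E₁⁺} {E₂} {E₂⁺}
      (G₁.chosen-energy r₁ n n<size₁) (G₂.chosen-energy r₂ n n<size₂)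
      (energies-≈ n n≤size₁ n≤size₂) (energies-≈ (suc n) n<size₁ n<size₂)
    where
    a₁ = a r₁ n n<size₁
    a₂ = a r₂ n n<size₂
    E₁⁺ = C₁.energy (G₁.chosen r₁ (suc n) n<size₁)
    E₂⁺ = C₂.energy (G₂.chosen r₂ (suc n) n<size₂)
    n≤size₁ = ≤-≤∞-trans (size r₁) (ℕ.n≤1+n n) n<size₁
    n≤size₂ = ≤-≤∞-trans (size r₂) (ℕ.n≤1+n n) n<size₂
    E₁ = C₁.energy (G₁.chosen r₁ n n≤size₁)
    E₂ = C₂.energy (G₂.chosen r₂ n n≤size₂)

theorem1p3 : ExcludedMiddle 0ℓ →
    (T₁ T₂ : RootedTree) → LocallyFinite T₁ → LocallyFinite T₂ →
    (ℓ₁ : LengthFunction T₁) (ℓ₂ : LengthFunction T₂) →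
    (χ₁ : CapacityFunction T₁) (χ₂ : CapacityFunction T₂) →
    (φ : RootedIsometry ℓ₁ ℓ₂) → RootedIsometry.Carries φ χ₁ χ₂ →
    (r₁ : GreedySequence ℓ₁ χ₁) (r₂ : GreedySequence ℓ₂ χ₂) →
    GreedySequence.size r₁ ≡ GreedySequence.size r₂ ×
    ((n : ℕ) (n<size₁ : n <∞ GreedySequence.size r₁)
    (n<size₂ : n <∞ GreedySequence.size r₂) →
    GreedySequence.a r₁ n n<size₁ ≈ᴿ GreedySequence.a r₂ n n<size₂)
theorem1p3 em T₁ T₂ _ _ ℓ₁ ℓ₂ χ₁ χ₂ φ carries r₁ r₂ =
  ≤∞-extensional _ _ Forth.continues Back.continues , Forth.values-≈
  where
  open RootedIsometries em φ
  same : SameCapacities pointIso χ₁ χ₂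
  same = sameCapacities {χ₁} {χ₂} carries
  module Forth = Comparison em pointIso same r₁ r₂
  module Back = Comparison em (PointIso-sym pointIso)
                  (SameCapacities-sym {φ = pointIso} {χ₁} {χ₂} same) r₂ r₁
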